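{- For every integer $n\ge0$, \[ r_{24}(n)=(-1)^{n}\,64\left(\sum_{j=0}^{n}\sigma_5^{*}(j)\sigma_5^{*}(n-j)-\tau(n)\right)=(-1)^{n}\frac{512}{17}\left(\sum_{j=0}^{n}\sigma_3^{*}(j)\sigma_7^{*}(n-j)-\tau(n)\right). \]
   Context: $r_{24}(n)$ is the number of $(m_1,\dots,m_{24})\in\mathbb{Z}^{24}$ with $m_1^2+\cdots+m_{24}^2=n$. For $n,s\ge1$, $\sigma^{*}_{s}(n)=-\sum_{d\mid n}(-1)^{d}d^{s}$; by convention $\sigma^*_3(0)=-\frac1{16}$, $\sigma^*_5(0)=\frac18$, $\sigma^*_7(0)=-\frac{17}{32}$. Ramanujan's tau function is defined by $q\prod_{n\ge1}(1-q^n)^{24}=\sum_{n\ge1}\tau(n)q^n$, and $\tau(0)=0$. -}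

module Defs where

open import Data.Nat as ℕ using (ℕ; zero; suc)
open import Data.Nat.Divisibility using (_∣?_)
open import Data.Integer as ℤ using (ℤ; +_; -[1+_])
open import Data.Rational as ℚ using (ℚ; _/_)
open import Data.List using (List; []; _∷_; length; filter; map; sum; concatMap; upTo)
open import Data.Vec using (Vec; []; _∷_)
open import Relation.Nullary.Decidable using (⌊_⌋)
open import Data.Bool using (if_then_else_)

-- r₂₄(n): number of (m₁,…,m₂₄) ∈ ℤ²⁴ with m₁² + ⋯ + m₂₄² = n.
-- Any such tuple has |mᵢ| ≤ n, so it suffices to enumerate the finite box
-- [-n, n]^k and count the tuples whose sum of squares is n.

intRange : ℕ → List ℤ
intRange n = map (λ i → + i) (upTo (suc n)) Data.List.++ map (λ i → -[1+ i ]) (upTo n)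

allVecs : (k : ℕ) → List ℤ → List (Vec ℤ k)
allVecs zero    xs = [] ∷ []
allVecs (suc k) xs = concatMap (λ x → map (x ∷_) (allVecs k xs)) xs

sumSq : {k : ℕ} → Vec ℤ k → ℕ
sumSq []       = 0
sumSq (m ∷ ms) = ℤ.∣ m ℤ.* m ∣ ℕ.+ sumSq ms

r : ℕ → ℕ → ℕ
r k n = length (filter (λ v → sumSq v ℕ.≟ n) (allVecs k (intRange n)))

r24 : ℕ → ℕ
r24 = r 24

sign : ℕ → ℤ
sign d = if ⌊ 2 ∣? d ⌋ then + 1 else ℤ.- (+ 1)

divisors : ℕ → List ℕ
divisors n = filter (λ d → d ∣? n) (map suc (upTo n))

σ*pos : ℕ → ℕ → ℤ
σ*pos s n = ℤ.- sum′ (map (λ d → sign d ℤ.* (+ (d ℕ.^ s))) (divisors n))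
  where
  sum′ : List ℤ → ℤ
  sum′ []       = + 0
  sum′ (x ∷ xs) = x ℤ.+ sum′ xs

σ*3 : ℕ → ℚ
σ*3 zero        = ℤ.- (+ 1) / 16
σ*3 n@(suc _)   = σ*pos 3 n / 1

σ*5 : ℕ → ℚ
σ*5 zero        = (+ 1) / 8
σ*5 n@(suc _)   = σ*pos 5 n / 1

σ*7 : ℕ → ℚ
σ*7 zero        = ℤ.- (+ 17) / 32
σ*7 n@(suc _)   = σ*pos 7 n / 1

-- Ramanujan's τ: q ∏_{n≥1} (1 - q^n)^24 = Σ τ(n) q^n, τ(0) = 0.
-- Formal power series over ℤ as coefficient functions ℕ → ℤ.

Series : Set
Series = ℕ → ℤ

Σ≤ : ℕ → (ℕ → ℤ) → ℤ
Σ≤ zero    f = f 0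
Σ≤ (suc n) f = Σ≤ n f ℤ.+ f (suc n)

oneS : Series
oneS zero    = + 1
oneS (suc _) = + 0

_*S_ : Series → Series → Series
(f *S g) n = Σ≤ n (λ j → f j ℤ.* g (n ℕ.∸ j))

_^S_ : Series → ℕ → Series
f ^S zero  = oneS
f ^S suc e = f *S (f ^S e)

oneMinusQ : ℕ → Series
oneMinusQ k n = if ⌊ n ℕ.≟ 0 ⌋ then + 1 else (if ⌊ n ℕ.≟ k ⌋ then ℤ.- (+ 1) else + 0)

etaProd : ℕ → Series
etaProd zero    = oneS
etaProd (suc N) = etaProd N *S (oneMinusQ (suc N) ^S 24)

-- coefficient of q^(n+1) in q ∏_{k≥1}(1-q^k)^24 is the coefficient of q^n in
-- ∏_{k≥1}(1-q^k)^24, which equals that of the finite product over k ≤ n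
-- (factors with k > n are ≡ 1 mod q^(n+1)).
τ : ℕ → ℤ
τ zero    = + 0
τ (suc n) = etaProd n n

τℚ : ℕ → ℚ
τℚ n = τ n / 1

conv : (ℕ → ℚ) → (ℕ → ℚ) → ℕ → ℚ
conv f g n = go n
  where
  go : ℕ → ℚ
  go zero    = f 0 ℚ.* g n
  go (suc j) = go j ℚ.+ f (suc j) ℚ.* g (n ℕ.∸ suc j)

signℚ : ℕ → ℚ
signℚ n = sign n / 1

{-# OPTIONS --safe #-}
-- Everything takes place in ℤ[[q]]/(q^{N+1}) with D = q d/dq.  Put
--   p = -16 Σ σ*₃(n) q^n,  s₅ = 8 Σ σ*₅(n) q^n,  s₇ = -32 Σ σ*₇(n) q^n,
--   Y = 1 - 8 Σ (Σ_{d∣n} (-1)^d d) q^n,  A = 1 + 12 Σ (Σ_{d∣n} (1 - (-1)^d) d) q^n.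
-- With g_a = q^a/(1-q^a) one has g_a g_b = g_{a+b}(1 + g_a + g_b).  Summing this against
-- suitable weights F(a,b) yields, at the 2-torsion point z = -1, the Taylor coefficients of
-- the heat equation and of ℘'' = 6℘² - g₂/2:
--   s₅ = A p,  s₇ = 9p² + 8A s₅,  D p = Y p - s₅,  8 D s₅ = 12 Y s₅ - s₇ + 5p².
-- Hence D p = p (Y - A), and Y - A is also the logarithmic derivative of θ(-q)⁸ by Gauss'
-- product ∏ (1-q^k)/(1+q^k) = Σ (-1)^s q^{s²}, so p = θ(-q)⁸.  Likewise s₅² - p³ has the
-- logarithmic derivative 3Y - 2A = 1 - 24 Σ σ(n) q^n of Δ = q ∏ (1-q^k)²⁴, so
-- s₅² - p³ = 64 Δ.  This is the first formula for p³ = θ(-q)²⁴, and the second follows from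
-- p s₇ = 9p³ + 8s₅².
module Submission where

open import Defs
open import Algebra.Bundles using (CommutativeRing; RawRing)
import Algebra.Properties.Semiring.Exp
import Algebra.Solver.Ring
open import Algebra.Solver.Ring.AlmostCommutativeRing using (fromCommutativeRing; _-Raw-AlmostCommutative⟶_)
open import Data.Bool using (if_then_else_)
open import Data.Fin.Patterns using (0F; 1F; 2F; 3F; 4F)
open import Data.Integer as ℤ using (ℤ; +_; -[1+_])
import Data.Integer.Properties as ℤ
import Data.Integer.Solver
open import Data.Integer.Tactic.RingSolver using (solve-∀)
open import Data.List as List using (List; []; _∷_; _++_; map; filter; upTo; length; concatMap)
import Data.List.Properties as List
open import Data.Maybe using (Maybe; just; nothing)
open import Data.Nat as ℕ using (ℕ; zero; suc; pred; z≤n; s≤s)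
open import Data.Nat.Divisibility using (_∣_; _∣?_; ∣m+n∣m⇒∣n; ∣m∣n⇒∣m+n; ∣-refl; ∣⇒≤)
import Data.Nat.Properties as ℕ
open import Data.Product using (_×_; _,_)
import Data.Rational.Solver
open import Data.Sum using (inj₁; inj₂)
open import Data.Vec using (Vec; []; _∷_)
open import Function using (_∘_; case_of_)
open import Level using (0ℓ)
open import Relation.Binary.PropositionalEquality as ≡ using (_≡_; refl; sym; trans; cong; cong₂; subst)
open import Relation.Nullary using (¬_; yes; no; contradiction)
open import Relation.Nullary.Decidable using (⌊_⌋)

-- Power series over ℤ

-- The sum of F(a,b) g_a g_b over a, b ≥ 1 is computed twice. Splitting off a = b and grouping by a
-- + b both leave terms g_c g_a with a < c, weighted by F(c,a) and by F(c-a,a). If these weights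
-- differ by W(c,a), and W is a combination of products of one-variable weights, then products of
-- Lambert series are expressed by single Lambert series, up to squares g_a², which are derivatives.
-- Equal logarithmic derivatives give equal series by recursion on coefficients: D h = h e
-- determines h_n from the lower coefficients unless n = e(0). This resonance is at 0 for θ(-q)⁸ and
-- at 1 for Δ, so one coefficient must be compared by hand in each case. The second comparison is
-- the origin of 64 = 2·8 + 3·16. The n-th coefficient only needs the ring modulo q^{n+1}, where all
-- sums and products are finite. The relations are kept over ℤ, with inverses as explicit elements.
-- The ring stays abstract throughout the Lambert argument, so that normalisation never unfolds a
-- convolution.

Σ≤-cong : ∀ n {f g : ℕ → ℤ} → (∀ {j} → j ℕ.≤ n → f j ≡ g j) → Σ≤ n f ≡ Σ≤ n g
Σ≤-cong zero    e = e z≤n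
Σ≤-cong (suc n) e = cong₂ ℤ._+_ (Σ≤-cong n (e ∘ ℕ.m≤n⇒m≤1+n)) (e ℕ.≤-refl)

Σ≤-+ : ∀ n (f g : ℕ → ℤ) → Σ≤ n (λ j → f j ℤ.+ g j) ≡ Σ≤ n f ℤ.+ Σ≤ n g
Σ≤-+ zero    f g = refl
Σ≤-+ (suc n) f g = trans (cong (ℤ._+ (f (suc n) ℤ.+ g (suc n))) (Σ≤-+ n f g))
                         (interchange (Σ≤ n f) (Σ≤ n g) (f (suc n)) (g (suc n)))
  where
  interchange : ∀ a b c d → (a ℤ.+ b) ℤ.+ (c ℤ.+ d) ≡ (a ℤ.+ c) ℤ.+ (b ℤ.+ d)
  interchange = solve-∀

Σ≤-*ˡ : ∀ n c (f : ℕ → ℤ) → Σ≤ n (λ j → c ℤ.* f j) ≡ c ℤ.* Σ≤ n f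
Σ≤-*ˡ zero    c f = refl
Σ≤-*ˡ (suc n) c f = trans (cong (ℤ._+ (c ℤ.* f (suc n))) (Σ≤-*ˡ n c f))
                          (sym (ℤ.*-distribˡ-+ c (Σ≤ n f) (f (suc n))))

Σ≤-0 : ∀ n {f : ℕ → ℤ} → (∀ {j} → j ℕ.≤ n → f j ≡ + 0) → Σ≤ n f ≡ + 0
Σ≤-0 zero    e = e z≤n
Σ≤-0 (suc n) e = cong₂ ℤ._+_ (Σ≤-0 n (e ∘ ℕ.m≤n⇒m≤1+n)) (e ℕ.≤-refl)

Σ≤-front : ∀ n (f : ℕ → ℤ) → Σ≤ (suc n) f ≡ f 0 ℤ.+ Σ≤ n (f ∘ suc)
Σ≤-front zero    f = refl
Σ≤-front (suc n) f = trans (cong (ℤ._+ f (suc (suc n))) (Σ≤-front n f))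
                           (ℤ.+-assoc (f 0) (Σ≤ n (f ∘ suc)) (f (suc (suc n))))

infixl 6 _+S_
infix  8 -S_

zeroS : Series
zeroS _ = + 0

_+S_ : Series → Series → Series
(f +S g) n = f n ℤ.+ g n

-S_ : Series → Series
(-S f) n = ℤ.- f n

const : ℤ → Series
const c zero    = c
const c (suc _) = + 0

mono : ℕ → Series
mono k n = if ⌊ n ℕ.≟ k ⌋ then + 1 else + 0

tail : Series → Series
tail f n = f (suc n)

θ∂ : Series → Series
θ∂ f n = + n ℤ.* f n

*S-front : ∀ f g n → (f *S g) (suc n) ≡ f 0 ℤ.* g (suc n) ℤ.+ (tail f *S g) n
*S-front f g n = Σ≤-front n (λ j → f j ℤ.* g (suc n ℕ.∸ j))

*S-back : ∀ f g n → (f *S g) (suc n) ≡ (f *S tail g) n ℤ.+ f (suc n) ℤ.* g 0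
*S-back f g n = cong₂ ℤ._+_
  (Σ≤-cong n (λ {j} j≤n → cong (λ k → f j ℤ.* g k) (ℕ.+-∸-assoc 1 j≤n)))
  (cong (λ k → f (suc n) ℤ.* g k) (ℕ.n∸n≡0 n))

*S-cong : ∀ {N f f′ g g′} → (∀ {n} → n ℕ.≤ N → f n ≡ f′ n) → (∀ {n} → n ℕ.≤ N → g n ≡ g′ n) →
          ∀ {n} → n ℕ.≤ N → (f *S g) n ≡ (f′ *S g′) n
*S-cong e e′ {n} n≤N = Σ≤-cong n λ {j} j≤n →
  cong₂ ℤ._*_ (e (ℕ.≤-trans j≤n n≤N)) (e′ (ℕ.≤-trans (ℕ.m∸n≤m n j) n≤N))

-- Peeling the first term of one product and the last term of the other exposes the same summand;
-- the rest is `tail f` against `g`, one degree lower.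
*S-comm : ∀ f g n → (f *S g) n ≡ (g *S f) n
*S-comm f g zero    = ℤ.*-comm (f 0) (g 0)
*S-comm f g (suc n) = begin
  (f *S g) (suc n)                               ≡⟨ *S-front f g n ⟩
  f 0 ℤ.* g (suc n) ℤ.+ (tail f *S g) n          ≡⟨ cong₂ ℤ._+_ (ℤ.*-comm (f 0) (g (suc n))) (*S-comm (tail f) g n) ⟩
  g (suc n) ℤ.* f 0 ℤ.+ (g *S tail f) n          ≡⟨ ℤ.+-comm (g (suc n) ℤ.* f 0) _ ⟩
  (g *S tail f) n ℤ.+ g (suc n) ℤ.* f 0          ≡⟨ *S-back g f n ⟨
  (g *S f) (suc n)                               ∎
  where open ≡.≡-Reasoning

*S-distribˡ : ∀ f g h n → (f *S (g +S h)) n ≡ (f *S g) n ℤ.+ (f *S h) n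
*S-distribˡ f g h n = trans
  (Σ≤-cong n (λ {j} _ → ℤ.*-distribˡ-+ (f j) (g (n ℕ.∸ j)) (h (n ℕ.∸ j))))
  (Σ≤-+ n (λ j → f j ℤ.* g (n ℕ.∸ j)) (λ j → f j ℤ.* h (n ℕ.∸ j)))

*S-distribʳ : ∀ f g h n → ((g +S h) *S f) n ≡ (g *S f) n ℤ.+ (h *S f) n
*S-distribʳ f g h n = trans (*S-comm (g +S h) f n)
  (trans (*S-distribˡ f g h n) (cong₂ ℤ._+_ (*S-comm f g n) (*S-comm f h n)))

scale-*S : ∀ c f g n → ((λ j → c ℤ.* f j) *S g) n ≡ c ℤ.* (f *S g) n
scale-*S c f g n = trans (Σ≤-cong n (λ {j} _ → ℤ.*-assoc c (f j) (g (n ℕ.∸ j))))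
                         (Σ≤-*ˡ n c (λ j → f j ℤ.* g (n ℕ.∸ j)))

-- Induction on the degree for all `f` at once: writing f = f 0 + q · `tail f`, degree n + 1 reduces
-- to a scalar part and to degree n with `tail f` in place of `f`.
*S-assoc : ∀ f g h n → ((f *S g) *S h) n ≡ (f *S (g *S h)) n
*S-assoc f g h zero    = ℤ.*-assoc (f 0) (g 0) (h 0)
*S-assoc f g h (suc n) = begin
  ((f *S g) *S h) (suc n)
    ≡⟨ *S-front (f *S g) h n ⟩
  f 0 ℤ.* g 0 ℤ.* h (suc n) ℤ.+ (tail (f *S g) *S h) n
    ≡⟨ cong (λ x → f 0 ℤ.* g 0 ℤ.* h (suc n) ℤ.+ x) (*S-cong {n} {g = h} (λ {k} _ → *S-front f g k) (λ _ → refl) ℕ.≤-refl) ⟩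
  f 0 ℤ.* g 0 ℤ.* h (suc n) ℤ.+ (((λ k → f 0 ℤ.* tail g k) +S (tail f *S g)) *S h) n
    ≡⟨ cong (λ x → f 0 ℤ.* g 0 ℤ.* h (suc n) ℤ.+ x) (*S-distribʳ h (λ k → f 0 ℤ.* tail g k) (tail f *S g) n) ⟩
  f 0 ℤ.* g 0 ℤ.* h (suc n) ℤ.+ (((λ k → f 0 ℤ.* tail g k) *S h) n ℤ.+ ((tail f *S g) *S h) n)
    ≡⟨ cong (λ x → f 0 ℤ.* g 0 ℤ.* h (suc n) ℤ.+ x) (cong₂ ℤ._+_ (scale-*S (f 0) (tail g) h n) (*S-assoc (tail f) g h n)) ⟩
  f 0 ℤ.* g 0 ℤ.* h (suc n) ℤ.+ (f 0 ℤ.* (tail g *S h) n ℤ.+ (tail f *S (g *S h)) n)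
    ≡⟨ rearrange (f 0) (g 0) (h (suc n)) ((tail g *S h) n) ((tail f *S (g *S h)) n) ⟩
  f 0 ℤ.* (g 0 ℤ.* h (suc n) ℤ.+ (tail g *S h) n) ℤ.+ (tail f *S (g *S h)) n
    ≡⟨ cong (λ x → f 0 ℤ.* x ℤ.+ (tail f *S (g *S h)) n) (*S-front g h n) ⟨
  f 0 ℤ.* (g *S h) (suc n) ℤ.+ (tail f *S (g *S h)) n
    ≡⟨ *S-front f (g *S h) n ⟨
  (f *S (g *S h)) (suc n) ∎
  where
  open ≡.≡-Reasoning
  rearrange : ∀ a b c x y → a ℤ.* b ℤ.* c ℤ.+ (a ℤ.* x ℤ.+ y) ≡ a ℤ.* (b ℤ.* c ℤ.+ x) ℤ.+ y
  rearrange = solve-∀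

zero-*S : ∀ f n → (zeroS *S f) n ≡ + 0
zero-*S f n = Σ≤-0 n (λ {j} _ → ℤ.*-zeroˡ (f (n ℕ.∸ j)))

const-*S : ∀ c f n → (const c *S f) n ≡ c ℤ.* f n
const-*S c f zero    = refl
const-*S c f (suc n) = trans (*S-front (const c) f n)
  (trans (cong (λ x → c ℤ.* f (suc n) ℤ.+ x) (zero-*S f n)) (ℤ.+-identityʳ _))

oneS≡const : ∀ n → oneS n ≡ const (+ 1) n
oneS≡const zero    = refl
oneS≡const (suc _) = refl

one-*S : ∀ f n → (oneS *S f) n ≡ f n
one-*S f n = trans (*S-cong {n} {g = f} (λ {k} _ → oneS≡const k) (λ _ → refl) ℕ.≤-refl)
                   (trans (const-*S (+ 1) f n) (ℤ.*-identityˡ (f n)))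

θ∂-*S : ∀ f g n → θ∂ (f *S g) n ≡ (θ∂ f *S g) n ℤ.+ (f *S θ∂ g) n
θ∂-*S f g n = begin
  + n ℤ.* Σ≤ n (λ j → f j ℤ.* g (n ℕ.∸ j))
    ≡⟨ Σ≤-*ˡ n (+ n) (λ j → f j ℤ.* g (n ℕ.∸ j)) ⟨
  Σ≤ n (λ j → + n ℤ.* (f j ℤ.* g (n ℕ.∸ j)))
    ≡⟨ Σ≤-cong n (λ {j} j≤n → trans
         (cong (λ k → + k ℤ.* (f j ℤ.* g (n ℕ.∸ j))) (sym (ℕ.m+[n∸m]≡n j≤n)))
         (split (+ j) (+ (n ℕ.∸ j)) (f j) (g (n ℕ.∸ j)))) ⟩
  Σ≤ n (λ j → + j ℤ.* f j ℤ.* g (n ℕ.∸ j) ℤ.+ f j ℤ.* (+ (n ℕ.∸ j) ℤ.* g (n ℕ.∸ j)))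
    ≡⟨ Σ≤-+ n _ _ ⟩
  (θ∂ f *S g) n ℤ.+ (f *S θ∂ g) n ∎
  where
  open ≡.≡-Reasoning
  split : ∀ a b x y → (a ℤ.+ b) ℤ.* (x ℤ.* y) ≡ a ℤ.* x ℤ.* y ℤ.+ x ℤ.* (b ℤ.* y)
  split = solve-∀

-- Monomials and geometric series

mono-same : ∀ k → mono k k ≡ + 1
mono-same k with k ℕ.≟ k
... | yes _  = refl
... | no k≢k = contradiction refl k≢k

mono-other : ∀ {k n} → ¬ n ≡ k → mono k n ≡ + 0
mono-other {k} {n} n≢k with n ℕ.≟ k
... | yes n≡k = contradiction n≡k n≢k
... | no _    = refl

mono-suc : ∀ k n → mono (suc k) (suc n) ≡ mono k n
mono-suc k n with n ℕ.≟ k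
... | yes refl = mono-same (suc k)
... | no n≢k   = mono-other (n≢k ∘ ℕ.suc-injective)

mono-0 : ∀ n → mono 0 n ≡ oneS n
mono-0 zero    = refl
mono-0 (suc n) = mono-other {0} {suc n} λ ()

mono-*S-shift : ∀ k f n → (mono k *S f) (k ℕ.+ n) ≡ f n
mono-*S-shift zero    f n = trans (*S-cong {n} {g = f} (λ {j} _ → mono-0 j) (λ _ → refl) ℕ.≤-refl) (one-*S f n)
mono-*S-shift (suc k) f n = begin
  (mono (suc k) *S f) (suc (k ℕ.+ n))
    ≡⟨ *S-front (mono (suc k)) f (k ℕ.+ n) ⟩
  + 0 ℤ.* f (suc (k ℕ.+ n)) ℤ.+ (tail (mono (suc k)) *S f) (k ℕ.+ n)
    ≡⟨ cong₂ ℤ._+_ (ℤ.*-zeroˡ (f (suc (k ℕ.+ n))))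
         (*S-cong {k ℕ.+ n} {g = f} (λ {j} _ → mono-suc k j) (λ _ → refl) ℕ.≤-refl) ⟩
  + 0 ℤ.+ (mono k *S f) (k ℕ.+ n)
    ≡⟨ ℤ.+-identityˡ _ ⟩
  (mono k *S f) (k ℕ.+ n)
    ≡⟨ mono-*S-shift k f n ⟩
  f n ∎
  where open ≡.≡-Reasoning

mono-*S-below : ∀ k f {n} → n ℕ.< k → (mono k *S f) n ≡ + 0
mono-*S-below k f {n} n<k = Σ≤-0 n λ {j} j≤n →
  trans (cong (ℤ._* f (n ℕ.∸ j)) (mono-other (ℕ.<⇒≢ (ℕ.≤-<-trans j≤n n<k)))) (ℤ.*-zeroˡ (f (n ℕ.∸ j)))

data SplitAt (k : ℕ) : ℕ → Set where
  below : ∀ {n} → n ℕ.< k → SplitAt k n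
  above : ∀ n → SplitAt k (k ℕ.+ n)

splitAt : ∀ k n → SplitAt k n
splitAt k n with n ℕ.<? k
... | yes n<k = below n<k
... | no n≮k  = subst (SplitAt k) (ℕ.m+[n∸m]≡n (ℕ.≮⇒≥ n≮k)) (above (n ℕ.∸ k))

mono-+ : ∀ k l n → mono (k ℕ.+ l) n ≡ (mono k *S mono l) n
mono-+ k l n with splitAt k n
... | below n<k = trans (mono-other (ℕ.<⇒≢ (ℕ.<-≤-trans n<k (ℕ.m≤m+n k l))))
                        (sym (mono-*S-below k (mono l) n<k))
... | above m   = trans (shift k m) (sym (mono-*S-shift k (mono l) m))
  where
  shift : ∀ k m → mono (k ℕ.+ l) (k ℕ.+ m) ≡ mono l m
  shift zero    m = refl
  shift (suc k) m = trans (mono-suc (k ℕ.+ l) (k ℕ.+ m)) (shift k m)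

θ∂-mono : ∀ k n → θ∂ (mono k) n ≡ + k ℤ.* mono k n
θ∂-mono k n with n ℕ.≟ k
... | yes refl = refl
... | no _     = trans (ℤ.*-zeroʳ (+ n)) (sym (ℤ.*-zeroʳ (+ k)))

geo : ℕ → Series
geo a zero    = + 0
geo a (suc n) = if ⌊ a ∣? suc n ⌋ then + 1 else + 0

geo-∣ : ∀ {a n} → a ∣ suc n → geo a (suc n) ≡ + 1
geo-∣ {a} {n} a∣n with a ∣? suc n
... | yes _  = refl
... | no a∤n = contradiction a∣n a∤n

geo-∤ : ∀ {a n} → ¬ a ∣ suc n → geo a (suc n) ≡ + 0
geo-∤ {a} {n} a∤n with a ∣? suc n
... | yes a∣n = contradiction a∣n a∤n
... | no _    = refl

geo-shift : ∀ a n → geo a (a ℕ.+ suc n) ≡ geo a (suc n)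
geo-shift a n = subst (λ k → geo a k ≡ geo a (suc n)) (sym (ℕ.+-suc a n)) go
  where
  go : geo a (suc (a ℕ.+ n)) ≡ geo a (suc n)
  go with a ∣? suc n
  ... | yes a∣n = geo-∣ (subst (a ∣_) (ℕ.+-suc a n) (∣m∣n⇒∣m+n ∣-refl a∣n))
  ... | no a∤n  = geo-∤ (λ d → a∤n (∣m+n∣m⇒∣n (subst (a ∣_) (sym (ℕ.+-suc a n)) d) ∣-refl))

-- Links the divisibility indicator `geo`, which is suited to divisor sums, with the closed form
-- q^a/(1-q^a), stated without division. The exponent is a successor because 1 - q^0 has no inverse.
geo-rec : ∀ a n → (mono (suc a) *S (const (+ 1) +S geo (suc a))) n ≡ geo (suc a) n
geo-rec a n with splitAt (suc a) n
... | above zero    = trans (mono-*S-shift (suc a) (const (+ 1) +S geo (suc a)) 0)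
                            (sym (geo-∣ (subst (suc a ∣_) (sym (cong suc (ℕ.+-identityʳ a))) ∣-refl)))
... | above (suc m) = trans (mono-*S-shift (suc a) (const (+ 1) +S geo (suc a)) (suc m))
                            (trans (ℤ.+-identityˡ _) (sym (geo-shift (suc a) m)))
... | below {zero}  0<a = mono-*S-below (suc a) (const (+ 1) +S geo (suc a)) 0<a
... | below {suc m} m<a = trans (mono-*S-below (suc a) (const (+ 1) +S geo (suc a)) m<a)
                                (sym (geo-∤ (λ d → ℕ.<⇒≱ m<a (∣⇒≤ d))))

-- The truncated ring ℤ[[q]]/(q^{N+1})

-- The quotient by q^{N+1} is taken in the equality alone; elements remain full series. Being a
-- record and not a bare function type, it lets unification recover `f` and `g`.
record Agree (N : ℕ) (f g : Series) : Set where
  constructor agree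
  field
    at : ∀ {n} → n ℕ.≤ N → f n ≡ g n

open Agree public

pointwise : ∀ {N f g} → (∀ n → f n ≡ g n) → Agree N f g
pointwise e = agree (λ {n} _ → e n)

truncatedRing : ℕ → CommutativeRing 0ℓ 0ℓ
truncatedRing N = record
  { Carrier = Series
  ; _≈_ = Agree N
  ; _+_ = _+S_
  ; _*_ = _*S_
  ; -_ = -S_
  ; 0# = zeroS
  ; 1# = oneS
  ; isCommutativeRing = record
    { isRing = record
      { +-isAbelianGroup = record
        { isGroup = record
          { isMonoid = record
            { isSemigroup = record
              { isMagma = record
                { isEquivalence = record
                  { refl = agree (λ _ → refl)
                  ; sym = λ e → agree (λ n≤N → sym (at e n≤N))
                  ; trans = λ e e′ → agree (λ n≤N → trans (at e n≤N) (at e′ n≤N))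
                  }
                ; ∙-cong = λ e e′ → agree (λ n≤N → cong₂ ℤ._+_ (at e n≤N) (at e′ n≤N))
                }
              ; assoc = λ f g h → pointwise (λ n → ℤ.+-assoc (f n) (g n) (h n))
              }
            ; identity = (λ f → pointwise (λ n → ℤ.+-identityˡ (f n)))
                       , (λ f → pointwise (λ n → ℤ.+-identityʳ (f n)))
            }
          ; inverse = (λ f → pointwise (λ n → ℤ.+-inverseˡ (f n)))
                    , (λ f → pointwise (λ n → ℤ.+-inverseʳ (f n)))
          ; ⁻¹-cong = λ e → agree (λ n≤N → cong ℤ.-_ (at e n≤N))
          }
        ; comm = λ f g → pointwise (λ n → ℤ.+-comm (f n) (g n))
        }
      ; *-cong = λ e e′ → agree (*S-cong (at e) (at e′))
      ; *-assoc = λ f g h → pointwise (*S-assoc f g h)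
      ; *-identity = (λ f → pointwise (one-*S f))
                   , (λ f → pointwise (λ n → trans (*S-comm f oneS n) (one-*S f n)))
      ; distrib = (λ f g h → pointwise (*S-distribˡ f g h))
                , (λ f g h → pointwise (*S-distribʳ f g h))
      }
    ; *-comm = λ f g → pointwise (*S-comm f g)
    }
  }

-- The structure of ℤ[[q]]/(q^{N+1}) used by the Lambert series argument: q a stands for q^a,
-- g a for q^a/(1-q^a) and D for q d/dq.
record LambertRing (N : ℕ) : Set₁ where
  field
    commutativeRing : CommutativeRing 0ℓ 0ℓ
  open CommutativeRing commutativeRing public hiding (ring)
  field
    ι      : ℤ → Carrier
    ι-+    : ∀ x y → ι (x ℤ.+ y) ≈ ι x + ι y
    ι-*    : ∀ x y → ι (x ℤ.* y) ≈ ι x * ι y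
    ι-neg  : ∀ x → ι (ℤ.- x) ≈ - ι x
    ι-0    : ι (+ 0) ≈ 0#
    ι-1    : ι (+ 1) ≈ 1#
    D      : Carrier → Carrier
    D-cong : ∀ {x y} → x ≈ y → D x ≈ D y
    D-+    : ∀ x y → D (x + y) ≈ D x + D y
    D-*    : ∀ x y → D (x * y) ≈ D x * y + x * D y
    D-ι    : ∀ c → D (ι c) ≈ 0#
    q      : ℕ → Carrier
    q-0    : q 0 ≈ ι (+ 1)
    q-+    : ∀ a b → q (a ℕ.+ b) ≈ q a * q b
    -- The only axiom that sees the truncation order.
    q-big  : ∀ {a} → N ℕ.< a → q a ≈ 0#
    D-q    : ∀ a → D (q a) ≈ ι (+ a) * q a
    g      : ℕ → Carrier
    g-rec  : ∀ a → q (suc a) * (ι (+ 1) + g (suc a)) ≈ g (suc a)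

  private
    ℤ-rawRing : RawRing 0ℓ 0ℓ
    ℤ-rawRing = record { _≈_ = _≡_ ; _+_ = ℤ._+_ ; _*_ = ℤ._*_ ; -_ = ℤ.-_ ; 0# = + 0 ; 1# = + 1 }

    morphism : ℤ-rawRing -Raw-AlmostCommutative⟶ fromCommutativeRing commutativeRing
    morphism = record
      { ⟦_⟧ = ι ; +-homo = ι-+ ; *-homo = ι-* ; -‿homo = ι-neg ; 0-homo = ι-0 ; 1-homo = ι-1 }

    ι-≟ : ∀ x y → Maybe (ι x ≈ ι y)
    ι-≟ x y with x ℤ.≟ y
    ... | yes x≡y = just (reflexive (≡.cong ι x≡y))
    ... | no _    = nothing

  -- Coefficients are integers embedded by `ι`, so numerals are computed and compared in ℤ, where
  -- equality is decidable.
  module Solver = Algebra.Solver.Ring ℤ-rawRing (fromCommutativeRing commutativeRing) morphism ι-≟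

truncated : ∀ N → LambertRing N
truncated N = record
  { commutativeRing = truncatedRing N
  ; ι = const
  ; ι-+ = λ x y → pointwise λ { zero → ≡.refl ; (suc _) → ≡.refl }
  ; ι-* = λ x y → pointwise λ { zero → ≡.refl ; (suc n) → ≡.trans (≡.sym (ℤ.*-zeroʳ x)) (≡.sym (const-*S x (const y) (suc n))) }
  ; ι-neg = λ x → pointwise λ { zero → ≡.refl ; (suc _) → ≡.refl }
  ; ι-0 = pointwise λ { zero → ≡.refl ; (suc _) → ≡.refl }
  ; ι-1 = pointwise λ { zero → ≡.refl ; (suc _) → ≡.refl }
  ; D = θ∂
  ; D-cong = λ e → agree (λ {n} n≤N → ≡.cong (+ n ℤ.*_) (at e n≤N))
  ; D-+ = λ f g → pointwise (λ n → ℤ.*-distribˡ-+ (+ n) (f n) (g n))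
  ; D-* = λ f g → pointwise (θ∂-*S f g)
  ; D-ι = λ c → pointwise λ { zero → ℤ.*-zeroˡ c ; (suc n) → ℤ.*-zeroʳ (+ suc n) }
  ; q = mono
  ; q-0 = pointwise (λ n → ≡.trans (mono-0 n) (oneS≡const n))
  ; q-+ = λ a b → pointwise (mono-+ a b)
  ; q-big = λ N<a → agree (λ n≤N → mono-other (ℕ.<⇒≢ (ℕ.≤-<-trans n≤N N<a)))
  ; D-q = λ a → pointwise (λ n → ≡.trans (θ∂-mono a n) (≡.sym (const-*S (+ a) (mono a) n)))
  ; g = geo
  ; g-rec = λ a → pointwise (geo-rec a)
  }

-- Finite sums and Lambert series

Σℤ : ℕ → (ℕ → ℤ) → ℤ
Σℤ zero    u = + 0
Σℤ (suc n) u = Σℤ n u ℤ.+ u (suc n)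

antidiagonal : (ℕ → ℕ → ℤ) → ℕ → ℤ
antidiagonal F c = Σℤ (pred c) (λ a → F a (c ℕ.∸ a))

module Sums {N : ℕ} (S : LambertRing N) where
  open LambertRing S renaming (refl to ≈-refl; sym to ≈-sym; trans to ≈-trans)
  open Solver using (solve; _:=_; _:+_; _:*_; _:-_; con)
  open import Relation.Binary.Reasoning.Setoid setoid

  Σ₁ : ℕ → (ℕ → Carrier) → Carrier
  Σ₁ zero    f = 0#
  Σ₁ (suc n) f = Σ₁ n f + f (suc n)

  Σ₁-cong : ∀ n {f h : ℕ → Carrier} → (∀ {i} → i ℕ.< n → f (suc i) ≈ h (suc i)) → Σ₁ n f ≈ Σ₁ n h
  Σ₁-cong zero    e = ≈-refl
  Σ₁-cong (suc n) e = +-cong (Σ₁-cong n (e ∘ ℕ.m<n⇒m<1+n)) (e ℕ.≤-refl)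

  Σ₁-+ : ∀ n f h → Σ₁ n (λ i → f i + h i) ≈ Σ₁ n f + Σ₁ n h
  Σ₁-+ zero    f h = ≈-sym (+-identityʳ 0#)
  Σ₁-+ (suc n) f h = ≈-trans (+-congʳ (Σ₁-+ n f h))
    (solve 4 (λ a b c d → (a :+ b) :+ (c :+ d) := (a :+ c) :+ (b :+ d)) ≈-refl
      (Σ₁ n f) (Σ₁ n h) (f (suc n)) (h (suc n)))

  Σ₁-*ˡ : ∀ n c f → Σ₁ n (λ i → c * f i) ≈ c * Σ₁ n f
  Σ₁-*ˡ zero    c f = ≈-sym (zeroʳ c)
  Σ₁-*ˡ (suc n) c f = ≈-trans (+-congʳ (Σ₁-*ˡ n c f)) (≈-sym (distribˡ c _ _))

  Σ₁-*ʳ : ∀ n c f → Σ₁ n (λ i → f i * c) ≈ Σ₁ n f * c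
  Σ₁-*ʳ n c f = ≈-trans (Σ₁-cong n (λ _ → *-comm _ c)) (≈-trans (Σ₁-*ˡ n c f) (*-comm c _))

  Σ₁-front : ∀ n f → Σ₁ (suc n) f ≈ f 1 + Σ₁ n (f ∘ suc)
  Σ₁-front zero    f = +-comm 0# (f 1)
  Σ₁-front (suc n) f = ≈-trans (+-congʳ (Σ₁-front n f)) (+-assoc _ _ _)

  Σ₁-reverse : ∀ n f → Σ₁ n f ≈ Σ₁ n (λ i → f (suc n ℕ.∸ i))
  Σ₁-reverse zero    f = ≈-refl
  Σ₁-reverse (suc n) f = begin
    Σ₁ n f + f (suc n)                             ≈⟨ +-congʳ (Σ₁-reverse n f) ⟩
    Σ₁ n (λ i → f (suc n ℕ.∸ i)) + f (suc n)       ≈⟨ +-comm _ _ ⟩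
    f (suc n) + Σ₁ n (λ i → f (suc n ℕ.∸ i))       ≈⟨ Σ₁-front n (λ i → f (suc (suc n) ℕ.∸ i)) ⟨
    Σ₁ (suc n) (λ i → f (suc (suc n) ℕ.∸ i))       ∎

  Σ₁-extend : ∀ m k {f} → (∀ {i} → m ℕ.< i → f i ≈ 0#) → Σ₁ (k ℕ.+ m) f ≈ Σ₁ m f
  Σ₁-extend m zero    e = ≈-refl
  Σ₁-extend m (suc k) e = ≈-trans (+-cong (Σ₁-extend m k e) (e (s≤s (ℕ.m≤n+m m k)))) (+-identityʳ _)

  ι-Σ : ∀ n u → ι (Σℤ n u) ≈ Σ₁ n (ι ∘ u)
  ι-Σ zero    u = ι-0
  ι-Σ (suc n) u = ≈-trans (ι-+ _ _) (+-congʳ (ι-Σ n u))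

  Σ₁-square : ∀ n (f : ℕ → ℕ → Carrier) →
    Σ₁ n (λ a → Σ₁ n (f a)) ≈
    Σ₁ n (λ a → Σ₁ (pred a) (λ b → f a b + f b a)) + Σ₁ n (λ a → f a a)
  Σ₁-square zero    f = ≈-sym (+-identityʳ 0#)
  Σ₁-square (suc n) f = begin
    Σ₁ n (λ a → Σ₁ n (f a) + f a (suc n)) + (Σ₁ n (f (suc n)) + f (suc n) (suc n))
      ≈⟨ +-congʳ (Σ₁-+ n (λ a → Σ₁ n (f a)) (λ a → f a (suc n))) ⟩
    (Σ₁ n (λ a → Σ₁ n (f a)) + Σ₁ n (λ a → f a (suc n))) + (Σ₁ n (f (suc n)) + f (suc n) (suc n))
      ≈⟨ +-congʳ (+-congʳ (Σ₁-square n f)) ⟩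
    ((T + d) + Σ₁ n (λ a → f a (suc n))) + (Σ₁ n (f (suc n)) + f (suc n) (suc n))
      ≈⟨ solve 5 (λ T d x y z → ((T :+ d) :+ x) :+ (y :+ z) := (T :+ (y :+ x)) :+ (d :+ z)) ≈-refl _ _ _ _ _ ⟩
    (T + (Σ₁ n (f (suc n)) + Σ₁ n (λ b → f b (suc n)))) + (d + f (suc n) (suc n))
      ≈⟨ +-congʳ (+-congˡ (Σ₁-+ n (f (suc n)) (λ b → f b (suc n)))) ⟨
    (T + Σ₁ n (λ b → f (suc n) b + f b (suc n))) + (d + f (suc n) (suc n)) ∎
    where
    T = Σ₁ n (λ a → Σ₁ (pred a) (λ b → f a b + f b a))
    d = Σ₁ n (λ a → f a a)

  Σ₁-triangle : ∀ n (f : ℕ → ℕ → Carrier) →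
    Σ₁ n (λ a → Σ₁ (n ℕ.∸ a) (f a)) ≈ Σ₁ n (λ c → Σ₁ (pred c) (λ a → f a (c ℕ.∸ a)))
  Σ₁-triangle zero    f = ≈-refl
  Σ₁-triangle (suc n) f = begin
    Σ₁ n (λ a → Σ₁ (suc n ℕ.∸ a) (f a)) + Σ₁ (n ℕ.∸ n) (f (suc n))
      ≈⟨ +-cong (Σ₁-cong n (λ {i} i<n → reflexive (≡.cong (λ k → Σ₁ k (f (suc i))) (ℕ.+-∸-assoc 1 i<n))))
                (reflexive (≡.cong (λ k → Σ₁ k (f (suc n))) (ℕ.n∸n≡0 n))) ⟩
    Σ₁ n (λ a → Σ₁ (n ℕ.∸ a) (f a) + f a (suc (n ℕ.∸ a))) + 0#
      ≈⟨ +-identityʳ _ ⟩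
    Σ₁ n (λ a → Σ₁ (n ℕ.∸ a) (f a) + f a (suc (n ℕ.∸ a)))
      ≈⟨ Σ₁-+ n _ _ ⟩
    Σ₁ n (λ a → Σ₁ (n ℕ.∸ a) (f a)) + Σ₁ n (λ a → f a (suc (n ℕ.∸ a)))
      ≈⟨ +-cong (Σ₁-triangle n f)
                (Σ₁-cong n (λ {i} i<n → reflexive (≡.cong (f (suc i)) (≡.sym (ℕ.+-∸-assoc 1 i<n))))) ⟩
    Σ₁ n (λ c → Σ₁ (pred c) (λ a → f a (c ℕ.∸ a))) + Σ₁ n (λ a → f a (suc n ℕ.∸ a)) ∎

  Σ₁-square-triangle : ∀ n (f : ℕ → ℕ → Carrier) →
    (∀ {a b} → n ℕ.< suc a ℕ.+ suc b → f (suc a) (suc b) ≈ 0#) →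
    Σ₁ n (λ a → Σ₁ n (f a)) ≈ Σ₁ n (λ c → Σ₁ (pred c) (λ a → f a (c ℕ.∸ a)))
  Σ₁-square-triangle n f e = ≈-trans (Σ₁-cong n shrink) (Σ₁-triangle n f)
    where
    vanish : ∀ {i} j → n ℕ.∸ suc i ℕ.< j → f (suc i) j ≈ 0#
    vanish {i} (suc j) lt = e (ℕ.≤-<-trans (ℕ.m≤n+m∸n n (suc i)) (ℕ.+-monoʳ-< (suc i) lt))
    shrink : ∀ {i} → i ℕ.< n → Σ₁ n (f (suc i)) ≈ Σ₁ (n ℕ.∸ suc i) (f (suc i))
    shrink {i} i<n = ≈-trans
      (reflexive (≡.cong (λ k → Σ₁ k (f (suc i))) (≡.sym (ℕ.m+[n∸m]≡n i<n))))
      (Σ₁-extend (n ℕ.∸ suc i) (suc i) (λ {j} → vanish j))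

  -- The unit in the form that the solver's `con (+ 1)` denotes; it agrees with `1#` only up to
  -- `ι-1`.
  𝟙 : Carrier
  𝟙 = ι (+ 1)

  *-𝟙 : ∀ x → x * 𝟙 ≈ x
  *-𝟙 x = ≈-trans (*-congˡ ι-1) (*-identityʳ x)

  g-inverse : ∀ a → (𝟙 - q (suc a)) * (𝟙 + g (suc a)) ≈ 𝟙
  g-inverse a = begin
    (𝟙 - q (suc a)) * (𝟙 + g (suc a))
      ≈⟨ solve 2 (λ x X → (con (+ 1) :- x) :* (con (+ 1) :+ X) := (con (+ 1) :+ X) :- x :* (con (+ 1) :+ X)) ≈-refl _ _ ⟩
    (𝟙 + g (suc a)) - q (suc a) * (𝟙 + g (suc a))
      ≈⟨ +-congˡ (-‿cong (g-rec a)) ⟩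
    (𝟙 + g (suc a)) - g (suc a)
      ≈⟨ solve 2 (λ o X → (o :+ X) :- X := o) ≈-refl 𝟙 _ ⟩
    𝟙 ∎

  -- x/(1-x) · y/(1-y) = xy/(1-xy) · (1 + x/(1-x) + y/(1-y)) at x = q^a, y = q^b.
  g-*-g : ∀ a b → g (suc a) * g (suc b) ≈ g (suc a ℕ.+ suc b) * (𝟙 + g (suc a) + g (suc b))
  g-*-g a b = begin
    X * Y
      ≈⟨ solve 3 (λ X Y Z → X :* Y := X :* Y :* (con (+ 1) :+ Z) :- Z :* (X :* Y)) ≈-refl X Y Z ⟩
    X * Y * (𝟙 + Z) - Z * (X * Y)
      ≈⟨ +-congʳ (*-congʳ (*-cong (g-rec a) (g-rec b))) ⟨
    q (suc a) * (𝟙 + X) * (q (suc b) * (𝟙 + Y)) * (𝟙 + Z) - Z * (X * Y)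
      ≈⟨ solve 5 (λ x y X Y Z →
           x :* (con (+ 1) :+ X) :* (y :* (con (+ 1) :+ Y)) :* (con (+ 1) :+ Z) :- Z :* (X :* Y) :=
           x :* y :* (con (+ 1) :+ Z) :* ((con (+ 1) :+ X) :* (con (+ 1) :+ Y)) :- Z :* (X :* Y)) ≈-refl
           (q (suc a)) (q (suc b)) X Y Z ⟩
    q (suc a) * q (suc b) * (𝟙 + Z) * ((𝟙 + X) * (𝟙 + Y)) - Z * (X * Y)
      ≈⟨ +-congʳ (*-congʳ (≈-trans (*-congʳ (≈-sym (q-+ (suc a) (suc b)))) (g-rec (a ℕ.+ suc b)))) ⟩
    Z * ((𝟙 + X) * (𝟙 + Y)) - Z * (X * Y)
      ≈⟨ solve 3 (λ X Y Z → Z :* ((con (+ 1) :+ X) :* (con (+ 1) :+ Y)) :- Z :* (X :* Y) :=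
                            Z :* (con (+ 1) :+ X :+ Y)) ≈-refl X Y Z ⟩
    Z * (𝟙 + X + Y) ∎
    where
    X = g (suc a)
    Y = g (suc b)
    Z = g (suc a ℕ.+ suc b)

  g-big : ∀ {a} → N ℕ.< suc a → g (suc a) ≈ 0#
  g-big {a} lt = ≈-trans (≈-sym (g-rec a)) (≈-trans (*-congʳ (q-big lt)) (zeroˡ _))

  g-*-g-big : ∀ {a b} → N ℕ.< suc a ℕ.+ suc b → g (suc a) * g (suc b) ≈ 0#
  g-*-g-big {a} {b} lt = ≈-trans (g-*-g a b) (≈-trans (*-congʳ (g-big lt)) (zeroˡ _))

  D-𝟙+ : ∀ x → D (𝟙 + x) ≈ D x
  D-𝟙+ x = ≈-trans (D-+ 𝟙 x) (≈-trans (+-congʳ (D-ι (+ 1))) (+-identityˡ (D x)))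

  -- Differentiating X = x (1 + X) gives (1 - x) D X = a X, and 1 + X is the inverse of 1 - x.
  D-g : ∀ a → D (g (suc a)) ≈ ι (+ suc a) * (g (suc a) + g (suc a) * g (suc a))
  D-g a = begin
    D X
      ≈⟨ solve 1 (λ d → d := con (+ 1) :* d) ≈-refl (D X) ⟩
    𝟙 * D X
      ≈⟨ *-congʳ (g-inverse a) ⟨
    (𝟙 - x) * (𝟙 + X) * D X
      ≈⟨ solve 3 (λ x X d → (con (+ 1) :- x) :* (con (+ 1) :+ X) :* d := (con (+ 1) :+ X) :* (d :- x :* d)) ≈-refl x X (D X) ⟩
    (𝟙 + X) * (D X - x * D X)
      ≈⟨ *-congˡ (+-congʳ D-X) ⟩
    (𝟙 + X) * (ι (+ suc a) * X + x * D X - x * D X)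
      ≈⟨ solve 3 (λ k X y → (con (+ 1) :+ X) :* (k :* X :+ y :- y) := k :* (X :+ X :* X)) ≈-refl (ι (+ suc a)) X (x * D X) ⟩
    ι (+ suc a) * (X + X * X) ∎
    where
    x = q (suc a)
    X = g (suc a)
    D-X : D X ≈ ι (+ suc a) * X + x * D X
    D-X = begin
      D X                                      ≈⟨ D-cong (g-rec a) ⟨
      D (x * (𝟙 + X))                          ≈⟨ D-* x (𝟙 + X) ⟩
      D x * (𝟙 + X) + x * D (𝟙 + X)            ≈⟨ +-cong (*-congʳ (D-q (suc a))) (*-congˡ (D-𝟙+ X)) ⟩
      ι (+ suc a) * x * (𝟙 + X) + x * D X      ≈⟨ +-congʳ (≈-trans (*-assoc _ _ _) (*-congˡ (g-rec a))) ⟩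
      ι (+ suc a) * X + x * D X                ∎

-- Quadratic identities for Lambert series

module Lambert {N : ℕ} (S : LambertRing N) where
  open LambertRing S renaming (refl to ≈-refl; sym to ≈-sym; trans to ≈-trans)
  open Solver using (solve; _:=_; _:+_; _:*_; _:-_; con)
  open import Relation.Binary.Reasoning.Setoid setoid
  open Sums S

  L : (ℕ → ℤ) → Carrier
  L u = Σ₁ N (λ a → ι (u a) * g a)

  L² : (ℕ → ℕ → ℤ) → Carrier
  L² W = Σ₁ N (λ a → Σ₁ N (λ b → ι (W a b) * (g a * g b)))

  Lsq : (ℕ → ℤ) → Carrier
  Lsq u = Σ₁ N (λ a → ι (u a) * (g a * g a))

  L-cong : ∀ {u v} → (∀ i → u (suc i) ≡ v (suc i)) → L u ≈ L v
  L-cong e = Σ₁-cong N (λ {i} _ → *-congʳ (reflexive (≡.cong ι (e i))))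

  L²-cong : ∀ {W W′} → (∀ i j → W (suc i) (suc j) ≡ W′ (suc i) (suc j)) → L² W ≈ L² W′
  L²-cong e = Σ₁-cong N (λ {i} _ → Σ₁-cong N (λ {j} _ → *-congʳ (reflexive (≡.cong ι (e i j)))))

  Lsq-cong : ∀ {u v} → (∀ i → u (suc i) ≡ v (suc i)) → Lsq u ≈ Lsq v
  Lsq-cong e = Σ₁-cong N (λ {i} _ → *-congʳ (reflexive (≡.cong ι (e i))))

  L-+ : ∀ u v → L (λ a → u a ℤ.+ v a) ≈ L u + L v
  L-+ u v = ≈-trans (Σ₁-cong N (λ _ → ≈-trans (*-congʳ (ι-+ _ _)) (distribʳ _ _ _))) (Σ₁-+ N _ _)

  L-* : ∀ c u → L (λ a → c ℤ.* u a) ≈ ι c * L u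
  L-* c u = ≈-trans (Σ₁-cong N (λ _ → ≈-trans (*-congʳ (ι-* _ _)) (*-assoc _ _ _))) (Σ₁-*ˡ N (ι c) _)

  Lsq-+ : ∀ u v → Lsq (λ a → u a ℤ.+ v a) ≈ Lsq u + Lsq v
  Lsq-+ u v = ≈-trans (Σ₁-cong N (λ _ → ≈-trans (*-congʳ (ι-+ _ _)) (distribʳ _ _ _))) (Σ₁-+ N _ _)

  L²-+ : ∀ W W′ → L² (λ a b → W a b ℤ.+ W′ a b) ≈ L² W + L² W′
  L²-+ W W′ = ≈-trans
    (Σ₁-cong N (λ _ → ≈-trans (Σ₁-cong N (λ _ → ≈-trans (*-congʳ (ι-+ _ _)) (distribʳ _ _ _))) (Σ₁-+ N _ _)))
    (Σ₁-+ N _ _)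

  L²-* : ∀ c u v → L² (λ a b → c ℤ.* (u a ℤ.* v b)) ≈ ι c * (L u * L v)
  L²-* c u v = begin
    Σ₁ N (λ a → Σ₁ N (λ b → ι (c ℤ.* (u a ℤ.* v b)) * (g a * g b)))
      ≈⟨ Σ₁-cong N (λ {i} _ → ≈-trans (Σ₁-cong N (λ {j} _ → split i j)) (Σ₁-*ˡ N _ _)) ⟩
    Σ₁ N (λ a → (ι c * (ι (u a) * g a)) * L v)
      ≈⟨ Σ₁-*ʳ N (L v) _ ⟩
    Σ₁ N (λ a → ι c * (ι (u a) * g a)) * L v
      ≈⟨ *-congʳ (Σ₁-*ˡ N (ι c) _) ⟩
    ι c * L u * L v
      ≈⟨ *-assoc _ _ _ ⟩
    ι c * (L u * L v) ∎
    where
    split : ∀ i j → ι (c ℤ.* (u (suc i) ℤ.* v (suc j))) * (g (suc i) * g (suc j)) ≈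
                    (ι c * (ι (u (suc i)) * g (suc i))) * (ι (v (suc j)) * g (suc j))
    split i j = ≈-trans
      (*-congʳ (≈-trans (ι-* c _) (*-congˡ (ι-* (u (suc i)) (v (suc j))))))
      (solve 5 (λ c u v x y → (c :* (u :* v)) :* (x :* y) := (c :* (u :* x)) :* (v :* y)) ≈-refl
        (ι c) (ι (u (suc i))) (ι (v (suc j))) (g (suc i)) (g (suc j)))

  D-Σ₁ : ∀ n f → D (Σ₁ n f) ≈ Σ₁ n (D ∘ f)
  D-Σ₁ zero    f = ≈-trans (D-cong (≈-sym ι-0)) (D-ι (+ 0))
  D-Σ₁ (suc n) f = ≈-trans (D-+ _ _) (+-congʳ (D-Σ₁ n f))

  D-scale : ∀ c x → D (ι c * x) ≈ ι c * D x
  D-scale c x = ≈-trans (D-* (ι c) x) (≈-trans (+-congʳ (≈-trans (*-congʳ (D-ι c)) (zeroˡ x))) (+-identityˡ _))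

  D-L : ∀ u → D (L u) ≈ L (λ a → + a ℤ.* u a) + Lsq (λ a → + a ℤ.* u a)
  D-L u = begin
    D (L u)
      ≈⟨ D-Σ₁ N _ ⟩
    Σ₁ N (λ a → D (ι (u a) * g a))
      ≈⟨ Σ₁-cong N (λ {i} _ → ≈-trans (D-scale _ _) (≈-trans (*-congˡ (D-g i)) (expand i))) ⟩
    Σ₁ N (λ a → ι (+ a ℤ.* u a) * g a + ι (+ a ℤ.* u a) * (g a * g a))
      ≈⟨ Σ₁-+ N _ _ ⟩
    L (λ a → + a ℤ.* u a) + Lsq (λ a → + a ℤ.* u a) ∎
    where
    expand : ∀ i → ι (u (suc i)) * (ι (+ suc i) * (g (suc i) + g (suc i) * g (suc i))) ≈
      ι (+ suc i ℤ.* u (suc i)) * g (suc i) + ι (+ suc i ℤ.* u (suc i)) * (g (suc i) * g (suc i))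
    expand i = ≈-trans
      (solve 3 (λ u k x → u :* (k :* (x :+ x :* x)) := (k :* u) :* x :+ (k :* u) :* (x :* x)) ≈-refl
        (ι (u (suc i))) (ι (+ suc i)) (g (suc i)))
      (≈-sym (+-cong (*-congʳ (ι-* _ _)) (*-congʳ (ι-* _ _))))

  private
    lower : (ℕ → ℕ → ℤ) → Carrier
    lower F = Σ₁ N (λ a → Σ₁ (pred a) (λ b → ι (F a b) * (g a * g b)))

  -- Grouping the terms g a * g b by a + b and applying g-*-g turns L² F into terms
  -- g c * g a with a < c, which the square decomposition of L² F also produces.
  L²-by-diagonal : ∀ F → (∀ a b → F a b ≡ F b a) → L² F ≈ (lower F + lower F) + Lsq (λ a → F a a)
  L²-by-diagonal F F-sym = ≈-trans (Σ₁-square N _) (+-congʳ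
    (≈-trans (Σ₁-cong N (λ {j} _ → ≈-trans (Σ₁-cong j (λ _ →
       +-congˡ (*-cong (reflexive (≡.cong ι (F-sym _ _))) (*-comm _ _)))) (Σ₁-+ j _ _)))
     (Σ₁-+ N _ _)))

  L²-by-antidiagonal : ∀ F → (∀ a b → F a b ≡ F b a) →
    L² F ≈ L (antidiagonal F) + (lower (λ c a → F (c ℕ.∸ a) a) + lower (λ c a → F (c ℕ.∸ a) a))
  L²-by-antidiagonal F F-sym = begin
    L² F
      ≈⟨ Σ₁-square-triangle N _ (λ lt → ≈-trans (*-congˡ (g-*-g-big lt)) (zeroʳ _)) ⟩
    Σ₁ N (λ c → Σ₁ (pred c) (λ a → ι (F a (c ℕ.∸ a)) * (g a * g (c ℕ.∸ a))))
      ≈⟨ Σ₁-cong N (λ {j} _ → row j) ⟩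
    Σ₁ N (λ c → ι (antidiagonal F c) * g c + (B c + B c))
      ≈⟨ Σ₁-+ N _ _ ⟩
    L (antidiagonal F) + Σ₁ N (λ c → B c + B c)
      ≈⟨ +-congˡ (Σ₁-+ N B B) ⟩
    L (antidiagonal F) + (Σ₁ N B + Σ₁ N B) ∎
    where
    B : ℕ → Carrier
    B c = Σ₁ (pred c) (λ a → ι (F (c ℕ.∸ a) a) * (g c * g a))

    module _ (j : ℕ) where
      c = suc j

      term : ∀ {i} → i ℕ.< j → ι (F (suc i) (c ℕ.∸ suc i)) * (g (suc i) * g (c ℕ.∸ suc i)) ≈
        ι (F (suc i) (c ℕ.∸ suc i)) * g c +
        (ι (F (c ℕ.∸ suc i) (suc i)) * (g c * g (suc i)) +
         ι (F (suc i) (c ℕ.∸ suc i)) * (g c * g (c ℕ.∸ suc i)))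
      term {i} i<j = ≈-trans (*-congˡ (product (j ℕ.∸ i) (ℕ.m<n⇒0<n∸m i<j) (≡.cong suc (ℕ.m+[n∸m]≡n (ℕ.<⇒≤ i<j)))))
        (≈-trans
          (solve 4 (λ f z x y → f :* (z :* (con (+ 1) :+ x :+ y)) := f :* z :+ (f :* (z :* x) :+ f :* (z :* y))) ≈-refl
            (ι (F (suc i) (c ℕ.∸ suc i))) (g c) (g (suc i)) (g (c ℕ.∸ suc i)))
          (+-congˡ (+-congʳ (*-congʳ (reflexive (≡.cong ι (F-sym _ _)))))))
        where
        -- `c ∸ suc i` is positive but not syntactically a successor, which `g-*-g` asks for; hence
        -- the detour through a variable b.
        product : ∀ b → 0 ℕ.< b → suc i ℕ.+ b ≡ c → g (suc i) * g b ≈ g c * (𝟙 + g (suc i) + g b)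
        product (suc b) _ e = ≈-trans (g-*-g i b) (*-congʳ (reflexive (≡.cong g e)))

      row : Σ₁ j (λ a → ι (F a (c ℕ.∸ a)) * (g a * g (c ℕ.∸ a))) ≈ ι (antidiagonal F c) * g c + (B c + B c)
      row = begin
        Σ₁ j (λ a → ι (F a (c ℕ.∸ a)) * (g a * g (c ℕ.∸ a)))
          ≈⟨ Σ₁-cong j term ⟩
        Σ₁ j (λ a → ι (F a (c ℕ.∸ a)) * g c + (ι (F (c ℕ.∸ a) a) * (g c * g a) + ι (F a (c ℕ.∸ a)) * (g c * g (c ℕ.∸ a))))
          ≈⟨ ≈-trans (Σ₁-+ j _ _) (+-congˡ (Σ₁-+ j _ _)) ⟩
        Σ₁ j (λ a → ι (F a (c ℕ.∸ a)) * g c) + (B c + Σ₁ j (λ a → ι (F a (c ℕ.∸ a)) * (g c * g (c ℕ.∸ a))))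
          ≈⟨ +-cong (≈-trans (Σ₁-*ʳ j (g c) _) (*-congʳ (≈-sym (ι-Σ j _)))) (+-congˡ reflect) ⟩
        ι (antidiagonal F c) * g c + (B c + B c) ∎
        where
        -- The substitution a ↦ c - a carries the terms with g_{c-a} to those with g_a, by the
        -- symmetry of F already used in `term`.
        reflect : Σ₁ j (λ a → ι (F a (c ℕ.∸ a)) * (g c * g (c ℕ.∸ a))) ≈ B c
        reflect = ≈-trans (Σ₁-reverse j _) (Σ₁-cong j (λ {i} i<j →
          reflexive (≡.cong (λ k → ι (F (c ℕ.∸ suc i) k) * (g c * g k))
                            (ℕ.m∸[m∸n]≡n (s≤s (ℕ.<⇒≤ i<j))))))

  -- The diagonal and antidiagonal evaluations of `L² F` contain g_c g_a, a < c, with weights F(c,a)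
  -- and F(c-a,a). By hypothesis the difference is W(c,a), so equating them leaves the off-diagonal
  -- part of `L² W`. In the applications W is a sum of products, which turns `L² W` into products of
  -- Lambert series, while F survives only in a single sum and on the diagonal.
  lambert-identity : ∀ (F W : ℕ → ℕ → ℤ) →
    (∀ a b → F a b ≡ F b a) → (∀ a b → W a b ≡ W b a) →
    (∀ a b → F (a ℕ.+ b) b ≡ W (a ℕ.+ b) b ℤ.+ F a b) →
    L² W + Lsq (λ a → F a a) ≈ L (antidiagonal F) + Lsq (λ a → W a a)
  lambert-identity F W F-sym W-sym step = begin
    L² W + Lsq Fd
      ≈⟨ +-congʳ (L²-by-diagonal W W-sym) ⟩
    (lower W + lower W) + Lsq Wd + Lsq Fd
      ≈⟨ solve 4 (λ w b d e → (w :+ w) :+ d :+ e := ((w :+ b) :+ (w :+ b)) :+ e :- (b :+ b) :+ d) ≈-refl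
           (lower W) B (Lsq Wd) (Lsq Fd) ⟩
    ((lower W + B) + (lower W + B)) + Lsq Fd - (B + B) + Lsq Wd
      ≈⟨ +-congʳ (+-congʳ (+-congʳ (+-cong lower-step lower-step))) ⟨
    (lower F + lower F) + Lsq Fd - (B + B) + Lsq Wd
      ≈⟨ +-congʳ (+-congʳ (≈-trans (≈-sym (L²-by-diagonal F F-sym)) (L²-by-antidiagonal F F-sym))) ⟩
    L (antidiagonal F) + (B + B) - (B + B) + Lsq Wd
      ≈⟨ solve 3 (λ l b d → l :+ (b :+ b) :- (b :+ b) :+ d := l :+ d) ≈-refl (L (antidiagonal F)) B (Lsq Wd) ⟩
    L (antidiagonal F) + Lsq Wd ∎
    where
    Fd = λ a → F a a
    Wd = λ a → W a a
    B = lower (λ c a → F (c ℕ.∸ a) a)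
    step′ : ∀ {j i} → i ℕ.< j → F (suc j) (suc i) ≡ W (suc j) (suc i) ℤ.+ F (j ℕ.∸ i) (suc i)
    step′ {j} {i} i<j = ≡.subst (λ k → F k (suc i) ≡ W k (suc i) ℤ.+ F (j ℕ.∸ i) (suc i))
      (ℕ.m∸n+n≡m (s≤s (ℕ.<⇒≤ i<j))) (step (j ℕ.∸ i) (suc i))
    lower-step : lower F ≈ lower W + B
    lower-step = ≈-trans
      (Σ₁-cong N (λ {j} _ → ≈-trans
        (Σ₁-cong j (λ i<j → ≈-trans (*-congʳ (≈-trans (reflexive (≡.cong ι (step′ i<j))) (ι-+ _ _))) (distribʳ _ _ _)))
        (Σ₁-+ j _ _)))
      (Σ₁-+ N _ _)

-- Weights

-- A recursive (-1)^n, since `sign` decides divisibility and does not reduce on a successor.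
ε : ℕ → ℤ
ε zero    = + 1
ε (suc n) = ℤ.- ε n

ε-+ : ∀ a b → ε (a ℕ.+ b) ≡ ε a ℤ.* ε b
ε-+ zero    b = sym (ℤ.*-identityˡ (ε b))
ε-+ (suc a) b = trans (cong ℤ.-_ (ε-+ a b)) (ℤ.neg-distribˡ-* (ε a) (ε b))

ε-square : ∀ a → ε a ℤ.* ε a ≡ + 1
ε-square zero    = refl
ε-square (suc a) = begin
  (ℤ.- ε a) ℤ.* (ℤ.- ε a)   ≡⟨ ℤ.neg-distribˡ-* (ε a) (ℤ.- ε a) ⟨
  ℤ.- (ε a ℤ.* ℤ.- ε a)     ≡⟨ cong ℤ.-_ (ℤ.neg-distribʳ-* (ε a) (ε a)) ⟨
  ℤ.- ℤ.- (ε a ℤ.* ε a)     ≡⟨ ℤ.neg-involutive _ ⟩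
  ε a ℤ.* ε a               ≡⟨ ε-square a ⟩
  + 1                       ∎
  where open ≡.≡-Reasoning

ε-+-cancelʳ : ∀ a b → ε (a ℕ.+ b) ℤ.* ε b ≡ ε a
ε-+-cancelʳ a b = begin
  ε (a ℕ.+ b) ℤ.* ε b     ≡⟨ cong (ℤ._* ε b) (ε-+ a b) ⟩
  ε a ℤ.* ε b ℤ.* ε b     ≡⟨ ℤ.*-assoc (ε a) (ε b) (ε b) ⟩
  ε a ℤ.* (ε b ℤ.* ε b)   ≡⟨ cong (ε a ℤ.*_) (ε-square b) ⟩
  ε a ℤ.* + 1             ≡⟨ ℤ.*-identityʳ (ε a) ⟩
  ε a                     ∎
  where open ≡.≡-Reasoning

ε-+-+ : ∀ a b → ε (a ℕ.+ b ℕ.+ b) ≡ ε a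
ε-+-+ a b = trans (ε-+ (a ℕ.+ b) b) (ε-+-cancelʳ a b)

pos : ℕ → ℤ
pos a = + a

u : ℕ → ℕ → ℤ
u k a = ε a ℤ.* (+ a) ℤ.^ k

-- A weight is a polynomial in (-1)^a, (-1)^b, (-1)^(a+b), a and b, in this order.
module Weights where
  open Data.Integer.Solver.+-*-Solver public

  Weight : Set
  Weight = ∀ {m} (e f h A B : Polynomial m) → Polynomial m

  -- Weights are kept as solver syntax, polymorphic in the number of variables: the same expression
  -- is evaluated here and reused inside `solve`, also with signs and variables specialised.
  eval : Weight → (e f h A B : ℤ) → ℤ
  eval P e f h A B = ⟦ P (var 0F) (var 1F) (var 2F) (var 3F) (var 4F) ⟧ (e ∷ f ∷ h ∷ A ∷ B ∷ [])

  Symmetric : Weight → Set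
  Symmetric P = ∀ e f h A B → eval P e f h A B ≡ eval P f e h B A

  -- The signs h f e are those of a+b, b and (a+b)+b.
  Difference : Weight → Weight → Set
  Difference P Q = ∀ e f h A B → eval P h f e (A ℤ.+ B) B ≡ eval Q h f e (A ℤ.+ B) B ℤ.+ eval P e f h A B

  weight : Weight → ℕ → ℕ → ℤ
  weight P a b = eval P (ε a) (ε b) (ε (a ℕ.+ b)) (+ a) (+ b)

  weight-sym : ∀ (P : Weight) → Symmetric P →
               ∀ a b → weight P a b ≡ weight P b a
  weight-sym P P-sym a b rewrite ℕ.+-comm a b = P-sym (ε a) (ε b) (ε (b ℕ.+ a)) (+ a) (+ b)

  weight-step : ∀ (P Q : Weight) → Difference P Q →
    ∀ a b → weight P (a ℕ.+ b) b ≡ weight Q (a ℕ.+ b) b ℤ.+ weight P a b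
  weight-step P Q step a b rewrite ε-+-+ a b = step (ε a) (ε b) (ε (a ℕ.+ b)) (+ a) (+ b)

  Σℤ-closed : ∀ c k {t : ℕ → ℤ} (C : ℕ → ℤ) → C 0 ≡ + 0 →
    (∀ {n} → n ℕ.< k → C (suc n) ≡ C n ℤ.+ c ℤ.* t (suc n)) → c ℤ.* Σℤ k t ≡ C k
  Σℤ-closed c zero    C C0 step = trans (ℤ.*-zeroʳ c) (sym C0)
  Σℤ-closed c (suc k) {t} C C0 step = begin
    c ℤ.* (Σℤ k t ℤ.+ t (suc k))           ≡⟨ ℤ.*-distribˡ-+ c (Σℤ k t) (t (suc k)) ⟩
    c ℤ.* Σℤ k t ℤ.+ c ℤ.* t (suc k)       ≡⟨ cong (ℤ._+ (c ℤ.* t (suc k))) (Σℤ-closed c k C C0 (step ∘ ℕ.m<n⇒m<1+n)) ⟩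
    C k ℤ.+ c ℤ.* t (suc k)                ≡⟨ step ℕ.≤-refl ⟨
    C (suc k)                              ∎
    where open ≡.≡-Reasoning

  -- The partial sum over a ≤ n is c⁻¹ C((-1)^d, (-1)^n, (-1)^(d+n), d, n).
  weight-antidiagonal : ∀ (P C : Weight) c →
    (∀ e D → eval C e (+ 1) e D (+ 0) ≡ + 0) →
    (∀ e e′ h D n → eval C e (ℤ.- e′) (ℤ.- h) D (+ 1 ℤ.+ n) ≡
      eval C e e′ h D n ℤ.+ c ℤ.* eval P (ℤ.- e′) (ℤ.- h) e (+ 1 ℤ.+ n) (D ℤ.- (+ 1 ℤ.+ n))) →
    ∀ k → c ℤ.* antidiagonal (weight P) (suc k) ≡ eval C (ε (suc k)) (ε k) (ℤ.- + 1) (+ suc k) (+ k)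
  weight-antidiagonal P C c base step k = trans
    (Σℤ-closed c k partial
      (trans (cong (λ h → eval C (ε d) (+ 1) h (+ d) (+ 0)) (ℤ.*-identityʳ (ε d))) (base (ε d) (+ d)))
      (λ {n} n<k → trans (cong (λ h → eval C (ε d) (ε (suc n)) h (+ d) (+ suc n)) (sym (ℤ.neg-distribʳ-* (ε d) (ε n))))
        (trans (step (ε d) (ε n) (ε d ℤ.* ε n) (+ d) (+ n))
          (cong (λ x → partial n ℤ.+ c ℤ.* x) (sym (term (s≤s (ℕ.<⇒≤ n<k))))))))
    -- The last index is k = d - 1, so d + k is odd and its sign is -1.
    (cong (λ h → eval C (ε d) (ε k) h (+ d) (+ k))
      (trans (sym (ℤ.neg-distribˡ-* (ε k) (ε k))) (cong ℤ.-_ (ε-square k))))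
    where
    d = suc k

    partial : ℕ → ℤ
    partial n = eval C (ε d) (ε n) (ε d ℤ.* ε n) (+ d) (+ n)

    term : ∀ {n} → suc n ℕ.≤ d → weight P (suc n) (d ℕ.∸ suc n) ≡
      eval P (ε (suc n)) (ℤ.- (ε d ℤ.* ε n)) (ε d) (+ suc n) (+ d ℤ.- + suc n)
    term {n} n<d = begin
      eval P (ε (suc n)) (ε b) (ε (suc n ℕ.+ b)) (+ suc n) (+ b)
        ≡⟨ cong (λ h → eval P (ε (suc n)) (ε b) (ε h) (+ suc n) (+ b)) (ℕ.m+[n∸m]≡n n<d) ⟩
      eval P (ε (suc n)) (ε b) (ε d) (+ suc n) (+ b)
        -- The sign of b = d - (n+1) is obtained from that of b + (n+1) = d, multiplied by the sign
        -- of n+1, because signs have a rule for sums only.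
        ≡⟨ cong₂ (λ f B → eval P (ε (suc n)) f (ε d) (+ suc n) B)
             (trans (sym (ε-+-cancelʳ b (suc n)))
               (trans (cong (λ m → ε m ℤ.* ε (suc n)) (ℕ.m∸n+n≡m n<d)) (sym (ℤ.neg-distribʳ-* (ε d) (ε n)))))
             (trans (sym (ℤ.⊖-≥ n<d)) (sym (ℤ.m-n≡m⊖n d (suc n)))) ⟩
      eval P (ε (suc n)) (ℤ.- (ε d ℤ.* ε n)) (ε d) (+ suc n) (+ d ℤ.- + suc n) ∎
      where
      open ≡.≡-Reasoning
      b = d ℕ.∸ suc n

  k : ∀ {m} → ℕ → Polynomial m
  k c = con (+ c)

  -- F is (-1)^a f(a) + (-1)^b f(b) + (-1)^(a+b) f(a+b) in the unprimed (heat equation) case and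
  -- (-1)^(a+b) ab f(a+b) - (-1)^a b(a+b) f(a) - (-1)^b a(a+b) f(b) in the primed (℘) case, with
  -- f(x) = x^k.  C comes from Σ_{a≤n} (-1)^a a^j = ((-1)^n ψⱼ(n) - ψⱼ(0))/8 and E is the k-th
  -- Euler polynomial.
  F₄ W₄ C₄ F₆ W₆ C₆ F₂′ W₂′ C₂′ F₄′ W₄′ C₄′ : Weight

  F₄ e f h A B = e :* A :^ 4 :+ f :* B :^ 4 :+ h :* (A :+ B) :^ 4
  W₄ e f h A B = h :* (k 8 :* (A :^ 3 :* B :+ A :* B :^ 3))
  C₄ e e′ h D n = e′ :* (n :^ 4 :+ k 2 :* n :^ 3 :- n) :+ h :* E (D :- n) :- e :* E D :+ k 2 :* n :* e :* D :^ 4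
    where E = λ x → x :^ 4 :- k 2 :* x :^ 3 :+ x

  F₆ e f h A B = e :* A :^ 6 :+ f :* B :^ 6 :+ h :* (A :+ B) :^ 6
  W₆ e f h A B = h :* (k 12 :* A :^ 5 :* B :+ k 40 :* A :^ 3 :* B :^ 3 :+ k 12 :* A :* B :^ 5)
  C₆ e e′ h D n = e′ :* (n :^ 6 :+ k 3 :* n :^ 5 :- k 5 :* n :^ 3 :+ k 3 :* n) :+
                  h :* E (D :- n) :- e :* E D :+ k 2 :* n :* e :* D :^ 6
    where E = λ x → x :^ 6 :- k 3 :* x :^ 5 :+ k 5 :* x :^ 3 :- k 3 :* x

  F₂′ e f h A B = h :* A :* B :* (A :+ B) :^ 2 :- e :* B :* (A :+ B) :* A :^ 2 :- f :* A :* (A :+ B) :* B :^ 2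
  W₂′ e f h A B = h :* A :* B :* ((A :+ B) :^ 2 :+ (A :- B) :^ 2) :-
                  k 2 :* e :* A :* B :* A :^ 2 :- k 2 :* f :* A :* B :* B :^ 2
  C₂′ e e′ h D n =
    e :* D :^ 2 :* (k 12 :* D :* n :* (n :+ k 1) :- k 4 :* n :* (n :+ k 1) :* (k 2 :* n :+ k 1)) :-
    k 3 :* D :* (D :* (e′ :* ψ₂) :- (e′ :* ψ₃ :+ k 1)) :-
    k 3 :* D :* (D :^ 2 :* (h :* ψ₁ :- k 2 :* e) :- k 2 :* D :* (h :* ψ₂) :+ (h :* ψ₃ :+ e))
    where
    ψ₁ = k 4 :* n :+ k 2
    ψ₂ = k 4 :* n :^ 2 :+ k 4 :* n
    ψ₃ = k 4 :* n :^ 3 :+ k 6 :* n :^ 2 :- k 1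

  F₄′ e f h A B = h :* A :* B :* (A :+ B) :^ 4 :- e :* B :* (A :+ B) :* A :^ 4 :- f :* A :* (A :+ B) :* B :^ 4
  W₄′ e f h A B = h :* A :* B :* ((A :+ B) :^ 4 :+ (A :- B) :^ 4) :-
                  k 2 :* e :* A :* B :* A :^ 4 :- k 2 :* f :* A :* B :* B :^ 4
  C₄′ e e′ h D n =
    e :* D :^ 4 :* (k 12 :* D :* n :* (n :+ k 1) :- k 4 :* n :* (n :+ k 1) :* (k 2 :* n :+ k 1)) :-
    k 3 :* D :* (D :* (e′ :* ψ₄) :- (e′ :* ψ₅ :- k 2)) :-
    k 3 :* D :* (D :^ 4 :* (h :* ψ₁ :- k 2 :* e) :- k 4 :* D :^ 3 :* (h :* ψ₂) :+
                 k 6 :* D :^ 2 :* (h :* ψ₃ :+ e) :- k 4 :* D :* (h :* ψ₄) :+ (h :* ψ₅ :- k 2 :* e))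
    where
    ψ₁ = k 4 :* n :+ k 2
    ψ₂ = k 4 :* n :^ 2 :+ k 4 :* n
    ψ₃ = k 4 :* n :^ 3 :+ k 6 :* n :^ 2 :- k 1
    ψ₄ = k 4 :* n :^ 4 :+ k 8 :* n :^ 3 :- k 4 :* n
    ψ₅ = k 4 :* n :^ 5 :+ k 10 :* n :^ 4 :- k 10 :* n :^ 2 :+ k 2

  antidiagonal-F₄ : ∀ i → + 2 ℤ.* antidiagonal (weight F₄) (suc i) ≡
    + 2 ℤ.* u 5 (suc i) ℤ.+ (ℤ.- + 4 ℤ.* u 4 (suc i) ℤ.+ (+ 4 ℤ.* u 3 (suc i) ℤ.+ ℤ.- + 2 ℤ.* u 1 (suc i)))
  antidiagonal-F₄ i = trans
    (weight-antidiagonal F₄ C₄ (+ 2)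
      (solve 2 (λ e D → C₄ e (k 1) e D (k 0) := k 0) refl)
      (solve 5 (λ e e′ h D n → C₄ e (:- e′) (:- h) D (k 1 :+ n) :=
        C₄ e e′ h D n :+ k 2 :* F₄ (:- e′) (:- h) e (k 1 :+ n) (D :- (k 1 :+ n))) refl)
      i)
    (solve 2 (λ e n → let d = k 1 :+ n in C₄ (:- e) e (:- k 1) d n :=
      k 2 :* (:- e :* d :^ 5) :+ ((:- k 4) :* (:- e :* d :^ 4) :+ (k 4 :* (:- e :* d :^ 3) :+ (:- k 2) :* (:- e :* d :^ 1)))) refl
      (ε i) (+ i))

  antidiagonal-F₆ : ∀ i → + 2 ℤ.* antidiagonal (weight F₆) (suc i) ≡
    + 2 ℤ.* u 7 (suc i) ℤ.+ (ℤ.- + 4 ℤ.* u 6 (suc i) ℤ.+ (+ 6 ℤ.* u 5 (suc i) ℤ.+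
      (ℤ.- + 10 ℤ.* u 3 (suc i) ℤ.+ + 6 ℤ.* u 1 (suc i))))
  antidiagonal-F₆ i = trans
    (weight-antidiagonal F₆ C₆ (+ 2)
      (solve 2 (λ e D → C₆ e (k 1) e D (k 0) := k 0) refl)
      (solve 5 (λ e e′ h D n → C₆ e (:- e′) (:- h) D (k 1 :+ n) :=
        C₆ e e′ h D n :+ k 2 :* F₆ (:- e′) (:- h) e (k 1 :+ n) (D :- (k 1 :+ n))) refl)
      i)
    (solve 2 (λ e n → let d = k 1 :+ n in C₆ (:- e) e (:- k 1) d n :=
      k 2 :* (:- e :* d :^ 7) :+ ((:- k 4) :* (:- e :* d :^ 6) :+ (k 6 :* (:- e :* d :^ 5) :+
        ((:- k 10) :* (:- e :* d :^ 3) :+ k 6 :* (:- e :* d :^ 1))))) refl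
      (ε i) (+ i))

  -- The factor 24 is the common denominator of Σ a², which contributes 6, and of the alternating
  -- power sums, which contribute 8.
  antidiagonal-F₂′ : ∀ i → + 24 ℤ.* antidiagonal (weight F₂′) (suc i) ≡
    + 4 ℤ.* u 5 (suc i) ℤ.+ (+ 8 ℤ.* u 3 (suc i) ℤ.+ (ℤ.- + 6 ℤ.* u 1 (suc i) ℤ.+ + 6 ℤ.* + suc i))
  antidiagonal-F₂′ i = trans
    (weight-antidiagonal F₂′ C₂′ (+ 24)
      (solve 2 (λ e D → C₂′ e (k 1) e D (k 0) := k 0) refl)
      (solve 5 (λ e e′ h D n → C₂′ e (:- e′) (:- h) D (k 1 :+ n) :=
        C₂′ e e′ h D n :+ k 24 :* F₂′ (:- e′) (:- h) e (k 1 :+ n) (D :- (k 1 :+ n))) refl)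
      i)
    (solve 2 (λ e n → let d = k 1 :+ n in C₂′ (:- e) e (:- k 1) d n :=
      k 4 :* (:- e :* d :^ 5) :+ (k 8 :* (:- e :* d :^ 3) :+ ((:- k 6) :* (:- e :* d :^ 1) :+ k 6 :* d))) refl
      (ε i) (+ i))

  antidiagonal-F₄′ : ∀ i → + 24 ℤ.* antidiagonal (weight F₄′) (suc i) ≡
    + 4 ℤ.* u 7 (suc i) ℤ.+ (+ 8 ℤ.* u 5 (suc i) ℤ.+ (ℤ.- + 36 ℤ.* u 3 (suc i) ℤ.+
      (+ 12 ℤ.* u 1 (suc i) ℤ.+ ℤ.- + 12 ℤ.* + suc i)))
  antidiagonal-F₄′ i = trans
    (weight-antidiagonal F₄′ C₄′ (+ 24)
      (solve 2 (λ e D → C₄′ e (k 1) e D (k 0) := k 0) refl)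
      (solve 5 (λ e e′ h D n → C₄′ e (:- e′) (:- h) D (k 1 :+ n) :=
        C₄′ e e′ h D n :+ k 24 :* F₄′ (:- e′) (:- h) e (k 1 :+ n) (D :- (k 1 :+ n))) refl)
      i)
    (solve 2 (λ e n → let d = k 1 :+ n in C₄′ (:- e) e (:- k 1) d n :=
      k 4 :* (:- e :* d :^ 7) :+ (k 8 :* (:- e :* d :^ 5) :+ ((:- k 36) :* (:- e :* d :^ 3) :+
        (k 12 :* (:- e :* d :^ 1) :+ (:- k 12) :* d)))) refl
      (ε i) (+ i))

  F₄-sym : Symmetric F₄
  F₄-sym = solve 5 (λ e f h A B → F₄ e f h A B := F₄ f e h B A) refl

  W₄-sym : Symmetric W₄
  W₄-sym = solve 5 (λ e f h A B → W₄ e f h A B := W₄ f e h B A) refl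

  F₄-W₄ : Difference F₄ W₄
  F₄-W₄ = solve 5 (λ e f h A B → F₄ h f e (A :+ B) B := W₄ h f e (A :+ B) B :+ F₄ e f h A B) refl

  F₄-diagonal : ∀ e A → eval F₄ e e (+ 1) A A ≡ eval W₄ e e (+ 1) A A ℤ.+ (e ℤ.* A ℤ.^ 4 ℤ.+ e ℤ.* A ℤ.^ 4)
  F₄-diagonal = solve 2 (λ e A → F₄ e e (k 1) A A := W₄ e e (k 1) A A :+ (e :* A :^ 4 :+ e :* A :^ 4)) refl

  W₄-product : ∀ a b → eval W₄ (ε a) (ε b) (ε a ℤ.* ε b) (+ a) (+ b) ≡
    + 8 ℤ.* (u 1 a ℤ.* u 3 b) ℤ.+ (+ 8 ℤ.* (u 3 a ℤ.* u 1 b))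
  W₄-product a b = solve 4 (λ e f A B → W₄ e f (e :* f) A B :=
    k 8 :* ((e :* A :^ 1) :* (f :* B :^ 3)) :+ (k 8 :* ((e :* A :^ 3) :* (f :* B :^ 1)))) refl
    (ε a) (ε b) (+ a) (+ b)

  F₆-sym : Symmetric F₆
  F₆-sym = solve 5 (λ e f h A B → F₆ e f h A B := F₆ f e h B A) refl

  W₆-sym : Symmetric W₆
  W₆-sym = solve 5 (λ e f h A B → W₆ e f h A B := W₆ f e h B A) refl

  F₆-W₆ : Difference F₆ W₆
  F₆-W₆ = solve 5 (λ e f h A B → F₆ h f e (A :+ B) B := W₆ h f e (A :+ B) B :+ F₆ e f h A B) refl

  F₆-diagonal : ∀ e A → eval F₆ e e (+ 1) A A ≡ eval W₆ e e (+ 1) A A ℤ.+ (e ℤ.* A ℤ.^ 6 ℤ.+ e ℤ.* A ℤ.^ 6)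
  F₆-diagonal = solve 2 (λ e A → F₆ e e (k 1) A A := W₆ e e (k 1) A A :+ (e :* A :^ 6 :+ e :* A :^ 6)) refl

  W₆-product : ∀ a b → eval W₆ (ε a) (ε b) (ε a ℤ.* ε b) (+ a) (+ b) ≡
    + 12 ℤ.* (u 1 a ℤ.* u 5 b) ℤ.+ (+ 40 ℤ.* (u 3 a ℤ.* u 3 b) ℤ.+ (+ 12 ℤ.* (u 5 a ℤ.* u 1 b)))
  W₆-product a b = solve 4 (λ e f A B → W₆ e f (e :* f) A B :=
    k 12 :* ((e :* A :^ 1) :* (f :* B :^ 5)) :+ (k 40 :* ((e :* A :^ 3) :* (f :* B :^ 3)) :+ (k 12 :* ((e :* A :^ 5) :* (f :* B :^ 1))))) refl
    (ε a) (ε b) (+ a) (+ b)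

  F₂′-sym : Symmetric F₂′
  F₂′-sym = solve 5 (λ e f h A B → F₂′ e f h A B := F₂′ f e h B A) refl

  W₂′-sym : Symmetric W₂′
  W₂′-sym = solve 5 (λ e f h A B → W₂′ e f h A B := W₂′ f e h B A) refl

  F₂′-W₂′ : Difference F₂′ W₂′
  F₂′-W₂′ = solve 5 (λ e f h A B → F₂′ h f e (A :+ B) B := W₂′ h f e (A :+ B) B :+ F₂′ e f h A B) refl

  F₂′-diagonal : ∀ e A → eval F₂′ e e (+ 1) A A ≡ eval W₂′ e e (+ 1) A A
  F₂′-diagonal = solve 2 (λ e A → F₂′ e e (k 1) A A := W₂′ e e (k 1) A A) refl

  W₂′-product : ∀ a b → eval W₂′ (ε a) (ε b) (ε a ℤ.* ε b) (+ a) (+ b) ≡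
    + 2 ℤ.* (u 1 a ℤ.* u 3 b) ℤ.+ (+ 2 ℤ.* (u 3 a ℤ.* u 1 b) ℤ.+ (ℤ.- + 2 ℤ.* (u 3 a ℤ.* pos b) ℤ.+ (ℤ.- + 2 ℤ.* (pos a ℤ.* u 3 b))))
  W₂′-product a b = solve 4 (λ e f A B → W₂′ e f (e :* f) A B :=
    k 2 :* ((e :* A :^ 1) :* (f :* B :^ 3)) :+ (k 2 :* ((e :* A :^ 3) :* (f :* B :^ 1)) :+ ((:- k 2) :* ((e :* A :^ 3) :* B) :+ ((:- k 2) :* (A :* (f :* B :^ 3)))))) refl
    (ε a) (ε b) (+ a) (+ b)

  F₄′-sym : Symmetric F₄′
  F₄′-sym = solve 5 (λ e f h A B → F₄′ e f h A B := F₄′ f e h B A) refl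

  W₄′-sym : Symmetric W₄′
  W₄′-sym = solve 5 (λ e f h A B → W₄′ e f h A B := W₄′ f e h B A) refl

  F₄′-W₄′ : Difference F₄′ W₄′
  F₄′-W₄′ = solve 5 (λ e f h A B → F₄′ h f e (A :+ B) B := W₄′ h f e (A :+ B) B :+ F₄′ e f h A B) refl

  F₄′-diagonal : ∀ e A → eval F₄′ e e (+ 1) A A ≡ eval W₄′ e e (+ 1) A A
  F₄′-diagonal = solve 2 (λ e A → F₄′ e e (k 1) A A := W₄′ e e (k 1) A A) refl

  W₄′-product : ∀ a b → eval W₄′ (ε a) (ε b) (ε a ℤ.* ε b) (+ a) (+ b) ≡
    + 12 ℤ.* (u 3 a ℤ.* u 3 b) ℤ.+ (+ 2 ℤ.* (u 1 a ℤ.* u 5 b) ℤ.+ (+ 2 ℤ.* (u 5 a ℤ.* u 1 b) ℤ.+ (ℤ.- + 2 ℤ.* (u 5 a ℤ.* pos b) ℤ.+ (ℤ.- + 2 ℤ.* (pos a ℤ.* u 5 b)))))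
  W₄′-product a b = solve 4 (λ e f A B → W₄′ e f (e :* f) A B :=
    k 12 :* ((e :* A :^ 3) :* (f :* B :^ 3)) :+ (k 2 :* ((e :* A :^ 1) :* (f :* B :^ 5)) :+ (k 2 :* ((e :* A :^ 5) :* (f :* B :^ 1)) :+ ((:- k 2) :* ((e :* A :^ 5) :* B) :+ ((:- k 2) :* (A :* (f :* B :^ 5))))))) refl
    (ε a) (ε b) (+ a) (+ b)

-- Relations between Eisenstein series

module Eisenstein {N : ℕ} (S : LambertRing N) where
  open LambertRing S renaming (refl to ≈-refl; sym to ≈-sym; trans to ≈-trans)
  open Solver using (solve; _:=_; _:+_; _:*_; _:-_; :-_; con)
  open import Relation.Binary.Reasoning.Setoid setoid
  open Sums S
  open Lambert S
  private module W = Weights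
  open W using (weight; eval)

  ℓ : ℕ → Carrier
  ℓ k = L (u k)

  ℓ⁺ : Carrier
  ℓ⁺ = L pos

  L-∷ : ∀ c v {w x} → L w ≈ x → L (λ a → c ℤ.* v a ℤ.+ w a) ≈ ι c * L v + x
  L-∷ c v e = ≈-trans (L-+ _ _) (+-cong (L-* c v) e)

  L²-∷ : ∀ c v w {W x} → L² W ≈ x → L² (λ a b → c ℤ.* (v a ℤ.* w b) ℤ.+ W a b) ≈ ι c * (L v * L w) + x
  L²-∷ c v w e = ≈-trans (L²-+ _ _) (+-cong (L²-* c v w) e)

  L²-weight : ∀ (P : W.Weight) (W : ℕ → ℕ → ℤ) →
    (∀ a b → eval P (ε a) (ε b) (ε a ℤ.* ε b) (+ a) (+ b) ≡ W a b) → L² (weight P) ≈ L² W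
  L²-weight P W e = L²-cong (λ i j → ≡.trans
    (≡.cong (λ h → eval P (ε (suc i)) (ε (suc j)) h (+ suc i) (+ suc j)) (ε-+ (suc i) (suc j))) (e (suc i) (suc j)))

  diagonal : ∀ (P : W.Weight) a → weight P a a ≡ eval P (ε a) (ε a) (+ 1) (+ a) (+ a)
  diagonal P a = ≡.cong (λ h → eval P (ε a) (ε a) h (+ a) (+ a)) (≡.trans (ε-+ a a) (ε-square a))

  -- D g_a = a (g_a + g_a²) is solved for the square: a sum of squares g_a² whose weight contains
  -- the factor a is a derivative minus a Lambert series.
  Lsq-a*u : ∀ k → Lsq (u (suc k)) ≈ D (ℓ k) - ℓ (suc k)
  Lsq-a*u k = begin
    Lsq (u (suc k))
      ≈⟨ solve 2 (λ x y → x := y :+ x :- y) ≈-refl _ (ℓ (suc k)) ⟩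
    ℓ (suc k) + Lsq (u (suc k)) - ℓ (suc k)
      ≈⟨ +-congʳ (≈-trans (D-L (u k)) (+-cong (L-cong e) (Lsq-cong e))) ⟨
    D (ℓ k) - ℓ (suc k) ∎
    where
    e : ∀ i → + suc i ℤ.* u k (suc i) ≡ u (suc k) (suc i)
    e i = swap (+ suc i) (ε (suc i)) ((+ suc i) ℤ.^ k)
      where
      swap : ∀ x e p → x ℤ.* (e ℤ.* p) ≡ e ℤ.* (x ℤ.* p)
      swap = solve-∀

  -- The diagonals of P and Q differ by 2 (-1)^a a^{k+1}. This excess, a sum of squares g_a², is
  -- where the derivative in the heat equation comes from.
  heat-identity : ∀ (P Q : W.Weight) k →
    W.Symmetric P → W.Symmetric Q → W.Difference P Q →
    (∀ e A → eval P e e (+ 1) A A ≡ eval Q e e (+ 1) A A ℤ.+ (e ℤ.* A ℤ.^ suc k ℤ.+ e ℤ.* A ℤ.^ suc k)) →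
    L² (weight Q) + ι (+ 2) * (D (ℓ k) - ℓ (suc k)) ≈ L (antidiagonal (weight P))
  heat-identity P Q k P-sym Q-sym step diag = begin
    L² (weight Q) + ι (+ 2) * (D (ℓ k) - ℓ (suc k))
      ≈⟨ +-congˡ (*-congˡ (Lsq-a*u k)) ⟨
    L² (weight Q) + ι (+ 2) * Lsq (u (suc k))
      ≈⟨ solve 3 (λ w q v → w :+ con (+ 2) :* v := w :+ (q :+ (v :+ v)) :- q) ≈-refl _ (Lsq (λ a → weight Q a a)) _ ⟩
    L² (weight Q) + (Lsq (λ a → weight Q a a) + (Lsq (u (suc k)) + Lsq (u (suc k)))) - Lsq (λ a → weight Q a a)
      ≈⟨ +-congʳ (+-congˡ (≈-trans (Lsq-cong diag′) (≈-trans (Lsq-+ _ _) (+-congˡ (Lsq-+ _ _))))) ⟨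
    L² (weight Q) + Lsq (λ a → weight P a a) - Lsq (λ a → weight Q a a)
      ≈⟨ +-congʳ (lambert-identity (weight P) (weight Q) (W.weight-sym P P-sym) (W.weight-sym Q Q-sym) (W.weight-step P Q step)) ⟩
    L (antidiagonal (weight P)) + Lsq (λ a → weight Q a a) - Lsq (λ a → weight Q a a)
      ≈⟨ solve 2 (λ l q → l :+ q :- q := l) ≈-refl _ _ ⟩
    L (antidiagonal (weight P)) ∎
    where
    diag′ : ∀ i → weight P (suc i) (suc i) ≡ weight Q (suc i) (suc i) ℤ.+ (u (suc k) (suc i) ℤ.+ u (suc k) (suc i))
    diag′ i = ≡.trans (diagonal P (suc i)) (≡.trans (diag (ε (suc i)) (+ suc i))
      (≡.cong (ℤ._+ (u (suc k) (suc i) ℤ.+ u (suc k) (suc i))) (≡.sym (diagonal Q (suc i)))))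

  -- Here the diagonals agree, so the squares g_a² cancel and no derivative appears.
  ℘-identity : ∀ (P Q : W.Weight) →
    W.Symmetric P → W.Symmetric Q → W.Difference P Q →
    (∀ e A → eval P e e (+ 1) A A ≡ eval Q e e (+ 1) A A) →
    L² (weight Q) ≈ L (antidiagonal (weight P))
  ℘-identity P Q P-sym Q-sym step diag = begin
    L² (weight Q)
      ≈⟨ solve 2 (λ w q → w := w :+ q :- q) ≈-refl _ (Lsq (λ a → weight P a a)) ⟩
    L² (weight Q) + Lsq (λ a → weight P a a) - Lsq (λ a → weight P a a)
      ≈⟨ +-congʳ (lambert-identity (weight P) (weight Q) (W.weight-sym P P-sym) (W.weight-sym Q Q-sym) (W.weight-step P Q step)) ⟩
    L (antidiagonal (weight P)) + Lsq (λ a → weight Q a a) - Lsq (λ a → weight P a a)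
      ≈⟨ +-congˡ (-‿cong (Lsq-cong diag′)) ⟩
    L (antidiagonal (weight P)) + Lsq (λ a → weight Q a a) - Lsq (λ a → weight Q a a)
      ≈⟨ solve 2 (λ l q → l :+ q :- q := l) ≈-refl _ _ ⟩
    L (antidiagonal (weight P)) ∎
    where
    diag′ : ∀ i → weight P (suc i) (suc i) ≡ weight Q (suc i) (suc i)
    diag′ i = ≡.trans (diagonal P (suc i)) (≡.trans (diag (ε (suc i)) (+ suc i)) (≡.sym (diagonal Q (suc i))))

  -- The -4 `ℓ 4` on the right matches the one produced on the left by `Lsq-a*u`, so that only odd
  -- indices remain when the identity is used. The same happens to `ℓ 6` in `heat₆`.
  heat₄ : ι (+ 2) * (ι (+ 16) * (ℓ 1 * ℓ 3) + ι (+ 2) * (D (ℓ 3) - ℓ 4)) ≈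
          ι (+ 2) * ℓ 5 + (ι (ℤ.- + 4) * ℓ 4 + (ι (+ 4) * ℓ 3 + ι (ℤ.- + 2) * ℓ 1))
  heat₄ = begin
    ι (+ 2) * (ι (+ 16) * (ℓ 1 * ℓ 3) + ι (+ 2) * (D (ℓ 3) - ℓ 4))
      ≈⟨ *-congˡ (+-congʳ (solve 2 (λ x y → con (+ 16) :* (x :* y) := con (+ 8) :* (x :* y) :+ con (+ 8) :* (y :* x)) ≈-refl (ℓ 1) (ℓ 3))) ⟩
    ι (+ 2) * (ι (+ 8) * (ℓ 1 * ℓ 3) + ι (+ 8) * (ℓ 3 * ℓ 1) + ι (+ 2) * (D (ℓ 3) - ℓ 4))
      ≈⟨ *-congˡ (+-congʳ (≈-trans (L²-weight W.W₄ _ W.W₄-product)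
           (L²-∷ (+ 8) (u 1) (u 3) (L²-* (+ 8) (u 3) (u 1))))) ⟨
    ι (+ 2) * (L² (weight W.W₄) + ι (+ 2) * (D (ℓ 3) - ℓ 4))
      ≈⟨ *-congˡ (heat-identity W.F₄ W.W₄ 3 W.F₄-sym W.W₄-sym W.F₄-W₄ W.F₄-diagonal) ⟩
    ι (+ 2) * L (antidiagonal (weight W.F₄))
      ≈⟨ L-* (+ 2) _ ⟨
    L (λ a → + 2 ℤ.* antidiagonal (weight W.F₄) a)
      ≈⟨ L-cong W.antidiagonal-F₄ ⟩
    L (λ a → + 2 ℤ.* u 5 a ℤ.+ (ℤ.- + 4 ℤ.* u 4 a ℤ.+ (+ 4 ℤ.* u 3 a ℤ.+ ℤ.- + 2 ℤ.* u 1 a)))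
      ≈⟨ L-∷ (+ 2) (u 5) (L-∷ (ℤ.- + 4) (u 4) (L-∷ (+ 4) (u 3) (L-* (ℤ.- + 2) (u 1)))) ⟩
    ι (+ 2) * ℓ 5 + (ι (ℤ.- + 4) * ℓ 4 + (ι (+ 4) * ℓ 3 + ι (ℤ.- + 2) * ℓ 1)) ∎

  heat₆ : ι (+ 2) * (ι (+ 24) * (ℓ 1 * ℓ 5) + ι (+ 40) * (ℓ 3 * ℓ 3) + ι (+ 2) * (D (ℓ 5) - ℓ 6)) ≈
          ι (+ 2) * ℓ 7 + (ι (ℤ.- + 4) * ℓ 6 + (ι (+ 6) * ℓ 5 + (ι (ℤ.- + 10) * ℓ 3 + ι (+ 6) * ℓ 1)))
  heat₆ = begin
    ι (+ 2) * (ι (+ 24) * (ℓ 1 * ℓ 5) + ι (+ 40) * (ℓ 3 * ℓ 3) + ι (+ 2) * (D (ℓ 5) - ℓ 6))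
      ≈⟨ *-congˡ (+-congʳ (solve 3 (λ x y z → con (+ 24) :* (x :* z) :+ con (+ 40) :* (y :* y) :=
           con (+ 12) :* (x :* z) :+ (con (+ 40) :* (y :* y) :+ con (+ 12) :* (z :* x))) ≈-refl (ℓ 1) (ℓ 3) (ℓ 5))) ⟩
    ι (+ 2) * (ι (+ 12) * (ℓ 1 * ℓ 5) + (ι (+ 40) * (ℓ 3 * ℓ 3) + ι (+ 12) * (ℓ 5 * ℓ 1)) + ι (+ 2) * (D (ℓ 5) - ℓ 6))
      ≈⟨ *-congˡ (+-congʳ (≈-trans (L²-weight W.W₆ _ W.W₆-product)
           (L²-∷ (+ 12) (u 1) (u 5) (L²-∷ (+ 40) (u 3) (u 3) (L²-* (+ 12) (u 5) (u 1)))))) ⟨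
    ι (+ 2) * (L² (weight W.W₆) + ι (+ 2) * (D (ℓ 5) - ℓ 6))
      ≈⟨ *-congˡ (heat-identity W.F₆ W.W₆ 5 W.F₆-sym W.W₆-sym W.F₆-W₆ W.F₆-diagonal) ⟩
    ι (+ 2) * L (antidiagonal (weight W.F₆))
      ≈⟨ L-* (+ 2) _ ⟨
    L (λ a → + 2 ℤ.* antidiagonal (weight W.F₆) a)
      ≈⟨ L-cong W.antidiagonal-F₆ ⟩
    L (λ a → + 2 ℤ.* u 7 a ℤ.+ (ℤ.- + 4 ℤ.* u 6 a ℤ.+ (+ 6 ℤ.* u 5 a ℤ.+ (ℤ.- + 10 ℤ.* u 3 a ℤ.+ + 6 ℤ.* u 1 a))))
      ≈⟨ L-∷ (+ 2) (u 7) (L-∷ (ℤ.- + 4) (u 6) (L-∷ (+ 6) (u 5) (L-∷ (ℤ.- + 10) (u 3) (L-* (+ 6) (u 1))))) ⟩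
    ι (+ 2) * ℓ 7 + (ι (ℤ.- + 4) * ℓ 6 + (ι (+ 6) * ℓ 5 + (ι (ℤ.- + 10) * ℓ 3 + ι (+ 6) * ℓ 1))) ∎

  -- The signed and unsigned sums enter only through `ℓ 1 - ℓ⁺`, which is (1 - A)/12; this is the
  -- source of `A`.
  ℘₂ : ι (+ 24) * (ι (+ 4) * (ℓ 3 * (ℓ 1 - ℓ⁺))) ≈
       ι (+ 4) * ℓ 5 + (ι (+ 8) * ℓ 3 + (ι (ℤ.- + 6) * ℓ 1 + ι (+ 6) * ℓ⁺))
  ℘₂ = begin
    ι (+ 24) * (ι (+ 4) * (ℓ 3 * (ℓ 1 - ℓ⁺)))
      ≈⟨ *-congˡ (solve 3 (λ x y z → con (+ 4) :* (y :* (x :- z)) :=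
           con (+ 2) :* (x :* y) :+ (con (+ 2) :* (y :* x) :+ (con (ℤ.- + 2) :* (y :* z) :+ con (ℤ.- + 2) :* (z :* y)))) ≈-refl
           (ℓ 1) (ℓ 3) ℓ⁺) ⟩
    ι (+ 24) * (ι (+ 2) * (ℓ 1 * ℓ 3) + (ι (+ 2) * (ℓ 3 * ℓ 1) + (ι (ℤ.- + 2) * (ℓ 3 * ℓ⁺) + ι (ℤ.- + 2) * (ℓ⁺ * ℓ 3))))
      ≈⟨ *-congˡ (≈-trans (L²-weight W.W₂′ _ W.W₂′-product)
           (L²-∷ (+ 2) (u 1) (u 3) (L²-∷ (+ 2) (u 3) (u 1) (L²-∷ (ℤ.- + 2) (u 3) pos (L²-* (ℤ.- + 2) pos (u 3)))))) ⟨
    ι (+ 24) * L² (weight W.W₂′)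
      ≈⟨ *-congˡ (℘-identity W.F₂′ W.W₂′ W.F₂′-sym W.W₂′-sym W.F₂′-W₂′ W.F₂′-diagonal) ⟩
    ι (+ 24) * L (antidiagonal (weight W.F₂′))
      ≈⟨ L-* (+ 24) _ ⟨
    L (λ a → + 24 ℤ.* antidiagonal (weight W.F₂′) a)
      ≈⟨ L-cong W.antidiagonal-F₂′ ⟩
    L (λ a → + 4 ℤ.* u 5 a ℤ.+ (+ 8 ℤ.* u 3 a ℤ.+ (ℤ.- + 6 ℤ.* u 1 a ℤ.+ + 6 ℤ.* + a)))
      ≈⟨ L-∷ (+ 4) (u 5) (L-∷ (+ 8) (u 3) (L-∷ (ℤ.- + 6) (u 1) (L-* (+ 6) pos))) ⟩
    ι (+ 4) * ℓ 5 + (ι (+ 8) * ℓ 3 + (ι (ℤ.- + 6) * ℓ 1 + ι (+ 6) * ℓ⁺)) ∎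

  ℘₄ : ι (+ 24) * (ι (+ 4) * (ℓ 5 * (ℓ 1 - ℓ⁺)) + ι (+ 12) * (ℓ 3 * ℓ 3)) ≈
       ι (+ 4) * ℓ 7 + (ι (+ 8) * ℓ 5 + (ι (ℤ.- + 36) * ℓ 3 + (ι (+ 12) * ℓ 1 + ι (ℤ.- + 12) * ℓ⁺)))
  ℘₄ = begin
    ι (+ 24) * (ι (+ 4) * (ℓ 5 * (ℓ 1 - ℓ⁺)) + ι (+ 12) * (ℓ 3 * ℓ 3))
      ≈⟨ *-congˡ (solve 4 (λ x y w z → con (+ 4) :* (y :* (x :- z)) :+ con (+ 12) :* (w :* w) :=
           con (+ 12) :* (w :* w) :+ (con (+ 2) :* (x :* y) :+ (con (+ 2) :* (y :* x) :+ (con (ℤ.- + 2) :* (y :* z) :+ con (ℤ.- + 2) :* (z :* y))))) ≈-refl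
           (ℓ 1) (ℓ 5) (ℓ 3) ℓ⁺) ⟩
    ι (+ 24) * (ι (+ 12) * (ℓ 3 * ℓ 3) + (ι (+ 2) * (ℓ 1 * ℓ 5) + (ι (+ 2) * (ℓ 5 * ℓ 1) + (ι (ℤ.- + 2) * (ℓ 5 * ℓ⁺) + ι (ℤ.- + 2) * (ℓ⁺ * ℓ 5)))))
      ≈⟨ *-congˡ (≈-trans (L²-weight W.W₄′ _ W.W₄′-product)
           (L²-∷ (+ 12) (u 3) (u 3) (L²-∷ (+ 2) (u 1) (u 5) (L²-∷ (+ 2) (u 5) (u 1)
             (L²-∷ (ℤ.- + 2) (u 5) pos (L²-* (ℤ.- + 2) pos (u 5))))))) ⟨
    ι (+ 24) * L² (weight W.W₄′)
      ≈⟨ *-congˡ (℘-identity W.F₄′ W.W₄′ W.F₄′-sym W.W₄′-sym W.F₄′-W₄′ W.F₄′-diagonal) ⟩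
    ι (+ 24) * L (antidiagonal (weight W.F₄′))
      ≈⟨ L-* (+ 24) _ ⟨
    L (λ a → + 24 ℤ.* antidiagonal (weight W.F₄′) a)
      ≈⟨ L-cong W.antidiagonal-F₄′ ⟩
    L (λ a → + 4 ℤ.* u 7 a ℤ.+ (+ 8 ℤ.* u 5 a ℤ.+ (ℤ.- + 36 ℤ.* u 3 a ℤ.+ (+ 12 ℤ.* u 1 a ℤ.+ ℤ.- + 12 ℤ.* + a))))
      ≈⟨ L-∷ (+ 4) (u 7) (L-∷ (+ 8) (u 5) (L-∷ (ℤ.- + 36) (u 3) (L-∷ (+ 12) (u 1) (L-* (ℤ.- + 12) pos)))) ⟩
    ι (+ 4) * ℓ 7 + (ι (+ 8) * ℓ 5 + (ι (ℤ.- + 36) * ℓ 3 + (ι (+ 12) * ℓ 1 + ι (ℤ.- + 12) * ℓ⁺))) ∎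

  -- With E₂(q) = 1 - 24 Σ σ(n) q^n one has A = 2E₂(q²) - E₂(q) and 3Y = 4E₂(q²) - E₂(q), hence 3Y -
  -- 2A = E₂(q). The scalings of `p`, `s₅`, `s₇` clear the denominators of σ*₃(0), σ*₅(0), σ*₇(0).
  A Y p s₅ s₇ : Carrier
  A  = 𝟙 + ι (+ 12) * ℓ⁺ - ι (+ 12) * ℓ 1
  Y  = 𝟙 - ι (+ 8) * ℓ 1
  p  = 𝟙 + ι (+ 16) * ℓ 3
  s₅ = 𝟙 - ι (+ 8) * ℓ 5
  s₇ = ι (+ 17) + ι (+ 32) * ℓ 7

  s₅≈A*p : s₅ ≈ A * p
  s₅≈A*p = begin
    s₅
      -- The claim holds as a polynomial identity up to a multiple of the difference of the two
      -- sides of `℘₂`. The multiplier 2 is forced by the products: 2·24·4 = 12·16. The multipliers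
      -- in the three relations after this one, 8, 4 and 16, arise in the same way.
      ≈⟨ solve 4 (λ x y z v → con (+ 1) :- con (+ 8) :* y :=
           (con (+ 1) :+ con (+ 12) :* v :- con (+ 12) :* x) :* (con (+ 1) :+ con (+ 16) :* z) :+
           con (+ 2) :* (con (+ 24) :* (con (+ 4) :* (z :* (x :- v))) :-
             (con (+ 4) :* y :+ (con (+ 8) :* z :+ (con (ℤ.- + 6) :* x :+ con (+ 6) :* v))))) ≈-refl (ℓ 1) (ℓ 5) (ℓ 3) ℓ⁺ ⟩
    A * p + ι (+ 2) * (ι (+ 24) * (ι (+ 4) * (ℓ 3 * (ℓ 1 - ℓ⁺))) - R)
      ≈⟨ +-congˡ (*-congˡ (+-congʳ ℘₂)) ⟩
    A * p + ι (+ 2) * (R - R)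
      ≈⟨ solve 2 (λ x r → x :+ con (+ 2) :* (r :- r) := x) ≈-refl (A * p) R ⟩
    A * p ∎
    where R = ι (+ 4) * ℓ 5 + (ι (+ 8) * ℓ 3 + (ι (ℤ.- + 6) * ℓ 1 + ι (+ 6) * ℓ⁺))

  s₇≈9p²+8As₅ : s₇ ≈ ι (+ 9) * (p * p) + ι (+ 8) * (A * s₅)
  s₇≈9p²+8As₅ = begin
    s₇
      ≈⟨ solve 5 (λ x z y w v → con (+ 17) :+ con (+ 32) :* w :=
           con (+ 9) :* ((con (+ 1) :+ con (+ 16) :* z) :* (con (+ 1) :+ con (+ 16) :* z)) :+
           con (+ 8) :* ((con (+ 1) :+ con (+ 12) :* v :- con (+ 12) :* x) :* (con (+ 1) :- con (+ 8) :* y)) :-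
           con (+ 8) :* (con (+ 24) :* (con (+ 4) :* (y :* (x :- v)) :+ con (+ 12) :* (z :* z)) :-
             (con (+ 4) :* w :+ (con (+ 8) :* y :+ (con (ℤ.- + 36) :* z :+ (con (+ 12) :* x :+ con (ℤ.- + 12) :* v)))))) ≈-refl
           (ℓ 1) (ℓ 3) (ℓ 5) (ℓ 7) ℓ⁺ ⟩
    T - ι (+ 8) * (ι (+ 24) * (ι (+ 4) * (ℓ 5 * (ℓ 1 - ℓ⁺)) + ι (+ 12) * (ℓ 3 * ℓ 3)) - R)
      ≈⟨ +-congˡ (-‿cong (*-congˡ (+-congʳ ℘₄))) ⟩
    T - ι (+ 8) * (R - R)
      ≈⟨ solve 2 (λ x r → x :- con (+ 8) :* (r :- r) := x) ≈-refl T R ⟩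
    T ∎
    where
    T = ι (+ 9) * (p * p) + ι (+ 8) * (A * s₅)
    R = ι (+ 4) * ℓ 7 + (ι (+ 8) * ℓ 5 + (ι (ℤ.- + 36) * ℓ 3 + (ι (+ 12) * ℓ 1 + ι (ℤ.- + 12) * ℓ⁺)))

  D-affine : ∀ c c′ x → D (ι c + ι c′ * x) ≈ ι c′ * D x
  D-affine c c′ x = ≈-trans (D-+ _ _) (≈-trans (+-cong (D-ι c) (D-scale c′ x)) (+-identityˡ _))

  D-p : D p ≈ Y * p - s₅
  D-p = begin
    D p
      ≈⟨ D-affine (+ 1) (+ 16) (ℓ 3) ⟩
    ι (+ 16) * D (ℓ 3)
      ≈⟨ solve 5 (λ x z y w d → con (+ 16) :* d :=
           (con (+ 1) :- con (+ 8) :* x) :* (con (+ 1) :+ con (+ 16) :* z) :- (con (+ 1) :- con (+ 8) :* y) :+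
           con (+ 4) :* (con (+ 2) :* (con (+ 16) :* (x :* z) :+ con (+ 2) :* (d :- w)) :-
             (con (+ 2) :* y :+ (con (ℤ.- + 4) :* w :+ (con (+ 4) :* z :+ con (ℤ.- + 2) :* x))))) ≈-refl
           (ℓ 1) (ℓ 3) (ℓ 5) (ℓ 4) (D (ℓ 3)) ⟩
    Y * p - s₅ + ι (+ 4) * (ι (+ 2) * (ι (+ 16) * (ℓ 1 * ℓ 3) + ι (+ 2) * (D (ℓ 3) - ℓ 4)) - R)
      ≈⟨ +-congˡ (*-congˡ (+-congʳ heat₄)) ⟩
    Y * p - s₅ + ι (+ 4) * (R - R)
      ≈⟨ solve 2 (λ x r → x :+ con (+ 4) :* (r :- r) := x) ≈-refl (Y * p - s₅) R ⟩
    Y * p - s₅ ∎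
    where R = ι (+ 2) * ℓ 5 + (ι (ℤ.- + 4) * ℓ 4 + (ι (+ 4) * ℓ 3 + ι (ℤ.- + 2) * ℓ 1))

  8D-s₅ : ι (+ 8) * D s₅ ≈ ι (+ 12) * (Y * s₅) - s₇ + ι (+ 5) * (p * p)
  8D-s₅ = begin
    ι (+ 8) * D s₅
      ≈⟨ *-congˡ (≈-trans (D-cong (solve 1 (λ y → con (+ 1) :- con (+ 8) :* y := con (+ 1) :+ con (ℤ.- + 8) :* y) ≈-refl (ℓ 5)))
                        (D-affine (+ 1) (ℤ.- + 8) (ℓ 5))) ⟩
    ι (+ 8) * (ι (ℤ.- + 8) * D (ℓ 5))
      ≈⟨ solve 6 (λ x z y w v d → con (+ 8) :* (con (ℤ.- + 8) :* d) :=
           con (+ 12) :* ((con (+ 1) :- con (+ 8) :* x) :* (con (+ 1) :- con (+ 8) :* y)) :-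
           (con (+ 17) :+ con (+ 32) :* w) :+
           con (+ 5) :* ((con (+ 1) :+ con (+ 16) :* z) :* (con (+ 1) :+ con (+ 16) :* z)) :-
           con (+ 16) :* (con (+ 2) :* (con (+ 24) :* (x :* y) :+ con (+ 40) :* (z :* z) :+ con (+ 2) :* (d :- v)) :-
             (con (+ 2) :* w :+ (con (ℤ.- + 4) :* v :+ (con (+ 6) :* y :+ (con (ℤ.- + 10) :* z :+ con (+ 6) :* x)))))) ≈-refl
           (ℓ 1) (ℓ 3) (ℓ 5) (ℓ 7) (ℓ 6) (D (ℓ 5)) ⟩
    T - ι (+ 16) * (ι (+ 2) * (ι (+ 24) * (ℓ 1 * ℓ 5) + ι (+ 40) * (ℓ 3 * ℓ 3) + ι (+ 2) * (D (ℓ 5) - ℓ 6)) - R)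
      ≈⟨ +-congˡ (-‿cong (*-congˡ (+-congʳ heat₆))) ⟩
    T - ι (+ 16) * (R - R)
      ≈⟨ solve 2 (λ x r → x :- con (+ 16) :* (r :- r) := x) ≈-refl T R ⟩
    T ∎
    where
    T = ι (+ 12) * (Y * s₅) - s₇ + ι (+ 5) * (p * p)
    R = ι (+ 2) * ℓ 7 + (ι (ℤ.- + 4) * ℓ 6 + (ι (+ 6) * ℓ 5 + (ι (ℤ.- + 10) * ℓ 3 + ι (+ 6) * ℓ 1)))

-- Logarithmic derivatives and products

module Products {N : ℕ} (S : LambertRing N) where
  open LambertRing S renaming (refl to ≈-refl; sym to ≈-sym; trans to ≈-trans)
  open Solver using (solve; _:=_; _:+_; _:*_; _:-_; :-_; con)
  open import Relation.Binary.Reasoning.Setoid setoid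
  open Sums S
  open Lambert S
  open Eisenstein S
  open Algebra.Properties.Semiring.Exp semiring using (_^_)

  logD-* : ∀ {x y a b} → D x ≈ x * a → D y ≈ y * b → D (x * y) ≈ x * y * (a + b)
  logD-* {x} {y} {a} {b} Dx Dy = begin
    D (x * y)                    ≈⟨ D-* x y ⟩
    D x * y + x * D y            ≈⟨ +-cong (*-congʳ Dx) (*-congˡ Dy) ⟩
    x * a * y + x * (y * b)      ≈⟨ solve 4 (λ x y a b → x :* a :* y :+ x :* (y :* b) := x :* y :* (a :+ b)) ≈-refl x y a b ⟩
    x * y * (a + b)              ∎

  D-1# : D 1# ≈ 0#
  D-1# = ≈-trans (D-cong (≈-sym ι-1)) (D-ι (+ 1))

  logD-1# : D 1# ≈ 1# * 0#
  logD-1# = ≈-trans D-1# (≈-sym (zeroʳ 1#))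

  logD-^ : ∀ {x a} n → D x ≈ x * a → D (x ^ n) ≈ x ^ n * (ι (+ n) * a)
  logD-^ {x} {a} zero    Dx = ≈-trans logD-1# (*-congˡ (≈-sym (≈-trans (*-congʳ ι-0) (zeroˡ a))))
  logD-^ {x} {a} (suc n) Dx = ≈-trans (logD-* Dx (logD-^ n Dx)) (*-congˡ (begin
    a + ι (+ n) * a            ≈⟨ solve 2 (λ m a → a :+ m :* a := (con (+ 1) :+ m) :* a) ≈-refl (ι (+ n)) a ⟩
    (ι (+ 1) + ι (+ n)) * a    ≈⟨ *-congʳ (ι-+ (+ 1) (+ n)) ⟨
    ι (+ suc n) * a            ∎))

  logD-1-q : ∀ a → D (𝟙 - q (suc a)) ≈ (𝟙 - q (suc a)) * (- (ι (+ suc a) * g (suc a)))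
  logD-1-q a = begin
    D (𝟙 - x)
      ≈⟨ D-cong (solve 1 (λ x → con (+ 1) :- x := con (+ 1) :+ con (ℤ.- + 1) :* x) ≈-refl x) ⟩
    D (𝟙 + ι (ℤ.- + 1) * x)
      ≈⟨ D-affine (+ 1) (ℤ.- + 1) x ⟩
    ι (ℤ.- + 1) * D x
      ≈⟨ *-congˡ (D-q (suc a)) ⟩
    ι (ℤ.- + 1) * (c * x)
      ≈⟨ solve 3 (λ c x X → con (ℤ.- + 1) :* (c :* x) := :- (c :* (x :* (con (+ 1) :+ X) :- x :* X))) ≈-refl c x X ⟩
    - (c * (x * (𝟙 + X) - x * X))
      ≈⟨ -‿cong (*-congˡ (+-congʳ (g-rec a))) ⟩
    - (c * (X - x * X))
      ≈⟨ solve 3 (λ c x X → :- (c :* (X :- x :* X)) := (con (+ 1) :- x) :* (:- (c :* X))) ≈-refl c x X ⟩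
    (𝟙 - x) * (- (c * X)) ∎
    where
    x = q (suc a)
    X = g (suc a)
    c = ι (+ suc a)

  logD-1+g : ∀ a → D (𝟙 + g (suc a)) ≈ (𝟙 + g (suc a)) * (ι (+ suc a) * g (suc a))
  logD-1+g a = ≈-trans (D-𝟙+ _) (≈-trans (D-g a)
    (solve 2 (λ c X → c :* (X :+ X :* X) := (con (+ 1) :+ X) :* (c :* X)) ≈-refl (ι (+ suc a)) (g (suc a))))

  ∏₁ : ℕ → (ℕ → Carrier) → Carrier
  ∏₁ zero    f = 1#
  ∏₁ (suc n) f = ∏₁ n f * f (suc n)

  logD-∏ : ∀ n {f h} → (∀ i → D (f (suc i)) ≈ f (suc i) * h (suc i)) → D (∏₁ n f) ≈ ∏₁ n f * Σ₁ n h
  logD-∏ zero    e = logD-1#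
  logD-∏ (suc n) e = logD-* (logD-∏ n e) (e n)

  η²⁴-factor : ℕ → Carrier
  η²⁴-factor k = (𝟙 - q k) ^ 24

  η²⁴ : Carrier
  η²⁴ = ∏₁ N η²⁴-factor

  D-Δ : D (q 1 * η²⁴) ≈ q 1 * η²⁴ * (ι (+ 3) * Y - ι (+ 2) * A)
  D-Δ = ≈-trans
    (logD-* (≈-trans (D-q 1) (*-comm _ _)) (logD-∏ N (λ i → logD-^ 24 (logD-1-q i))))
    (*-congˡ (begin
      ι (+ 1) + Σ₁ N (λ k → ι (+ 24) * (- (ι (+ k) * g k)))
        ≈⟨ +-congˡ (≈-trans (Σ₁-cong N (λ _ → solve 1 (λ x → con (+ 24) :* (:- x) := con (ℤ.- + 24) :* x) ≈-refl _)) (Σ₁-*ˡ N _ _)) ⟩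
      ι (+ 1) + ι (ℤ.- + 24) * ℓ⁺
        ≈⟨ solve 2 (λ x v → con (+ 1) :+ con (ℤ.- + 24) :* v :=
             con (+ 3) :* (con (+ 1) :- con (+ 8) :* x) :- con (+ 2) :* (con (+ 1) :+ con (+ 12) :* v :- con (+ 12) :* x)) ≈-refl (ℓ 1) ℓ⁺ ⟩
      ι (+ 3) * Y - ι (+ 2) * A ∎))

  -- 1/(1+q^k), written as (1-q^k)/(1-q^{2k})
  U : ℕ → Carrier
  U k = (𝟙 - q k) * (𝟙 + g (k ℕ.+ k))

  U-inverse : ∀ a → U (suc a) * (𝟙 + q (suc a)) ≈ 𝟙
  U-inverse a = begin
    (𝟙 - x) * (𝟙 + G) * (𝟙 + x)      ≈⟨ solve 2 (λ x G → (con (+ 1) :- x) :* (con (+ 1) :+ G) :* (con (+ 1) :+ x) :=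
                                              (con (+ 1) :- x :* x) :* (con (+ 1) :+ G)) ≈-refl x G ⟩
    (𝟙 - x * x) * (𝟙 + G)            ≈⟨ *-congʳ (+-congˡ (-‿cong (q-+ (suc a) (suc a)))) ⟨
    (𝟙 - q (suc a ℕ.+ suc a)) * (𝟙 + G)  ≈⟨ g-inverse (a ℕ.+ suc a) ⟩
    𝟙                                ∎
    where
    x = q (suc a)
    G = g (suc a ℕ.+ suc a)

  φ : ℕ → Carrier
  φ n = ∏₁ n (λ k → (𝟙 - q k) * U k)

  -- The coefficient d (1 + (-1)^d) vanishes at odd d and is 2d at even d. This expresses the
  -- contribution of the factors 1/(1-q^{2k}) to the logarithmic derivative by `ℓ⁺` and `ℓ 1`.
  Σ-even : ∀ n → Σ₁ (n ℕ.+ n) (λ d → ι (pos d ℤ.+ u 1 d) * g d) ≈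
                 Σ₁ n (λ k → ι (+ 2) * (ι (+ (k ℕ.+ k)) * g (k ℕ.+ k)))
  Σ-even zero    = ≈-refl
  Σ-even (suc n) rewrite ℕ.+-suc n n = begin
    Σ₁ (n ℕ.+ n) (λ d → ι (pos d ℤ.+ u 1 d) * g d) + ι (+ m ℤ.+ u 1 m) * g m + ι (+ suc m ℤ.+ u 1 (suc m)) * g (suc m)
      ≈⟨ +-cong (+-cong (Σ-even n) (≈-trans (*-congʳ (≈-trans (reflexive (≡.cong ι odd)) ι-0)) (zeroˡ _)))
                (≈-trans (*-congʳ (≈-trans (reflexive (≡.cong ι even)) (ι-* (+ 2) (+ suc m)))) (*-assoc _ _ _)) ⟩
    Σ₁ n (λ k → ι (+ 2) * (ι (+ (k ℕ.+ k)) * g (k ℕ.+ k))) + 0# + ι (+ 2) * (ι (+ suc m) * g (suc m))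
      ≈⟨ +-congʳ (+-identityʳ _) ⟩
    Σ₁ n (λ k → ι (+ 2) * (ι (+ (k ℕ.+ k)) * g (k ℕ.+ k))) + ι (+ 2) * (ι (+ suc m) * g (suc m)) ∎
    where
    m = suc (n ℕ.+ n)
    ε-double : ε (n ℕ.+ n) ≡ + 1
    ε-double = ≡.trans (ε-+ n n) (ε-square n)
    cancel : ∀ x → x ℤ.+ ℤ.- + 1 ℤ.* (x ℤ.* + 1) ≡ + 0
    cancel = solve-∀
    double : ∀ x → x ℤ.+ + 1 ℤ.* (x ℤ.* + 1) ≡ + 2 ℤ.* x
    double = solve-∀
    odd : + m ℤ.+ u 1 m ≡ + 0
    odd = ≡.trans (≡.cong (λ e → + m ℤ.+ ℤ.- e ℤ.* (+ m) ℤ.^ 1) ε-double)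
                  (cancel (+ m))
    even : + suc m ℤ.+ u 1 (suc m) ≡ + 2 ℤ.* + suc m
    even = ≡.trans (≡.cong (λ e → + suc m ℤ.+ ℤ.- (ℤ.- e) ℤ.* (+ suc m) ℤ.^ 1) ε-double)
                   (double (+ suc m))

  D-φ⁸ : D (φ N ^ 8) ≈ φ N ^ 8 * (Y - A)
  D-φ⁸ = ≈-trans (logD-^ 8 (logD-∏ N (λ i → logD-* (logD-1-q i) (logD-* (logD-1-q i) (logD-1+g (i ℕ.+ suc i))))))
    (*-congˡ (begin
      ι (+ 8) * Σ₁ N (λ k → - (ι (+ k) * g k) + (- (ι (+ k) * g k) + ι (+ (k ℕ.+ k)) * g (k ℕ.+ k)))
        ≈⟨ Σ₁-*ˡ N (ι (+ 8)) _ ⟨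
      Σ₁ N (λ k → ι (+ 8) * (- (ι (+ k) * g k) + (- (ι (+ k) * g k) + ι (+ (k ℕ.+ k)) * g (k ℕ.+ k))))
        ≈⟨ Σ₁-cong N (λ _ → solve 2 (λ x y → con (+ 8) :* (:- x :+ (:- x :+ y)) := con (ℤ.- + 16) :* x :+ con (+ 4) :* (con (+ 2) :* y)) ≈-refl _ _) ⟩
      Σ₁ N (λ k → ι (ℤ.- + 16) * (ι (+ k) * g k) + ι (+ 4) * (ι (+ 2) * (ι (+ (k ℕ.+ k)) * g (k ℕ.+ k))))
        ≈⟨ ≈-trans (Σ₁-+ N _ _) (+-cong (Σ₁-*ˡ N _ _) (Σ₁-*ˡ N _ _)) ⟩
      ι (ℤ.- + 16) * ℓ⁺ + ι (+ 4) * Σ₁ N (λ k → ι (+ 2) * (ι (+ (k ℕ.+ k)) * g (k ℕ.+ k)))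
        ≈⟨ +-congˡ (*-congˡ (Σ-even N)) ⟨
      ι (ℤ.- + 16) * ℓ⁺ + ι (+ 4) * Σ₁ (N ℕ.+ N) (λ d → ι (pos d ℤ.+ u 1 d) * g d)
        -- The doubled indices reach 2N, but g_d is zero for d > N.
        ≈⟨ +-congˡ (*-congˡ (≈-trans (Σ₁-extend N N vanish) (L-+ pos (u 1)))) ⟩
      ι (ℤ.- + 16) * ℓ⁺ + ι (+ 4) * (ℓ⁺ + ℓ 1)
        ≈⟨ solve 2 (λ x v → con (ℤ.- + 16) :* v :+ con (+ 4) :* (v :+ x) :=
             (con (+ 1) :- con (+ 8) :* x) :- (con (+ 1) :+ con (+ 12) :* v :- con (+ 12) :* x)) ≈-refl (ℓ 1) ℓ⁺ ⟩
      Y - A ∎))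
    where
    vanish : ∀ {d} → N ℕ.< d → ι (pos d ℤ.+ u 1 d) * g d ≈ 0#
    vanish {suc d} lt = ≈-trans (*-congˡ (g-big lt)) (zeroʳ _)

  Θ : ℕ → Carrier
  Θ zero    = 𝟙
  Θ (suc n) = Θ n + ι (+ 2 ℤ.* ε (suc n)) * q (suc n ℕ.* suc n)

  private
    φ⁻¹ : ℕ → Carrier
    φ⁻¹ n = ∏₁ n (λ k → (𝟙 + q k) * (𝟙 + g k))

    -- The summand of Shanks' sum for s ≥ 1. The one for s = 0 is `φ n`, because 2/(1 + q^0) is 1;
    -- it is kept apart so that 2 is never inverted.
    T : ℕ → ℕ → Carrier
    T n s = ι (ε s) * φ n * φ⁻¹ s * (ι (+ 2) * U s) * q (s ℕ.* suc n)

    -- A telescoping certificate in the style of Wilf and Zeilberger: the change of `T` under n ↦ n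
    -- + 1 is a difference of `z` in s.
    z : ℕ → ℕ → Carrier
    z n s = ι (ε (suc s)) * q (suc s ℕ.* suc n) * φ n * U (suc n) * (ι (+ 2) * φ⁻¹ s)

  -- The telescoping relation with x = q^{n+1} and y = q^s for the s in question. The solver knows
  -- no inverses, so the relations for U = 1/(1+x), V = 1/(1+y) and a = 1/(1-y) are applied one by
  -- one between polynomial rearrangements.
  shanks-algebra : ∀ e P i Q {U V a x y} → V * (𝟙 + y) ≈ 𝟙 → U * (𝟙 + x) ≈ 𝟙 → (𝟙 - y) * a ≈ 𝟙 →
    e * (P * ((𝟙 - x) * U)) * (i * ((𝟙 + y) * a)) * (ι (+ 2) * V) * (Q * y) ≈
    e * P * (i * ((𝟙 + y) * a)) * (ι (+ 2) * V) * Q +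
    ((- e) * (x * Q) * P * U * (ι (+ 2) * (i * ((𝟙 + y) * a))) - e * Q * P * U * (ι (+ 2) * i))
  shanks-algebra e P i Q {U} {V} {a} {x} {y} V⁻¹ U⁻¹ a⁻¹ = begin
    e * (P * ((𝟙 - x) * U)) * (i * ((𝟙 + y) * a)) * (ι (+ 2) * V) * (Q * y)
      ≈⟨ solve 9 (λ e P i Q U V a x y →
           e :* (P :* ((con (+ 1) :- x) :* U)) :* (i :* ((con (+ 1) :+ y) :* a)) :* (con (+ 2) :* V) :* (Q :* y) :=
           con (+ 2) :* e :* P :* Q :* i :* a :* U :* y :* (con (+ 1) :- x) :* (V :* (con (+ 1) :+ y))) ≈-refl e P i Q U V a x y ⟩
    ι (+ 2) * e * P * Q * i * a * U * y * (𝟙 - x) * (V * (𝟙 + y))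
      ≈⟨ *-congˡ V⁻¹ ⟩
    ι (+ 2) * e * P * Q * i * a * U * y * (𝟙 - x) * 𝟙
      ≈⟨ solve 8 (λ e P i Q U a x y →
           con (+ 2) :* e :* P :* Q :* i :* a :* U :* y :* (con (+ 1) :- x) :* con (+ 1) :=
           con (+ 2) :* e :* P :* Q :* i :* a :* (U :* (con (+ 1) :+ x)) :+
           ((:- e) :* (x :* Q) :* P :* U :* (con (+ 2) :* (i :* ((con (+ 1) :+ y) :* a))) :-
            con (+ 2) :* e :* Q :* P :* U :* i :* ((con (+ 1) :- y) :* a))) ≈-refl e P i Q U a x y ⟩
    ι (+ 2) * e * P * Q * i * a * (U * (𝟙 + x)) + (M - ι (+ 2) * e * Q * P * U * i * ((𝟙 - y) * a))
      -- The unit released by U is written again as V (1 + y), the form that the target summand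
      -- contains.
      ≈⟨ +-cong (*-congˡ (≈-trans U⁻¹ (≈-sym V⁻¹))) (+-congˡ (-‿cong (*-congˡ a⁻¹))) ⟩
    ι (+ 2) * e * P * Q * i * a * (V * (𝟙 + y)) + (M - ι (+ 2) * e * Q * P * U * i * 𝟙)
      ≈⟨ solve 9 (λ e P i Q U V a y M →
           con (+ 2) :* e :* P :* Q :* i :* a :* (V :* (con (+ 1) :+ y)) :+ (M :- con (+ 2) :* e :* Q :* P :* U :* i :* con (+ 1)) :=
           e :* P :* (i :* ((con (+ 1) :+ y) :* a)) :* (con (+ 2) :* V) :* Q :+ (M :- e :* Q :* P :* U :* (con (+ 2) :* i))) ≈-refl
           e P i Q U V a y M ⟩
    e * P * (i * ((𝟙 + y) * a)) * (ι (+ 2) * V) * Q + (M - e * Q * P * U * (ι (+ 2) * i)) ∎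
    where M = (- e) * (x * Q) * P * U * (ι (+ 2) * (i * ((𝟙 + y) * a)))

  private
    T-step : ∀ n s → T (suc n) (suc s) ≈ T n (suc s) + (z n (suc s) - z n s)
    T-step n s = begin
      T (suc n) (suc s)
        ≈⟨ *-congˡ (≈-trans (reflexive (≡.cong q (≡.trans (ℕ.*-suc (suc s) (suc n)) (ℕ.+-comm (suc s) _)))) (q-+ _ (suc s))) ⟩
      ι (ε (suc s)) * (φ n * ((𝟙 - x) * U (suc n))) * (φ⁻¹ s * ((𝟙 + y) * (𝟙 + g (suc s)))) * (ι (+ 2) * U (suc s)) * (Q * y)
        ≈⟨ shanks-algebra _ _ _ _ (U-inverse s) (U-inverse n) (g-inverse s) ⟩
      T n (suc s) + ((- ι (ε (suc s))) * (x * Q) * φ n * U (suc n) * (ι (+ 2) * φ⁻¹ (suc s)) - z n s)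
        ≈⟨ +-congˡ (+-congʳ (*-congʳ (*-congʳ (*-congʳ (*-cong (ι-neg (ε (suc s))) (q-+ (suc n) _)))))) ⟨
      T n (suc s) + (z n (suc s) - z n s) ∎
      where
      x = q (suc n)
      y = q (suc s)
      Q = q (suc s ℕ.* suc n)

    T-sum : ∀ n m → φ (suc n) + Σ₁ m (T (suc n)) ≈ φ n + Σ₁ m (T n) + z n m
    T-sum n zero = begin
      φ n * ((𝟙 - x) * U (suc n)) + 0#
        ≈⟨ +-identityʳ _ ⟩
      φ n * ((𝟙 - x) * U (suc n))
        -- Since 1 - x = (1 + x) - 2x, the factor (1 - x) U is 1 - 2 x U, and the second part is
        -- `z n 0`.
        ≈⟨ solve 3 (λ P x U → P :* ((con (+ 1) :- x) :* U) :=
             P :* (U :* (con (+ 1) :+ x)) :+ con (ℤ.- + 1) :* x :* P :* U :* (con (+ 2) :* con (+ 1))) ≈-refl (φ n) x (U (suc n)) ⟩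
      φ n * (U (suc n) * (𝟙 + x)) + ι (ℤ.- + 1) * x * φ n * U (suc n) * (ι (+ 2) * 𝟙)
        ≈⟨ +-cong (≈-trans (*-congˡ (U-inverse n)) (≈-trans (*-𝟙 _) (≈-sym (+-identityʳ _))))
                  (*-cong (*-congʳ (*-congʳ (*-congˡ (reflexive (≡.cong q (≡.sym (ℕ.*-identityˡ (suc n)))))))) (*-congˡ ι-1)) ⟩
      φ n + 0# + z n 0 ∎
      where x = q (suc n)
    T-sum n (suc m) = begin
      φ (suc n) + (Σ₁ m (T (suc n)) + T (suc n) (suc m))
        ≈⟨ +-assoc _ _ _ ⟨
      φ (suc n) + Σ₁ m (T (suc n)) + T (suc n) (suc m)
        ≈⟨ +-cong (T-sum n m) (T-step n m) ⟩
      φ n + Σ₁ m (T n) + z n m + (T n (suc m) + (z n (suc m) - z n m))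
        ≈⟨ solve 5 (λ a b c t d → a :+ b :+ c :+ (t :+ (d :- c)) := a :+ (b :+ t) :+ d) ≈-refl _ _ _ _ _ ⟩
      φ n + (Σ₁ m (T n) + T n (suc m)) + z n (suc m) ∎

  -- Shanks' finite form of Gauss' identity:
  -- Σ_{|s|≤n} (-1)^s q^{s²} = Σ_{0≤s≤n} (-1)^s (φ n / φ s) 2 q^{s(n+1)} / (1 + q^s).
  shanks : ∀ n → Θ n ≈ φ n + Σ₁ n (T n)
  shanks zero    = ≈-trans ι-1 (≈-sym (+-identityʳ _))
  shanks (suc n) = begin
    Θ n + ι (+ 2 ℤ.* e) * q (suc n ℕ.* suc n)
      ≈⟨ +-cong (shanks n) last ⟩
    φ n + Σ₁ n (T n) + (z n n + T (suc n) (suc n))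
      ≈⟨ +-assoc _ _ _ ⟨
    φ n + Σ₁ n (T n) + z n n + T (suc n) (suc n)
      ≈⟨ +-congʳ (T-sum n n) ⟨
    φ (suc n) + Σ₁ n (T (suc n)) + T (suc n) (suc n)
      ≈⟨ +-assoc _ _ _ ⟩
    φ (suc n) + Σ₁ (suc n) (T (suc n)) ∎
    where
    e = ε (suc n)
    x = q (suc n)
    Q = q (suc n ℕ.* suc n)

    φ-inverse : ∀ n → φ n * φ⁻¹ n ≈ 𝟙
    φ-inverse zero    = ≈-trans (*-identityʳ 1#) (≈-sym ι-1)
    φ-inverse (suc n) = begin
      φ n * ((𝟙 - q (suc n)) * U (suc n)) * (φ⁻¹ n * ((𝟙 + q (suc n)) * (𝟙 + g (suc n))))
        ≈⟨ solve 6 (λ P a U I b G → P :* (a :* U) :* (I :* (b :* G)) := (P :* I) :* ((U :* b) :* (a :* G))) ≈-refl _ _ _ _ _ _ ⟩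
      (φ n * φ⁻¹ n) * ((U (suc n) * (𝟙 + q (suc n))) * ((𝟙 - q (suc n)) * (𝟙 + g (suc n))))
        ≈⟨ *-cong (φ-inverse n) (*-cong (U-inverse n) (g-inverse n)) ⟩
      𝟙 * (𝟙 * 𝟙)
        ≈⟨ ≈-trans (*-congˡ (*-𝟙 𝟙)) (*-𝟙 𝟙) ⟩
      𝟙 ∎

    last : ι (+ 2 ℤ.* e) * Q ≈ z n n + T (suc n) (suc n)
    last = begin
      ι (+ 2 ℤ.* e) * Q
        ≈⟨ *-congʳ (ι-* (+ 2) e) ⟩
      ι (+ 2) * ι e * Q
        ≈⟨ solve 2 (λ e Q → con (+ 2) :* e :* Q := con (+ 2) :* e :* Q :* (con (+ 1) :* con (+ 1))) ≈-refl (ι e) Q ⟩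
      ι (+ 2) * ι e * Q * (𝟙 * 𝟙)
        ≈⟨ *-congˡ (*-cong (φ-inverse n) (U-inverse n)) ⟨
      ι (+ 2) * ι e * Q * ((φ n * φ⁻¹ n) * (U (suc n) * (𝟙 + x)))
        ≈⟨ solve 6 (λ e Q P I U x → con (+ 2) :* e :* Q :* ((P :* I) :* (U :* (con (+ 1) :+ x))) :=
             e :* Q :* P :* U :* (con (+ 2) :* I) :+ e :* (P :* I) :* (con (+ 2) :* U) :* (Q :* x)) ≈-refl (ι e) Q (φ n) (φ⁻¹ n) (U (suc n)) x ⟩
      z n n + ι e * (φ n * φ⁻¹ n) * (ι (+ 2) * U (suc n)) * (Q * x)
        ≈⟨ +-congˡ (*-cong (*-congʳ (≈-trans (*-congˡ (≈-trans (φ-inverse n) (≈-sym (φ-inverse (suc n))))) (≈-sym (*-assoc _ _ _))))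
             (≈-trans (≈-sym (q-+ _ (suc n))) (reflexive (≡.cong q (≡.trans (ℕ.+-comm _ (suc n)) (≡.sym (ℕ.*-suc (suc n) (suc n)))))))) ⟩
      z n n + T (suc n) (suc n) ∎

  -- At n = N each correction term of `shanks` carries q^{s(N+1)}, which is zero in the truncated
  -- ring; what is left is Gauss' identity.
  Θ≈φ : Θ N ≈ φ N
  Θ≈φ = ≈-trans (shanks N) (≈-trans (+-congˡ (≈-trans (Σ₁-cong N (λ {i} _ → T-big i)) (Σ₁-0 N))) (+-identityʳ _))
    where
    T-big : ∀ i → T N (suc i) ≈ 0#
    T-big i = ≈-trans (*-congˡ (q-big (ℕ.m≤m+n (suc N) (i ℕ.* suc N)))) (zeroʳ _)
    Σ₁-0 : ∀ n → Σ₁ n (λ _ → 0#) ≈ 0#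
    Σ₁-0 zero    = ≈-refl
    Σ₁-0 (suc n) = ≈-trans (+-identityʳ _) (Σ₁-0 n)

-- Differential equations for θ(-q)⁸ and Δ

module Differential {N : ℕ} (S : LambertRing N) where
  open LambertRing S renaming (refl to ≈-refl; sym to ≈-sym; trans to ≈-trans)
  open Solver using (solve; _:=_; _:+_; _:*_; _:-_; :-_; con)
  open import Relation.Binary.Reasoning.Setoid setoid
  open Sums S
  open Lambert S
  open Eisenstein S
  open Products S
  open Algebra.Properties.Semiring.Exp semiring using (_^_; ^-congˡ)

  -- D h = h a is linear in h, so the equality of two solutions becomes the vanishing of a third, to
  -- which `ode-zero` applies.
  logD-- : ∀ {x y a} → D x ≈ x * a → D y ≈ y * a → D (x - y) ≈ (x - y) * a
  logD-- {x} {y} {a} Dx Dy = begin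
    D (x - y)                    ≈⟨ D-cong (solve 2 (λ x y → x :- y := x :+ con (ℤ.- + 1) :* y) ≈-refl x y) ⟩
    D (x + ι (ℤ.- + 1) * y)      ≈⟨ D-+ _ _ ⟩
    D x + D (ι (ℤ.- + 1) * y)    ≈⟨ +-cong Dx (≈-trans (D-scale _ y) (*-congˡ Dy)) ⟩
    x * a + ι (ℤ.- + 1) * (y * a)  ≈⟨ solve 3 (λ x y a → x :* a :+ con (ℤ.- + 1) :* (y :* a) := (x :- y) :* a) ≈-refl x y a ⟩
    (x - y) * a                  ∎

  logD-p : D p ≈ p * (Y - A)
  logD-p = begin
    D p              ≈⟨ D-p ⟩
    Y * p - s₅       ≈⟨ +-congˡ (-‿cong s₅≈A*p) ⟩
    Y * p - A * p    ≈⟨ solve 3 (λ Y A p → Y :* p :- A :* p := p :* (Y :- A)) ≈-refl Y A p ⟩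
    p * (Y - A)      ∎

  logD-Θ⁸-p : D (Θ N ^ 8 - p) ≈ (Θ N ^ 8 - p) * (Y - A)
  logD-Θ⁸-p = logD-- (≈-trans (D-cong (^-congˡ 8 Θ≈φ)) (≈-trans D-φ⁸ (*-congʳ (^-congˡ 8 (≈-sym Θ≈φ))))) logD-p

  -- The factor 4 is chosen because only 8 D `s₅` is given by an integral relation, and 4 D(s₅²) =
  -- (8 D s₅) s₅.
  V : Carrier
  V = ι (+ 4) * (s₅ * s₅ - p * (p * p))

  logD-V : D V ≈ V * (ι (+ 3) * Y - ι (+ 2) * A)
  logD-V = begin
    D V
      ≈⟨ D-scale (+ 4) _ ⟩
    ι (+ 4) * D (s₅ * s₅ - p * (p * p))
      ≈⟨ *-congˡ (≈-trans (D-cong (solve 2 (λ x y → x :- y := x :+ con (ℤ.- + 1) :* y) ≈-refl _ _))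
           (≈-trans (D-+ _ _) (+-cong (D-* s₅ s₅) (≈-trans (D-scale _ _) (*-congˡ (≈-trans (D-* p (p * p)) (+-congˡ (*-congˡ (D-* p p))))))))) ⟩
    ι (+ 4) * ((D s₅ * s₅ + s₅ * D s₅) + ι (ℤ.- + 1) * (D p * (p * p) + p * (D p * p + p * D p)))
      ≈⟨ solve 4 (λ s p s′ p′ →
           con (+ 4) :* ((s′ :* s :+ s :* s′) :+ con (ℤ.- + 1) :* (p′ :* (p :* p) :+ p :* (p′ :* p :+ p :* p′))) :=
           (con (+ 8) :* s′) :* s :- con (+ 12) :* (p :* p) :* p′) ≈-refl s₅ p (D s₅) (D p) ⟩
    (ι (+ 8) * D s₅) * s₅ - ι (+ 12) * (p * p) * D p
      ≈⟨ +-cong (*-congʳ (≈-trans 8D-s₅ (+-congʳ (+-congˡ (-‿cong s₇≈9p²+8As₅))))) (-‿cong (*-congˡ D-p)) ⟩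
    (ι (+ 12) * (Y * s₅) - (ι (+ 9) * (p * p) + ι (+ 8) * (A * s₅)) + ι (+ 5) * (p * p)) * s₅ -
      ι (+ 12) * (p * p) * (Y * p - s₅)
      -- After the substitutions, the failure of the expected formula is a multiple of s₅ - A p,
      -- which is zero.
      ≈⟨ solve 4 (λ s p Y A →
           (con (+ 12) :* (Y :* s) :- (con (+ 9) :* (p :* p) :+ con (+ 8) :* (A :* s)) :+ con (+ 5) :* (p :* p)) :* s :-
             con (+ 12) :* (p :* p) :* (Y :* p :- s) :=
           con (+ 4) :* (s :* s :- p :* (p :* p)) :* (con (+ 3) :* Y :- con (+ 2) :* A) :+ con (+ 8) :* (p :* p) :* (s :- A :* p)) ≈-refl
           s₅ p Y A ⟩
    V * (ι (+ 3) * Y - ι (+ 2) * A) + ι (+ 8) * (p * p) * (s₅ - A * p)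
      ≈⟨ +-congˡ (*-congˡ (+-congʳ s₅≈A*p)) ⟩
    V * (ι (+ 3) * Y - ι (+ 2) * A) + ι (+ 8) * (p * p) * (A * p - A * p)
      ≈⟨ solve 3 (λ v p a → v :+ con (+ 8) :* (p :* p) :* (a :- a) := v) ≈-refl _ p (A * p) ⟩
    V * (ι (+ 3) * Y - ι (+ 2) * A) ∎

  logD-V-Δ : D (V - ι (+ 256) * (q 1 * η²⁴)) ≈ (V - ι (+ 256) * (q 1 * η²⁴)) * (ι (+ 3) * Y - ι (+ 2) * A)
  logD-V-Δ = logD-- logD-V (≈-trans (D-scale _ _) (≈-trans (*-congˡ D-Δ) (≈-sym (*-assoc _ _ _))))

  p*s₇ : p * s₇ ≈ ι (+ 9) * (p * (p * p)) + ι (+ 8) * (s₅ * s₅)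
  p*s₇ = begin
    p * s₇
      ≈⟨ *-congˡ s₇≈9p²+8As₅ ⟩
    p * (ι (+ 9) * (p * p) + ι (+ 8) * (A * s₅))
      ≈⟨ solve 3 (λ p A s → p :* (con (+ 9) :* (p :* p) :+ con (+ 8) :* (A :* s)) :=
           con (+ 9) :* (p :* (p :* p)) :+ con (+ 8) :* ((A :* p) :* s)) ≈-refl p A s₅ ⟩
    ι (+ 9) * (p * (p * p)) + ι (+ 8) * ((A * p) * s₅)
      ≈⟨ +-congˡ (*-congˡ (*-congʳ s₅≈A*p)) ⟨
    ι (+ 9) * (p * (p * p)) + ι (+ 8) * (s₅ * s₅) ∎

-- Uniqueness of solutions

-- The coefficient of q^n in D h = h e reads (n - e(0)) h_n = Σ_{j<n} h_j e_{n-j}, and the right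
-- side is zero by induction. As ℤ has no zero divisors, h_n can be nonzero only at n = e(0), where
-- `resonant` supplies its value.
ode-zero : ∀ {N} (h e : Series) → Agree N (θ∂ h) (h *S e) →
  (∀ {n} → n ℕ.≤ N → + n ≡ e 0 → h n ≡ + 0) → ∀ n → n ℕ.≤ N → ∀ {j} → j ℕ.≤ n → h j ≡ + 0
ode-zero {N} h e ode resonant = go
  where
  open Weights using (solve; _:=_; _:*_; _:-_)

  cancel : ∀ n → n ℕ.≤ N → + n ℤ.* h n ≡ h n ℤ.* e 0 → h n ≡ + 0
  cancel n n≤N eq with ℤ.i*j≡0⇒i≡0∨j≡0 (+ n ℤ.- e 0) {h n} zero-product
    where
    zero-product : (+ n ℤ.- e 0) ℤ.* h n ≡ + 0
    zero-product = begin
      (+ n ℤ.- e 0) ℤ.* h n            ≡⟨ solve 3 (λ n e h → (n :- e) :* h := n :* h :- h :* e) refl (+ n) (e 0) (h n) ⟩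
      + n ℤ.* h n ℤ.- h n ℤ.* e 0      ≡⟨ cong (ℤ._- (h n ℤ.* e 0)) eq ⟩
      h n ℤ.* e 0 ℤ.- h n ℤ.* e 0      ≡⟨ ℤ.+-inverseʳ (h n ℤ.* e 0) ⟩
      + 0                              ∎
      where open ≡.≡-Reasoning
  ... | inj₁ n≡e = resonant n≤N (ℤ.i-j≡0⇒i≡j (+ n) (e 0) n≡e)
  ... | inj₂ h≡0 = h≡0

  go : ∀ n → n ℕ.≤ N → ∀ {j} → j ℕ.≤ n → h j ≡ + 0
  go zero    n≤N z≤n = cancel 0 n≤N (at ode n≤N)
  go (suc n) n<N {j} j≤n with ℕ.m≤n⇒m<n∨m≡n j≤n
  ... | inj₁ (s≤s j<n) = go n (ℕ.<⇒≤ n<N) j<n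
  ... | inj₂ refl      = cancel (suc n) n<N (trans (at ode n<N) (begin
    Σ≤ n (λ j → h j ℤ.* e (suc n ℕ.∸ j)) ℤ.+ h (suc n) ℤ.* e (n ℕ.∸ n)
      ≡⟨ cong₂ ℤ._+_
           (Σ≤-0 n (λ {j} j≤n → trans (cong (ℤ._* e (suc n ℕ.∸ j)) (go n (ℕ.<⇒≤ n<N) j≤n)) (ℤ.*-zeroˡ (e (suc n ℕ.∸ j)))))
           (cong (λ k → h (suc n) ℤ.* e k) (ℕ.n∸n≡0 n)) ⟩
    + 0 ℤ.+ h (suc n) ℤ.* e 0
      ≡⟨ ℤ.+-identityˡ _ ⟩
    h (suc n) ℤ.* e 0 ∎))
    where open ≡.≡-Reasoning

-- Divisor sums and the truncated eta product

Σℤ-cong : ∀ n {s t : ℕ → ℤ} → (∀ i → s (suc i) ≡ t (suc i)) → Σℤ n s ≡ Σℤ n t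
Σℤ-cong zero    e = refl
Σℤ-cong (suc n) e = cong₂ ℤ._+_ (Σℤ-cong n e) (e n)

Σℤ-0 : ∀ n {t : ℕ → ℤ} → (∀ i → t (suc i) ≡ + 0) → Σℤ n t ≡ + 0
Σℤ-0 zero    e = refl
Σℤ-0 (suc n) e = cong₂ ℤ._+_ (Σℤ-0 n e) (e n)

Σℤ-extend : ∀ {m n} {t : ℕ → ℤ} → m ℕ.≤ n → (∀ {i} → m ℕ.≤ i → t (suc i) ≡ + 0) → Σℤ n t ≡ Σℤ m t
Σℤ-extend {m} {n} {t} m≤n e = subst (λ k → Σℤ k t ≡ Σℤ m t) (ℕ.m∸n+n≡m m≤n) (go (n ℕ.∸ m))
  where
  go : ∀ k → Σℤ (k ℕ.+ m) t ≡ Σℤ m t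
  go zero    = refl
  go (suc k) = trans (cong₂ ℤ._+_ (go k) (e (ℕ.m≤n+m m k))) (ℤ.+-identityʳ _)

sign≡ε : ∀ n → sign n ≡ ε n
sign≡ε 0             = refl
sign≡ε 1             = refl
sign≡ε (suc (suc n)) = trans periodic (trans (sign≡ε n) (sym (ℤ.neg-involutive (ε n))))
  where
  periodic : sign (2 ℕ.+ n) ≡ sign n
  periodic with 2 ∣? n | 2 ∣? (2 ℕ.+ n)
  ... | yes _  | yes _   = refl
  ... | no _   | no _    = refl
  ... | yes d  | no ¬d   = contradiction (∣m∣n⇒∣m+n ∣-refl d) ¬d
  ... | no ¬d  | yes d   = contradiction (∣m+n∣m⇒∣n d ∣-refl) ¬d

pos-^ : ∀ d s → + (d ℕ.^ s) ≡ (+ d) ℤ.^ s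
pos-^ d zero    = refl
pos-^ d (suc s) = trans (ℤ.pos-* d (d ℕ.^ s)) (cong (+ d ℤ.*_) (pos-^ d s))

-- The body `_` (here and in partialConv) is solved by the equation that follows; this names
-- the local functions in the definitions of σ*pos and conv.
mutual
  sumℤ : ℕ → ℕ → List ℤ → ℤ
  sumℤ s n xs = _

  σ*pos-sumℤ : ∀ s n → σ*pos s n ≡ ℤ.- sumℤ s n (map (λ d → sign d ℤ.* (+ (d ℕ.^ s))) (divisors n))
  σ*pos-sumℤ s n with map (λ d → sign d ℤ.* (+ (d ℕ.^ s))) (divisors n) | ℤ.-_
  ... | xs | neg = refl

sumℤ-∷ʳ : ∀ s n xs x → sumℤ s n (xs ++ x ∷ []) ≡ sumℤ s n xs ℤ.+ x
sumℤ-∷ʳ s n []       x = ℤ.+-comm x (+ 0)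
sumℤ-∷ʳ s n (y ∷ xs) x = trans (cong (λ z → y ℤ.+ z) (sumℤ-∷ʳ s n xs x)) (sym (ℤ.+-assoc y _ x))

geo-> : ∀ {a n} → n ℕ.< a → geo a n ≡ + 0
geo-> {a} {zero}  _   = refl
geo-> {a} {suc n} n<a = geo-∤ (λ d → ℕ.<⇒≱ n<a (∣⇒≤ d))

-- The filter becomes the indicator `geo`. The list of candidates is grown at its right end, the end
-- at which `Σℤ` recurses.
σ*pos≡Σ : ∀ s n → σ*pos s (suc n) ≡ ℤ.- Σℤ (suc n) (λ a → u s a ℤ.* geo a (suc n))
σ*pos≡Σ s n = trans (σ*pos-sumℤ s (suc n)) (cong ℤ.-_ (go (suc n)))
  where
  open ≡.≡-Reasoning

  term : ℕ → ℤ
  term d = sign d ℤ.* (+ (d ℕ.^ s))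

  P? = λ d → d ∣? suc n

  last : ∀ m xs → sumℤ s (suc n) (map term (xs ++ filter P? (suc m ∷ []))) ≡
         sumℤ s (suc n) (map term xs) ℤ.+ u s (suc m) ℤ.* geo (suc m) (suc n)
  last m xs = case suc m ∣? suc n of λ where
    (no ∤n) → begin
      sumℤ s (suc n) (map term (xs ++ filter P? (suc m ∷ [])))
        ≡⟨ cong (λ l → sumℤ s (suc n) (map term (xs ++ l))) (List.filter-reject P? ∤n) ⟩
      sumℤ s (suc n) (map term (xs ++ []))
        ≡⟨ cong (sumℤ s (suc n) ∘ map term) (List.++-identityʳ xs) ⟩
      sumℤ s (suc n) (map term xs)
        ≡⟨ ℤ.+-identityʳ _ ⟨
      sumℤ s (suc n) (map term xs) ℤ.+ + 0
        ≡⟨ cong (λ z → sumℤ s (suc n) (map term xs) ℤ.+ z)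
             (trans (cong (u s (suc m) ℤ.*_) (geo-∤ ∤n)) (ℤ.*-zeroʳ (u s (suc m)))) ⟨
      sumℤ s (suc n) (map term xs) ℤ.+ u s (suc m) ℤ.* geo (suc m) (suc n) ∎
    (yes ∣n) → begin
      sumℤ s (suc n) (map term (xs ++ filter P? (suc m ∷ [])))
        ≡⟨ cong (λ l → sumℤ s (suc n) (map term (xs ++ l))) (List.filter-accept P? ∣n) ⟩
      sumℤ s (suc n) (map term (xs ++ suc m ∷ []))
        ≡⟨ cong (sumℤ s (suc n)) (List.map-++ term xs (suc m ∷ [])) ⟩
      sumℤ s (suc n) (map term xs ++ term (suc m) ∷ [])
        ≡⟨ sumℤ-∷ʳ s (suc n) (map term xs) (term (suc m)) ⟩
      sumℤ s (suc n) (map term xs) ℤ.+ term (suc m)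
        ≡⟨ cong (λ z → sumℤ s (suc n) (map term xs) ℤ.+ z)
             (trans (cong₂ ℤ._*_ (sign≡ε (suc m)) (pos-^ (suc m) s))
               (trans (sym (ℤ.*-identityʳ (u s (suc m)))) (cong (u s (suc m) ℤ.*_) (sym (geo-∣ ∣n))))) ⟩
      sumℤ s (suc n) (map term xs) ℤ.+ u s (suc m) ℤ.* geo (suc m) (suc n) ∎

  go : ∀ m → sumℤ s (suc n) (map term (filter P? (map suc (upTo m)))) ≡ Σℤ m (λ a → u s a ℤ.* geo a (suc n))
  go zero    = refl
  go (suc m) = begin
    sumℤ s (suc n) (map term (filter P? (map suc (upTo (suc m)))))
      ≡⟨ cong (λ l → sumℤ s (suc n) (map term (filter P? (map suc l)))) (List.upTo-∷ʳ m) ⟨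
    sumℤ s (suc n) (map term (filter P? (map suc (upTo m ++ m ∷ []))))
      ≡⟨ cong (λ l → sumℤ s (suc n) (map term (filter P? l))) (List.map-++ suc (upTo m) (m ∷ [])) ⟩
    sumℤ s (suc n) (map term (filter P? (map suc (upTo m) ++ suc m ∷ [])))
      ≡⟨ cong (sumℤ s (suc n) ∘ map term) (List.filter-++ P? (map suc (upTo m)) (suc m ∷ [])) ⟩
    sumℤ s (suc n) (map term (filter P? (map suc (upTo m)) ++ filter P? (suc m ∷ [])))
      ≡⟨ last m (filter P? (map suc (upTo m))) ⟩
    sumℤ s (suc n) (map term (filter P? (map suc (upTo m)))) ℤ.+ u s (suc m) ℤ.* geo (suc m) (suc n)
      ≡⟨ cong (ℤ._+ (u s (suc m) ℤ.* geo (suc m) (suc n))) (go m) ⟩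
    Σℤ (suc m) (λ a → u s a ℤ.* geo a (suc n)) ∎

^-≈1 : ∀ {N f} k → Agree N f oneS → Agree N (f ^S k) oneS
^-≈1 zero    e = agree (λ _ → refl)
^-≈1 {N} {f} (suc k) e = agree (λ {n} n≤N → trans (*S-cong (at e) (at (^-≈1 k e)) n≤N) (one-*S oneS n))

oneMinusQ≈1 : ∀ m → Agree m (oneMinusQ (suc m)) oneS
oneMinusQ≈1 m = agree λ { {zero} _ → refl ; {suc n} n<m → go n n<m }
  where
  go : ∀ n → n ℕ.< m → oneMinusQ (suc m) (suc n) ≡ + 0
  go n n<m with suc n ℕ.≟ suc m
  ... | yes refl = contradiction n<m (ℕ.<-irrefl refl)
  ... | no _     = refl

-- (1 - q^{m+1})^24 is 1 up to degree m. This bridges the m factors from which τ(m+1) is read and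
-- the m + 1 factors of `η²⁴` when N = m + 1.
etaProd-stable : ∀ m → etaProd (suc m) m ≡ etaProd m m
etaProd-stable m = trans
  (*S-cong {m} {f = etaProd m} {g = oneMinusQ (suc m) ^S 24} {g′ = oneS}
    (λ _ → refl) (at (^-≈1 {m} {oneMinusQ (suc m)} 24 (oneMinusQ≈1 m))) ℕ.≤-refl)
  (trans (*S-comm (etaProd m) oneS m) (one-*S (etaProd m) m))

oneMinusQ≡1-mono : ∀ k n → oneMinusQ (suc k) n ≡ (const (+ 1) +S -S mono (suc k)) n
oneMinusQ≡1-mono k zero    = refl
oneMinusQ≡1-mono k (suc n) with suc n ℕ.≟ suc k
... | yes _ = refl
... | no _  = refl

-- The series identities in terms of coefficients

module Coefficients (N : ℕ) where
  open Weights using (solve; _:=_; _:+_; _:*_; _:-_; :-_; k)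
  open Sums (truncated N) using (Σ₁; 𝟙)
  open Lambert (truncated N) using (L)
  open Eisenstein (truncated N)
  open Products (truncated N)
  open Differential (truncated N)
  open LambertRing (truncated N) using (_≈_; _-_; q; *-cong; *-congˡ; semiring)
    renaming (sym to ≈-sym; trans to ≈-trans; refl to ≈-refl)
  open Algebra.Properties.Semiring.Exp semiring using (_^_; ^-congˡ; ^-assocʳ)

  ^S≈^ : ∀ {f g} k → f ≈ g → f ^S k ≈ g ^ k
  ^S≈^ zero    e = ≈-refl
  ^S≈^ (suc k) e = *-cong e (^S≈^ k e)

  ^-at-0 : ∀ f k → f 0 ≡ + 1 → (f ^ k) 0 ≡ + 1
  ^-at-0 f zero    e = refl
  ^-at-0 f (suc k) e = cong₂ ℤ._*_ e (^-at-0 f k e)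

  Σ₁-at : ∀ m f n → Σ₁ m f n ≡ Σℤ m (λ a → f a n)
  Σ₁-at zero    f n = refl
  Σ₁-at (suc m) f n = cong (ℤ._+ f (suc m) n) (Σ₁-at m f n)

  L-at : ∀ v n → L v n ≡ Σℤ N (λ a → v a ℤ.* geo a n)
  L-at v n = trans (Σ₁-at N _ n) (Σℤ-cong N (λ i → const-*S (v (suc i)) (geo (suc i)) n))

  L-at-0 : ∀ v → L v 0 ≡ + 0
  L-at-0 v = trans (L-at v 0) (Σℤ-0 N (λ i → ℤ.*-zeroʳ (v (suc i))))

  ℓ-at : ∀ s {n} → suc n ℕ.≤ N → ℓ s (suc n) ≡ ℤ.- σ*pos s (suc n)
  ℓ-at s {n} n<N = begin
    ℓ s (suc n)                                               ≡⟨ L-at (u s) (suc n) ⟩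
    Σℤ N (λ a → u s a ℤ.* geo a (suc n))
      -- The Lambert sum runs up to N, but no index beyond n + 1 divides n + 1.
      ≡⟨ Σℤ-extend n<N (λ {i} n<i → trans (cong (u s (suc i) ℤ.*_) (geo-> (s≤s n<i))) (ℤ.*-zeroʳ (u s (suc i)))) ⟩
    Σℤ (suc n) (λ a → u s a ℤ.* geo a (suc n))                ≡⟨ ℤ.neg-involutive _ ⟨
    ℤ.- ℤ.- Σℤ (suc n) (λ a → u s a ℤ.* geo a (suc n))        ≡⟨ cong ℤ.-_ (σ*pos≡Σ s n) ⟨
    ℤ.- σ*pos s (suc n)                                       ∎
    where open ≡.≡-Reasoning

  scale-at-0 : ∀ c v → (const c *S L v) 0 ≡ + 0
  scale-at-0 c v = trans (cong (c ℤ.*_) (L-at-0 v)) (ℤ.*-zeroʳ c)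

  scale-at : ∀ c s {n} → suc n ℕ.≤ N → (const c *S ℓ s) (suc n) ≡ c ℤ.* ℤ.- σ*pos s (suc n)
  scale-at c s {n} n<N = trans (const-*S c (ℓ s) (suc n)) (cong (c ℤ.*_) (ℓ-at s n<N))

  p-at-0 : p 0 ≡ + 1
  p-at-0 = cong (λ z → + 1 ℤ.+ z) (scale-at-0 (+ 16) (u 3))

  s₅-at-0 : s₅ 0 ≡ + 1
  s₅-at-0 = cong (λ z → + 1 ℤ.- z) (scale-at-0 (+ 8) (u 5))

  s₇-at-0 : s₇ 0 ≡ + 17
  s₇-at-0 = cong (λ z → + 17 ℤ.+ z) (scale-at-0 (+ 32) (u 7))

  p-at : ∀ {n} → suc n ℕ.≤ N → p (suc n) ≡ ℤ.- + 16 ℤ.* σ*pos 3 (suc n)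
  p-at {n} n<N = trans (cong (λ z → + 0 ℤ.+ z) (scale-at (+ 16) 3 n<N))
    (solve 1 (λ x → k 0 :+ k 16 :* (:- x) := (:- k 16) :* x) refl (σ*pos 3 (suc n)))

  s₅-at : ∀ {n} → suc n ℕ.≤ N → s₅ (suc n) ≡ + 8 ℤ.* σ*pos 5 (suc n)
  s₅-at {n} n<N = trans (cong (λ z → + 0 ℤ.- z) (scale-at (+ 8) 5 n<N))
    (solve 1 (λ x → k 0 :- k 8 :* (:- x) := k 8 :* x) refl (σ*pos 5 (suc n)))

  s₇-at : ∀ {n} → suc n ℕ.≤ N → s₇ (suc n) ≡ ℤ.- + 32 ℤ.* σ*pos 7 (suc n)
  s₇-at {n} n<N = trans (cong (λ z → + 0 ℤ.+ z) (scale-at (+ 32) 7 n<N))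
    (solve 1 (λ x → k 0 :+ k 32 :* (:- x) := (:- k 32) :* x) refl (σ*pos 7 (suc n)))

  Y-at-0 : Y 0 ≡ + 1
  Y-at-0 = cong (λ z → + 1 ℤ.- z) (scale-at-0 (+ 8) (u 1))

  A-at-0 : A 0 ≡ + 1
  A-at-0 = cong₂ (λ y z → + 1 ℤ.+ y ℤ.- z) (scale-at-0 (+ 12) pos) (scale-at-0 (+ 12) (u 1))

  Θ-at-0 : ∀ m → Θ m 0 ≡ + 1
  Θ-at-0 zero    = refl
  Θ-at-0 (suc m) = cong₂ ℤ._+_ (Θ-at-0 m) (trans (const-*S c (mono (suc m ℕ.* suc m)) 0)
    (trans (cong (c ℤ.*_) (mono-other {suc m ℕ.* suc m} {0} (λ ()))) (ℤ.*-zeroʳ c)))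
    where c = + 2 ℤ.* ε (suc m)

  Θ⁸≈p : Θ N ^ 8 ≈ p
  Θ⁸≈p = agree (λ {n} n≤N → ℤ.i-j≡0⇒i≡j ((Θ N ^ 8) n) (p n)
      (ode-zero (Θ N ^ 8 - p) (Y - A) logD-Θ⁸-p resonant n n≤N ℕ.≤-refl))
    where
    -- Y(0) - A(0) = 0, so only the constant terms are left to compare, and both are 1.
    resonant : ∀ {n} → n ℕ.≤ N → + n ≡ Y 0 ℤ.- A 0 → (Θ N ^ 8) n ℤ.- p n ≡ + 0
    resonant {zero}  _ _  = cong₂ ℤ._-_ (^-at-0 (Θ N) 8 (Θ-at-0 N)) p-at-0
    resonant {suc n} _ eq = contradiction (trans eq (cong₂ ℤ._-_ Y-at-0 A-at-0)) λ ()

  Δ : Series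
  Δ = mono 1 *S η²⁴

  etaProd≈∏ : ∀ m → etaProd m ≈ ∏₁ m η²⁴-factor
  etaProd≈∏ zero    = ≈-refl
  etaProd≈∏ (suc m) = *-cong {etaProd m} {∏₁ m η²⁴-factor} {oneMinusQ (suc m) ^S 24} {η²⁴-factor (suc m)} (etaProd≈∏ m)
    (^S≈^ {oneMinusQ (suc m)} {𝟙 - q (suc m)} 24 (pointwise (oneMinusQ≡1-mono m)))

  etaProd≈η²⁴ : etaProd N ≈ η²⁴
  etaProd≈η²⁴ = etaProd≈∏ N

  τ≡Δ : ∀ m → m ≡ N → τ m ≡ Δ m
  τ≡Δ zero    _  = refl
  τ≡Δ (suc m) eq = begin
    etaProd m m          ≡⟨ etaProd-stable m ⟨
    etaProd (suc m) m    ≡⟨ cong (λ k → etaProd k m) eq ⟩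
    etaProd N m          ≡⟨ at etaProd≈η²⁴ (subst (m ℕ.≤_) eq (ℕ.n≤1+n m)) ⟩
    η²⁴ m                ≡⟨ mono-*S-shift 1 η²⁴ m ⟨
    Δ (suc m)            ∎
    where open ≡.≡-Reasoning

  ∏-at-0 : ∀ m → ∏₁ m η²⁴-factor 0 ≡ + 1
  ∏-at-0 zero    = refl
  ∏-at-0 (suc m) = cong₂ ℤ._*_ (∏-at-0 m) (^-at-0 (𝟙 - q (suc m)) 24 refl)

  p³+64Δ≡s₅² : ∀ {n} → n ℕ.≤ N → (p *S (p *S p)) n ℤ.+ + 64 ℤ.* Δ n ≡ (s₅ *S s₅) n
  p³+64Δ≡s₅² {n} n≤N = ℤ.*-cancelˡ-≡ (+ 4) _ _ (sym (ℤ.i-j≡0⇒i≡j _ _ (begin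
    + 4 ℤ.* S ℤ.- + 4 ℤ.* (P ℤ.+ + 64 ℤ.* Δ n)
      ≡⟨ solve 3 (λ S P d → k 4 :* S :- k 4 :* (P :+ k 64 :* d) :=
           k 4 :* (S :- P) :- k 256 :* d) refl S P (Δ n) ⟩
    + 4 ℤ.* (S ℤ.- P) ℤ.- + 256 ℤ.* Δ n
      ≡⟨ cong₂ ℤ._-_ (const-*S (+ 4) ((s₅ *S s₅) +S -S (p *S (p *S p))) n) (const-*S (+ 256) Δ n) ⟨
    H n
      ≡⟨ ode-zero H E logD-V-Δ resonant n n≤N ℕ.≤-refl ⟩
    + 0 ∎)))
    where
    open ≡.≡-Reasoning
    S = (s₅ *S s₅) n
    P = (p *S (p *S p)) n
    H E : Series
    H = V +S -S (const (+ 256) *S Δ)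
    E = (const (+ 3) *S Y) +S -S (const (+ 2) *S A)

    -- Stated for variable series, here and in `at-1`, so that after rewriting with the given
    -- coefficients `refl` computes with numbers only.
    at-0 : ∀ (s p d : Series) → s 0 ≡ + 1 → p 0 ≡ + 1 → d 0 ≡ + 0 →
      ((const (+ 4) *S ((s *S s) +S -S (p *S (p *S p)))) +S -S (const (+ 256) *S d)) 0 ≡ + 0
    at-0 s p d s0 p0 d0 rewrite s0 | p0 | d0 = refl

    at-1 : ∀ (s p d : Series) → s 0 ≡ + 1 → s 1 ≡ + 8 → p 0 ≡ + 1 → p 1 ≡ ℤ.- + 16 → d 1 ≡ + 1 →
      ((const (+ 4) *S ((s *S s) +S -S (p *S (p *S p)))) +S -S (const (+ 256) *S d)) 1 ≡ + 0
    at-1 s p d s0 s1 p0 p1 d1 rewrite s0 | s1 | p0 | p1 | d1 = refl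

    -- E(0) = 3 - 2 = 1. At q the coefficient of s₅² - p³ is 2·8 + 3·16 = 64, and that of Δ is 1.
    resonant : ∀ {n} → n ℕ.≤ N → + n ≡ E 0 → H n ≡ + 0
    resonant {zero}        _   _  = at-0 s₅ p Δ s₅-at-0 p-at-0 refl
    resonant {suc zero}    1≤N _  = at-1 s₅ p Δ s₅-at-0 (s₅-at 1≤N) p-at-0 (p-at 1≤N)
      (trans (mono-*S-shift 1 η²⁴ 0) (∏-at-0 N))
    resonant {suc (suc n)} _   eq = contradiction
      (trans eq (cong₂ (λ y a → + 3 ℤ.* y ℤ.- + 2 ℤ.* a) Y-at-0 A-at-0)) λ ()

  ^S-* : ∀ f g m n k → m ℕ.* n ≡ k → f ^ m ≈ g → f ^S k ≈ g ^ n
  ^S-* f g m n _ refl e = ≈-trans (^S≈^ {f} {f} (m ℕ.* n) ≈-refl)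
    (≈-trans (≈-sym (^-assocʳ f m n)) (^-congˡ n e))

  cube : ∀ f → f ^ 3 ≈ f *S (f *S f)
  cube f = *-congˡ {f} (*-congˡ {f} (pointwise (λ n → trans (*S-comm f oneS n) (one-*S f n))))

  -- The exponent 24 is split as 8·3, which reduces t²⁴ to p³. The series are variables, so that
  -- none of the concrete ones is unfolded.
  ^24-s₅ : ∀ (t p s₅ Δ : Series) → t ^ 8 ≈ p → (p *S (p *S p)) N ℤ.+ + 64 ℤ.* Δ N ≡ (s₅ *S s₅) N → τ N ≡ Δ N →
    (t ^S 24) N ≡ (s₅ *S s₅) N ℤ.- + 64 ℤ.* τ N
  ^24-s₅ t p s₅ Δ t⁸ eq τ≡ = begin
    (t ^S 24) N                        ≡⟨ at (≈-trans {t ^S 24} {p ^ 3} {p *S (p *S p)} (^S-* t p 8 3 24 refl t⁸) (cube p)) ℕ.≤-refl ⟩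
    P                                  ≡⟨ solve 2 (λ P t → P := P :+ k 64 :* t :- k 64 :* t) refl P (τ N) ⟩
    P ℤ.+ + 64 ℤ.* τ N ℤ.- + 64 ℤ.* τ N
      ≡⟨ cong (ℤ._- (+ 64 ℤ.* τ N)) (trans (cong (λ t → P ℤ.+ + 64 ℤ.* t) τ≡) eq) ⟩
    (s₅ *S s₅) N ℤ.- + 64 ℤ.* τ N      ∎
    where
    open ≡.≡-Reasoning
    P = (p *S (p *S p)) N

  -- Of the 17 copies of p³ = s₅² - 64τ, 9 are kept and 8 are replaced by s₅² - 64τ. This gives p s₇
  -- with the remainder 8·64 = 512.
  s₅-s₇ : + 17 ℤ.* ((s₅ *S s₅) N ℤ.- + 64 ℤ.* τ N) ≡ (p *S s₇) N ℤ.- + 512 ℤ.* τ N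
  s₅-s₇ = begin
    + 17 ℤ.* (Q ℤ.- + 64 ℤ.* τ N)
      ≡⟨ cong (λ x → + 17 ℤ.* (x ℤ.- + 64 ℤ.* τ N)) (p³+64Δ≡s₅² ℕ.≤-refl) ⟨
    + 17 ℤ.* (P ℤ.+ + 64 ℤ.* Δ N ℤ.- + 64 ℤ.* τ N)
      ≡⟨ cong (λ t → + 17 ℤ.* (P ℤ.+ + 64 ℤ.* t ℤ.- + 64 ℤ.* τ N)) (τ≡Δ N refl) ⟨
    + 17 ℤ.* (P ℤ.+ + 64 ℤ.* τ N ℤ.- + 64 ℤ.* τ N)
      ≡⟨ solve 2 (λ P t → k 17 :* (P :+ k 64 :* t :- k 64 :* t) :=
           k 9 :* P :+ k 8 :* (P :+ k 64 :* t) :- k 512 :* t) refl P (τ N) ⟩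
    + 9 ℤ.* P ℤ.+ + 8 ℤ.* (P ℤ.+ + 64 ℤ.* τ N) ℤ.- + 512 ℤ.* τ N
      ≡⟨ cong (λ x → + 9 ℤ.* P ℤ.+ + 8 ℤ.* x ℤ.- + 512 ℤ.* τ N)
           (trans (cong (λ t → P ℤ.+ + 64 ℤ.* t) (τ≡Δ N refl)) (p³+64Δ≡s₅² ℕ.≤-refl)) ⟩
    + 9 ℤ.* P ℤ.+ + 8 ℤ.* Q ℤ.- + 512 ℤ.* τ N
      ≡⟨ cong (ℤ._- (+ 512 ℤ.* τ N)) (trans (at p*s₇ ℕ.≤-refl)
           (cong₂ ℤ._+_ (const-*S (+ 9) (p *S (p *S p)) N) (const-*S (+ 8) (s₅ *S s₅) N))) ⟨
    (p *S s₇) N ℤ.- + 512 ℤ.* τ N ∎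
    where
    open ≡.≡-Reasoning
    P = (p *S (p *S p)) N
    Q = (s₅ *S s₅) N

-- Counting representations

θ-of : List ℤ → Series
θ-of []       = zeroS
θ-of (x ∷ xs) = mono ℤ.∣ x ℤ.* x ∣ +S θ-of xs

count : ∀ {k} → List (Vec ℤ k) → ℕ → ℕ
count vs n = length (filter (λ v → sumSq v ℕ.≟ n) vs)

count-∷-below : ∀ {k} x (vs : List (Vec ℤ k)) {n} → n ℕ.< ℤ.∣ x ℤ.* x ∣ → count (map (x ∷_) vs) n ≡ 0
count-∷-below x []       n<c = refl
count-∷-below x (v ∷ vs) {n} n<c = trans
  (cong length (List.filter-reject (λ v → sumSq v ℕ.≟ n) {x ∷ v} {map (x ∷_) vs}
    (λ eq → ℕ.<⇒≱ n<c (subst (ℤ.∣ x ℤ.* x ∣ ℕ.≤_) eq (ℕ.m≤m+n ℤ.∣ x ℤ.* x ∣ (sumSq v))))))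
  (count-∷-below x vs n<c)

count-∷-above : ∀ {k} x (vs : List (Vec ℤ k)) m → count (map (x ∷_) vs) (ℤ.∣ x ℤ.* x ∣ ℕ.+ m) ≡ count vs m
count-∷-above x []       m = refl
count-∷-above x (v ∷ vs) m = case sumSq v ℕ.≟ m of λ where
    (yes eq) → trans (cong length (List.filter-accept (λ v → sumSq v ℕ.≟ c ℕ.+ m) {x ∷ v} {map (x ∷_) vs} (cong (c ℕ.+_) eq)))
      (trans (cong suc (count-∷-above x vs m)) (sym (cong length (List.filter-accept (λ v → sumSq v ℕ.≟ m) {v} {vs} eq))))
    (no ne) → trans (cong length (List.filter-reject (λ v → sumSq v ℕ.≟ c ℕ.+ m) {x ∷ v} {map (x ∷_) vs} (ne ∘ ℕ.+-cancelˡ-≡ c (sumSq v) m)))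
      (trans (count-∷-above x vs m) (sym (cong length (List.filter-reject (λ v → sumSq v ℕ.≟ m) {v} {vs} ne))))
  where c = ℤ.∣ x ℤ.* x ∣

-- Prepending x raises the sum of squares by x², which on generating functions is multiplication by
-- q^{x²}; a sum over all x gives the factor `θ-of xs`.
count-concatMap : ∀ {k} (vs : List (Vec ℤ k)) (f : Series) → (∀ m → + count vs m ≡ f m) →
  ∀ xs n → + count (concatMap (λ x → map (x ∷_) vs) xs) n ≡ (θ-of xs *S f) n
count-concatMap vs f e []       n = sym (zero-*S f n)
count-concatMap vs f e (x ∷ xs) n = begin
  + count (map (x ∷_) vs ++ rest) n
    ≡⟨ cong +_ (trans (cong length (List.filter-++ (λ v → sumSq v ℕ.≟ n) (map (x ∷_) vs) rest))
                      (List.length-++ (filter (λ v → sumSq v ℕ.≟ n) (map (x ∷_) vs)))) ⟩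
  + count (map (x ∷_) vs) n ℤ.+ + count rest n
    ≡⟨ cong₂ ℤ._+_ (head n) (count-concatMap vs f e xs n) ⟩
  (mono ℤ.∣ x ℤ.* x ∣ *S f) n ℤ.+ (θ-of xs *S f) n
    ≡⟨ *S-distribʳ f (mono ℤ.∣ x ℤ.* x ∣) (θ-of xs) n ⟨
  (θ-of (x ∷ xs) *S f) n ∎
  where
  open ≡.≡-Reasoning
  rest = concatMap (λ x → map (x ∷_) vs) xs
  head : ∀ n → + count (map (x ∷_) vs) n ≡ (mono ℤ.∣ x ℤ.* x ∣ *S f) n
  head n with splitAt ℤ.∣ x ℤ.* x ∣ n
  ... | below n<c = trans (cong +_ (count-∷-below x vs n<c)) (sym (mono-*S-below ℤ.∣ x ℤ.* x ∣ f n<c))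
  ... | above m   = trans (cong +_ (count-∷-above x vs m)) (trans (e m) (sym (mono-*S-shift ℤ.∣ x ℤ.* x ∣ f m)))

count-allVecs : ∀ k xs n → + count (allVecs k xs) n ≡ (θ-of xs ^S k) n
count-allVecs zero    xs zero    = refl
count-allVecs zero    xs (suc n) = refl
count-allVecs (suc k) xs n       = count-concatMap (allVecs k xs) (θ-of xs ^S k) (count-allVecs k xs) xs n

-- The substitution q ↦ -q, hence multiplicative. It is the source of the sign (-1)^n in the
-- theorem.
twist : Series → Series
twist f n = ε n ℤ.* f n

twist-*S : ∀ f g n → (twist f *S twist g) n ≡ twist (f *S g) n
twist-*S f g n = trans
  (Σ≤-cong n (λ {j} j≤n → trans
    (solve 4 (λ a x b y → (a :* x) :* (b :* y) := (a :* b) :* (x :* y)) refl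
      (ε j) (f j) (ε (n ℕ.∸ j)) (g (n ℕ.∸ j)))
    (cong (ℤ._* (f j ℤ.* g (n ℕ.∸ j))) (trans (sym (ε-+ j (n ℕ.∸ j))) (cong ε (ℕ.m+[n∸m]≡n j≤n))))))
  (Σ≤-*ˡ n (ε n) (λ j → f j ℤ.* g (n ℕ.∸ j)))
  where open Weights using (solve; _:=_; _:*_)

twist-^S : ∀ {h f} → (∀ n → h n ≡ twist f n) → ∀ k n → (h ^S k) n ≡ twist (f ^S k) n
twist-^S e zero    zero    = refl
twist-^S e zero    (suc n) = sym (ℤ.*-zeroʳ (ε (suc n)))
twist-^S {h} {f} e (suc k) n = trans
  (*S-cong {n} {h} {twist f} {h ^S k} {twist (f ^S k)} (λ {j} _ → e j) (λ {j} _ → twist-^S e k j) ℕ.≤-refl)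
  (twist-*S f (f ^S k) n)

θ-of-++ : ∀ xs ys n → θ-of (xs ++ ys) n ≡ θ-of xs n ℤ.+ θ-of ys n
θ-of-++ []       ys n = sym (ℤ.+-identityˡ _)
θ-of-++ (x ∷ xs) ys n = trans (cong (λ z → mono ℤ.∣ x ℤ.* x ∣ n ℤ.+ z) (θ-of-++ xs ys n))
                              (sym (ℤ.+-assoc (mono ℤ.∣ x ℤ.* x ∣ n) _ _))

θ-of-upTo : ∀ (f : ℕ → ℤ) m n → θ-of (map f (upTo (suc m))) n ≡ θ-of (map f (upTo m)) n ℤ.+ mono (ℤ.∣ f m ∣ ℕ.* ℤ.∣ f m ∣) n
θ-of-upTo f m n = begin
  θ-of (map f (upTo (suc m))) n
    ≡⟨ cong (λ l → θ-of (map f l) n) (List.upTo-∷ʳ m) ⟨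
  θ-of (map f (upTo m ++ m ∷ [])) n
    ≡⟨ cong (λ l → θ-of l n) (List.map-++ f (upTo m) (m ∷ [])) ⟩
  θ-of (map f (upTo m) ++ f m ∷ []) n
    ≡⟨ θ-of-++ (map f (upTo m)) (f m ∷ []) n ⟩
  θ-of (map f (upTo m)) n ℤ.+ (mono ℤ.∣ f m ℤ.* f m ∣ n ℤ.+ + 0)
    ≡⟨ cong (λ z → θ-of (map f (upTo m)) n ℤ.+ z) (trans (ℤ.+-identityʳ _) (cong (λ c → mono c n) (ℤ.abs-* (f m) (f m)))) ⟩
  θ-of (map f (upTo m)) n ℤ.+ mono (ℤ.∣ f m ∣ ℕ.* ℤ.∣ f m ∣) n ∎
  where open ≡.≡-Reasoning

ε-m*m : ∀ m → ε (m ℕ.* m) ≡ ε m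
ε-m*m zero    = refl
ε-m*m (suc m) = begin
  ε (suc m ℕ.+ m ℕ.* suc m)              ≡⟨ ε-+ (suc m) (m ℕ.* suc m) ⟩
  ε (suc m) ℤ.* ε (m ℕ.* suc m)          ≡⟨ cong (λ k → ε (suc m) ℤ.* ε k) (ℕ.*-suc m m) ⟩
  ε (suc m) ℤ.* ε (m ℕ.+ m ℕ.* m)        ≡⟨ cong (ε (suc m) ℤ.*_) (trans (ε-+ m (m ℕ.* m)) (cong (ε m ℤ.*_) (ε-m*m m))) ⟩
  ε (suc m) ℤ.* (ε m ℤ.* ε m)            ≡⟨ cong (ε (suc m) ℤ.*_) (ε-square m) ⟩
  ε (suc m) ℤ.* + 1                      ≡⟨ ℤ.*-identityʳ _ ⟩
  ε (suc m)                              ∎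
  where open ≡.≡-Reasoning

r-value : ∀ k n t {x} → (∀ j → θ-of (intRange n) j ≡ twist t j) → (t ^S k) n ≡ x → + r k n ≡ ε n ℤ.* x
r-value k n t θ≡t eq = trans (count-allVecs k (intRange n) n) (trans (twist-^S θ≡t k n) (cong (ε n ℤ.*_) eq))

module Theta (N : ℕ) where
  open Weights using (solve; _:=_; _:+_; _:*_; k)
  open Products (truncated N) using (Θ)

  twist-term : ∀ m n → mono (suc m ℕ.* suc m) n ℤ.+ mono (suc m ℕ.* suc m) n ≡
    twist (const (+ 2 ℤ.* ε (suc m)) *S mono (suc m ℕ.* suc m)) n
  twist-term m n = trans (go n) (cong (ε n ℤ.*_) (sym (const-*S (+ 2 ℤ.* ε (suc m)) (mono (suc m ℕ.* suc m)) n)))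
    where
    c = suc m ℕ.* suc m
    go : ∀ n → mono c n ℤ.+ mono c n ≡ ε n ℤ.* (+ 2 ℤ.* ε (suc m) ℤ.* mono c n)
    go n = case n ℕ.≟ c of λ where
      (no n≢c) → trans (cong (λ z → z ℤ.+ z) (mono-other n≢c))
        (sym (trans (cong (λ z → ε n ℤ.* (+ 2 ℤ.* ε (suc m) ℤ.* z)) (mono-other n≢c))
          (solve 2 (λ a b → a :* (k 2 :* b :* k 0) := k 0) refl (ε n) (ε (suc m)))))
      (yes refl) → trans (cong (λ z → z ℤ.+ z) (mono-same c))
        (sym (trans (cong₂ (λ e z → e ℤ.* (+ 2 ℤ.* ε (suc m) ℤ.* z)) (ε-m*m (suc m)) (mono-same c))
          (trans (solve 1 (λ a → a :* (k 2 :* a :* k 1) := k 2 :* (a :* a)) refl (ε (suc m)))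
            (cong (+ 2 ℤ.*_) (ε-square (suc m))))))

  -- `Θ` carries the sign (-1)^s at q^{s²}; as s² and s have the same parity, q ↦ -q removes it.
  -- Enlarging the box from m to m + 1 appends one integer to each of its two halves, which gives
  -- the coefficient 2.
  θ-of-intRange : ∀ m n → θ-of (intRange m) n ≡ twist (Θ m) n
  θ-of-intRange zero    zero    = refl
  θ-of-intRange zero    (suc n) = sym (ℤ.*-zeroʳ (ε (suc n)))
  θ-of-intRange (suc m) n = begin
    θ-of (intRange (suc m)) n
      ≡⟨ θ-of-++ (map (λ i → + i) (upTo (suc (suc m)))) (map (λ i → -[1+ i ]) (upTo (suc m))) n ⟩
    θ-of (map (λ i → + i) (upTo (suc (suc m)))) n ℤ.+ θ-of (map (λ i → -[1+ i ]) (upTo (suc m))) n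
      ≡⟨ cong₂ ℤ._+_ (θ-of-upTo (λ i → + i) (suc m) n) (θ-of-upTo (λ i → -[1+ i ]) m n) ⟩
    (a ℤ.+ x) ℤ.+ (b ℤ.+ x)
      ≡⟨ solve 3 (λ a b x → (a :+ x) :+ (b :+ x) := (a :+ b) :+ (x :+ x)) refl a b x ⟩
    (a ℤ.+ b) ℤ.+ (x ℤ.+ x)
      ≡⟨ cong₂ ℤ._+_ (trans (sym (θ-of-++ (map (λ i → + i) (upTo (suc m))) (map (λ i → -[1+ i ]) (upTo m)) n)) (θ-of-intRange m n))
                     (twist-term m n) ⟩
    twist (Θ m) n ℤ.+ twist (const (+ 2 ℤ.* ε (suc m)) *S mono (suc m ℕ.* suc m)) n
      ≡⟨ ℤ.*-distribˡ-+ (ε n) _ _ ⟨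
    twist (Θ (suc m)) n ∎
    where
    open ≡.≡-Reasoning
    a = θ-of (map (λ i → + i) (upTo (suc m))) n
    b = θ-of (map (λ i → -[1+ i ]) (upTo m)) n
    x = mono (suc m ℕ.* suc m) n

-- Passage to ℚ

open import Data.Rational as ℚ using (ℚ; _/_; _*_; _-_; toℚᵘ; fromℚᵘ)
import Data.Rational.Properties as ℚ
open import Data.Rational.Unnormalised as ℚᵘ using (mkℚᵘ)
import Data.Rational.Unnormalised.Properties as ℚᵘ

-- Reduction to lowest terms does not compute on variable numerators, so the arithmetic is
-- transported from unnormalised fractions.
fromℚᵘ-+ : ∀ p q → fromℚᵘ (p ℚᵘ.+ q) ≡ fromℚᵘ p ℚ.+ fromℚᵘ q
fromℚᵘ-+ p q = ℚ.toℚᵘ-injective (begin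
  toℚᵘ (fromℚᵘ (p ℚᵘ.+ q))                    ≈⟨ ℚ.toℚᵘ-fromℚᵘ (p ℚᵘ.+ q) ⟩
  p ℚᵘ.+ q                                    ≈⟨ ℚᵘ.+-cong (ℚ.toℚᵘ-fromℚᵘ p) (ℚ.toℚᵘ-fromℚᵘ q) ⟨
  toℚᵘ (fromℚᵘ p) ℚᵘ.+ toℚᵘ (fromℚᵘ q)        ≈⟨ ℚ.toℚᵘ-homo-+ (fromℚᵘ p) (fromℚᵘ q) ⟨
  toℚᵘ (fromℚᵘ p ℚ.+ fromℚᵘ q)                ∎)
  where open import Relation.Binary.Reasoning.Setoid ℚᵘ.≃-setoid

fromℚᵘ-* : ∀ p q → fromℚᵘ (p ℚᵘ.* q) ≡ fromℚᵘ p * fromℚᵘ q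
fromℚᵘ-* p q = ℚ.toℚᵘ-injective (begin
  toℚᵘ (fromℚᵘ (p ℚᵘ.* q))                    ≈⟨ ℚ.toℚᵘ-fromℚᵘ (p ℚᵘ.* q) ⟩
  p ℚᵘ.* q                                    ≈⟨ ℚᵘ.*-cong (ℚ.toℚᵘ-fromℚᵘ p) (ℚ.toℚᵘ-fromℚᵘ q) ⟨
  toℚᵘ (fromℚᵘ p) ℚᵘ.* toℚᵘ (fromℚᵘ q)        ≈⟨ ℚ.toℚᵘ-homo-* (fromℚᵘ p) (fromℚᵘ q) ⟨
  toℚᵘ (fromℚᵘ p * fromℚᵘ q)                  ∎)
  where open import Relation.Binary.Reasoning.Setoid ℚᵘ.≃-setoid

/1-+ : ∀ x y → (x ℤ.+ y) / 1 ≡ x / 1 ℚ.+ y / 1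
-- The unnormalised sum has the numerator x·1 + y·1, hence the inserted units; the product needs no
-- such adjustment.
/1-+ x y = trans (cong (_/ 1) (cong₂ ℤ._+_ (sym (ℤ.*-identityʳ x)) (sym (ℤ.*-identityʳ y)))) (fromℚᵘ-+ (mkℚᵘ x 0) (mkℚᵘ y 0))

/1-* : ∀ x y → (x ℤ.* y) / 1 ≡ x / 1 * (y / 1)
/1-* x y = fromℚᵘ-* (mkℚᵘ x 0) (mkℚᵘ y 0)

/1-- : ∀ x y → (x ℤ.- y) / 1 ≡ x / 1 - y / 1
/1-- x y = begin
  (x ℤ.- y) / 1                          ≡⟨ ℚ-lemma (x ℤ.- y) ⟨
  ((x ℤ.- y) / 1 ℚ.+ y / 1) - y / 1      ≡⟨ cong (_- y / 1) (/1-+ (x ℤ.- y) y) ⟨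
  (x ℤ.- y ℤ.+ y) / 1 - y / 1            ≡⟨ cong (λ z → z / 1 - y / 1) (cancel x y) ⟩
  x / 1 - y / 1                          ∎
  where
  open ≡.≡-Reasoning
  open Data.Rational.Solver.+-*-Solver
  cancel : ∀ x y → x ℤ.- y ℤ.+ y ≡ x
  cancel = solve-∀
  ℚ-lemma : ∀ z → (z / 1 ℚ.+ y / 1) - y / 1 ≡ z / 1
  ℚ-lemma z = solve 2 (λ z y → (z :+ y) :- y := z) refl (z / 1) (y / 1)

mutual
  partialConv : (f g : ℕ → ℚ) → ℕ → ℕ → ℚ
  partialConv f g n k = _

  conv-suc : ∀ f g m → conv f g (suc m) ≡ partialConv f g (suc m) m ℚ.+ f (suc m) * g (m ℕ.∸ m)
  conv-suc f g m with suc m | ℚ._+_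
  ... | n | _⊕_ = refl

conv-scaled : ∀ {f g : ℕ → ℚ} (F G : Series) c d n →
  (∀ {j} → j ℕ.≤ n → f j ≡ F j / 1 * c) → (∀ {j} → j ℕ.≤ n → g j ≡ G j / 1 * d) →
  conv f g n ≡ (F *S G) n / 1 * (c * d)
conv-scaled {f} {g} F G c d n f≡ g≡ = go n ℕ.≤-refl
  where
  open Data.Rational.Solver.+-*-Solver
  open ≡.≡-Reasoning

  term : ∀ {j} → j ℕ.≤ n → f j * g (n ℕ.∸ j) ≡ (F j ℤ.* G (n ℕ.∸ j)) / 1 * (c * d)
  term {j} j≤n = begin
    f j * g (n ℕ.∸ j)                              ≡⟨ cong₂ _*_ (f≡ j≤n) (g≡ (ℕ.m∸n≤m n j)) ⟩
    F j / 1 * c * (G (n ℕ.∸ j) / 1 * d)            ≡⟨ solve 4 (λ x c y d → x :* c :* (y :* d) := x :* y :* (c :* d)) refl (F j / 1) c (G (n ℕ.∸ j) / 1) d ⟩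
    F j / 1 * (G (n ℕ.∸ j) / 1) * (c * d)          ≡⟨ cong (_* (c * d)) (/1-* (F j) (G (n ℕ.∸ j))) ⟨
    (F j ℤ.* G (n ℕ.∸ j)) / 1 * (c * d)            ∎

  go : ∀ k → k ℕ.≤ n → partialConv f g n k ≡ Σ≤ k (λ j → F j ℤ.* G (n ℕ.∸ j)) / 1 * (c * d)
  go zero    k≤n = term k≤n
  go (suc k) k<n = begin
    partialConv f g n k ℚ.+ f (suc k) * g (n ℕ.∸ suc k)
      ≡⟨ cong₂ ℚ._+_ (go k (ℕ.<⇒≤ k<n)) (term k<n) ⟩
    s / 1 * (c * d) ℚ.+ t / 1 * (c * d)
      ≡⟨ ℚ.*-distribʳ-+ (c * d) (s / 1) (t / 1) ⟨
    (s / 1 ℚ.+ t / 1) * (c * d)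
      ≡⟨ cong (_* (c * d)) (/1-+ s t) ⟨
    (s ℤ.+ t) / 1 * (c * d) ∎
    where
    s = Σ≤ k (λ j → F j ℤ.* G (n ℕ.∸ j))
    t = F (suc k) ℤ.* G (n ℕ.∸ suc k)

unscale : ∀ {x y} a b → y ≡ a ℤ.* x → a / 1 * b ≡ ℚ.1ℚ → x / 1 ≡ y / 1 * b
unscale {x} a b refl ab = sym (begin
  (a ℤ.* x) / 1 * b         ≡⟨ cong (_* b) (/1-* a x) ⟩
  a / 1 * (x / 1) * b       ≡⟨ solve 3 (λ a x b → a :* x :* b := x :* (a :* b)) refl (a / 1) (x / 1) b ⟩
  x / 1 * (a / 1 * b)       ≡⟨ cong (x / 1 *_) ab ⟩
  x / 1 * ℚ.1ℚ              ≡⟨ ℚ.*-identityʳ (x / 1) ⟩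
  x / 1                     ∎)
  where
  open ≡.≡-Reasoning
  open Data.Rational.Solver.+-*-Solver

-- The two formulas for r₂₄

module Main (n : ℕ) where
  open Coefficients n
  open Eisenstein (truncated n) using (p; s₅; s₇)
  open Products (truncated n) using (Θ)
  open Theta n
  open LambertRing (truncated n) using (_≈_; semiring)
  open Algebra.Properties.Semiring.Exp semiring using (_^_)
  open ≡.≡-Reasoning

  -- The conventional value -1/16 at 0 is the constant term 1 of `p` under the same scaling as all
  -- other coefficients; likewise 1/8 for `s₅`, and -17/32 for `s₇`, whose constant term is 17.
  σ*3≡ : ∀ {j} → j ℕ.≤ n → σ*3 j ≡ p j / 1 * (ℤ.- + 1 / 16)
  σ*3≡ {zero}  _   = cong (λ z → z / 1 * (ℤ.- + 1 / 16)) (sym p-at-0)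
  σ*3≡ {suc j} j<n = unscale (ℤ.- + 16) (ℤ.- + 1 / 16) (p-at j<n) refl

  σ*5≡ : ∀ {j} → j ℕ.≤ n → σ*5 j ≡ s₅ j / 1 * (+ 1 / 8)
  σ*5≡ {zero}  _   = cong (λ z → z / 1 * (+ 1 / 8)) (sym s₅-at-0)
  σ*5≡ {suc j} j<n = unscale (+ 8) (+ 1 / 8) (s₅-at j<n) refl

  σ*7≡ : ∀ {j} → j ℕ.≤ n → σ*7 j ≡ s₇ j / 1 * (ℤ.- + 1 / 32)
  σ*7≡ {zero}  _   = cong (λ z → z / 1 * (ℤ.- + 1 / 32)) (sym s₇-at-0)
  σ*7≡ {suc j} j<n = unscale (ℤ.- + 32) (ℤ.- + 1 / 32) (s₇-at j<n) refl

  r24-value : ∀ (t p s₅ Δ : Series) → (∀ j → θ-of (intRange n) j ≡ twist t j) → t ^ 8 ≈ p →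
    (p *S (p *S p)) n ℤ.+ + 64 ℤ.* Δ n ≡ (s₅ *S s₅) n → τ n ≡ Δ n →
    + r24 n ≡ sign n ℤ.* ((s₅ *S s₅) n ℤ.- + 64 ℤ.* τ n)
  r24-value t p s₅ Δ θ≡t t⁸ eq τ≡ = trans
    (r-value 24 n t θ≡t (^24-s₅ t p s₅ Δ t⁸ eq τ≡))
    (cong (ℤ._* ((s₅ *S s₅) n ℤ.- + 64 ℤ.* τ n)) (sym (sign≡ε n)))

  r24≡ : + r24 n ≡ sign n ℤ.* ((s₅ *S s₅) n ℤ.- + 64 ℤ.* τ n)
  r24≡ = r24-value (Θ n) p s₅ Δ (θ-of-intRange n) Θ⁸≈p (p³+64Δ≡s₅² ℕ.≤-refl) (τ≡Δ n refl)

expand : ∀ s x c t → (s ℤ.* (x ℤ.- c ℤ.* t)) / 1 ≡ s / 1 * (x / 1 - c / 1 * (t / 1))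
expand s x c t = trans (/1-* s (x ℤ.- c ℤ.* t)) (cong (s / 1 *_) (trans (/1-- x (c ℤ.* t)) (cong (x / 1 -_) (/1-* c t))))

module Rationals (R s t : ℤ) where
  open ≡.≡-Reasoning
  open Data.Rational.Solver.+-*-Solver

  first : ∀ x C → R ≡ s ℤ.* (x ℤ.- + 64 ℤ.* t) → C ≡ x / 1 * (+ 1 / 8 * (+ 1 / 8)) →
          R / 1 ≡ s / 1 * ((+ 64) / 1) * (C - t / 1)
  first x C R≡ C≡ = begin
    R / 1
      ≡⟨ cong (_/ 1) R≡ ⟩
    (s ℤ.* (x ℤ.- + 64 ℤ.* t)) / 1
      ≡⟨ expand s x (+ 64) t ⟩
    s / 1 * (x / 1 - + 64 / 1 * (t / 1))
      ≡⟨ solve 3 (λ s x t → s :* (x :- con (+ 64 / 1) :* t) := s :* con (+ 64 / 1) :* (x :* con (+ 1 / 8 * (+ 1 / 8)) :- t)) refl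
           (s / 1) (x / 1) (t / 1) ⟩
    s / 1 * ((+ 64) / 1) * (x / 1 * (+ 1 / 8 * (+ 1 / 8)) - t / 1)
      ≡⟨ cong (λ z → s / 1 * ((+ 64) / 1) * (z - t / 1)) C≡ ⟨
    s / 1 * ((+ 64) / 1) * (C - t / 1) ∎

  second : ∀ x y C → R ≡ s ℤ.* x → + 17 ℤ.* x ≡ y ℤ.- + 512 ℤ.* t → C ≡ y / 1 * (ℤ.- + 1 / 16 * (ℤ.- + 1 / 32)) →
           R / 1 ≡ s / 1 * ((+ 512) / 17) * (C - t / 1)
  second x y C R≡ x≡ C≡ = begin
    R / 1
      -- The relation with s₇ is integral only for 17 R, so the factor 1/17 is split off before it
      -- is used.
      ≡⟨ unscale {R} (+ 17) (+ 1 / 17) refl refl ⟩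
    (+ 17 ℤ.* R) / 1 * (+ 1 / 17)
      ≡⟨ cong (λ z → z / 1 * (+ 1 / 17)) 17R≡ ⟩
    (s ℤ.* (y ℤ.- + 512 ℤ.* t)) / 1 * (+ 1 / 17)
      ≡⟨ cong (_* (+ 1 / 17)) (expand s y (+ 512) t) ⟩
    s / 1 * (y / 1 - + 512 / 1 * (t / 1)) * (+ 1 / 17)
      ≡⟨ solve 3 (λ s x t → s :* (x :- con (+ 512 / 1) :* t) :* con (+ 1 / 17) :=
           s :* con (+ 512 / 17) :* (x :* con (ℤ.- + 1 / 16 * (ℤ.- + 1 / 32)) :- t)) refl
           (s / 1) (y / 1) (t / 1) ⟩
    s / 1 * ((+ 512) / 17) * (y / 1 * (ℤ.- + 1 / 16 * (ℤ.- + 1 / 32)) - t / 1)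
      ≡⟨ cong (λ z → s / 1 * ((+ 512) / 17) * (z - t / 1)) C≡ ⟨
    s / 1 * ((+ 512) / 17) * (C - t / 1) ∎
    where
    swap : ∀ s x → + 17 ℤ.* (s ℤ.* x) ≡ s ℤ.* (+ 17 ℤ.* x)
    swap = solve-∀
    17R≡ : + 17 ℤ.* R ≡ s ℤ.* (y ℤ.- + 512 ℤ.* t)
    17R≡ = trans (cong (+ 17 ℤ.*_) R≡) (trans
      (swap s x)
      (cong (s ℤ.*_) x≡))

theorem4p17 : (n : ℕ) →
    ((+ r24 n) / 1 ≡ signℚ n * ((+ 64) / 1) * (conv σ*5 σ*5 n - τℚ n))
    × ((+ r24 n) / 1 ≡ signℚ n * ((+ 512) / 17) * (conv σ*3 σ*7 n - τℚ n))
theorem4p17 n =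
  first ((s₅ *S s₅) n) (conv σ*5 σ*5 n) r24≡ (conv-scaled s₅ s₅ (+ 1 / 8) (+ 1 / 8) n σ*5≡ σ*5≡) ,
  second ((s₅ *S s₅) n ℤ.- + 64 ℤ.* τ n) ((p *S s₇) n) (conv σ*3 σ*7 n) r24≡ s₅-s₇
    (conv-scaled p s₇ (ℤ.- + 1 / 16) (ℤ.- + 1 / 32) n σ*3≡ σ*7≡)
  where
  open Main n
  open Coefficients n using (s₅-s₇)
  open Eisenstein (truncated n) using (p; s₅; s₇)
  open Rationals (+ r24 n) (sign n) (τ n)
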